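{- Let $\varepsilon\in(0,1)$, let $n_1\neq n_2$ be integers with $n_1,n_2\ge 3$, and let $u_1,u_2$ be vertices of the cycles $G_1=C_{n_1}$ and $G_2=C_{n_2}$ respectively. Then $(G_1,u_1)$ and $(G_2,u_2)$ are distinguishable either by $S^{(1)}$ or by $S^{(2)}$.
   Context: $C_n$ denotes the cycle on $n$ vertices. Noisy voter model (NVM) with noise $\varepsilon\in(0,1)$ on a connected (locally finite, with at least two vertices) graph $G$: let $N_G(u)$ be the set of neighbors of $u$. At time $0$, $X_0(u)\sim\mathrm{Bern}(1/2)$ independently over all $u\in V(G)$. For every $t\ge 1$ and $u\in V(G)$, $$X_t(u)=\xi_t(u)Y_t(u)+(1-\xi_t(u))\sum_{v\in N_G(u)}I(\eta_t(u)=v)X_{t-1}(v),$$ where $\xi_t(u)\sim\mathrm{Bern}(\varepsilon)$, $Y_t(u)\sim\mathrm{Bern}(1/2)$, $\eta_t(u)$ is uniform on $N_G(u)$, and all the variables $\xi_t(u),Y_t(u),\eta_t(u)$ ($t\ge1$, $u\in V(G)$) and $X_0(u)$ ($u\in V(G)$) are independent. Write $X_t(G,u)=X_t(u)$. Distinguishability: let $(G_1,u_1),(G_2,u_2)$ be rooted graphs, both running the NVM with the same $\varepsilon$. They are distinguishable by a sequence $S=(S_t)_{t}$, where $S_t$ is a real-valued function of the observations up to time $t$ at a vertex, if there are sets $\mathcal S_1(t),\mathcal S_2(t)\subset\mathbb R$, disjoint for each $t$, such that $$\mathsf P\big[S_t(X_i(G_1,u_1),\,i\le t)\in\mathcal S_1(t),\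 S_t(X_i(G_2,u_2),\,i\le t)\in\mathcal S_2(t)\big]\to1\quad (t\to\infty).$$ Repetition statistic: for $d\in\mathbb N$ and $t>d$, $S^{(d)}_t=\frac1{t-d}\sum_{i=1}^{t-d}I(X_i(u)=X_{i+d}(u))$, where $u$ is the observed vertex, and $S^{(d)}=(S^{(d)}_t)_t$. -}

module Defs where

open import Data.Bool using (Bool; true; false; if_then_else_)
import Data.Bool.Properties as Bool
open import Data.Empty using (⊥-elim)
open import Data.Fin using (Fin; zero; suc; toℕ; fromℕ<)
open import Data.Fin.Properties using (toℕ<n; toℕ-fromℕ<; fromℕ<-toℕ)
import Data.Fin.Properties as Fin
open import Data.Integer using (+_)
open import Data.List
  using (List; []; _∷_; [_]; map; foldr; filter; length; allFin; cartesianProduct; cartesianProductWith)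
open import Data.List.Membership.Propositional using (_∈_)
open import Data.List.Membership.Propositional.Properties using (∈-filter⁺; ∈-allFin)
open import Data.List.Relation.Unary.Any using (here; there)
open import Data.Nat using (ℕ; zero; suc; z≤n; s≤s; _⊔_; _∸_; _%_)
import Data.Nat as ℕ
import Data.Nat.DivMod as ℕ
import Data.Nat.Properties as ℕ
open import Data.Product using (Σ-syntax; ∃-syntax; _×_; _,_; proj₁; proj₂)
open import Data.Rational using (ℚ; 0ℚ; 1ℚ; ½)
import Data.Rational as ℚ
import Data.Rational.Properties as ℚ
open import Data.Rational.Solver using (module +-*-Solver)
open import Data.Sum using (_⊎_; inj₁; inj₂; swap)
open import Data.Vec using (Vec; lookup; tabulate)
open import Function using (_∘_)
open import Level using (0ℓ)
open import Relation.Binary.Construct.Closure.ReflexiveTransitive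
  using (Star; _◅_; _◅◅_; reverse) renaming (ε to stop)
open import Relation.Binary.Core using (Rel)
open import Relation.Binary.Definitions using (Symmetric; Irreflexive; _Respects_)
import Relation.Binary.Definitions as B
open import Relation.Binary.PropositionalEquality
  using (_≡_; _≢_; refl; sym; trans; cong; subst)
open import Relation.Nullary using (¬_; does)
open import Relation.Nullary.Decidable using (_⊎-dec_)
open import Relation.Unary using (Pred; Decidable)

-- Real numbers are Cauchy sequences of rationals, with the setoid equality _≈ᵣ_.
Cauchy : (ℕ → ℚ) → Set
Cauchy f = ∀ δ → 0ℚ ℚ.< δ →
  ∃[ N ] (∀ m n → N ℕ.≤ m → N ℕ.≤ n → ℚ.∣ f m ℚ.- f n ∣ ℚ.< δ)

record ℝ : Set where
  constructor mkℝ
  field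
    seq    : ℕ → ℚ
    cauchy : Cauchy seq

open ℝ public

infix  4 _≈ᵣ_ _<ᵣ_
infixl 6 _+ᵣ_ _-ᵣ_
infixl 7 _*ᵣ_

_≈ᵣ_ : Rel ℝ 0ℓ
x ≈ᵣ y = ∀ δ → 0ℚ ℚ.< δ →
  ∃[ N ] (∀ n → N ℕ.≤ n → ℚ.∣ seq x n ℚ.- seq y n ∣ ℚ.< δ)

_<ᵣ_ : Rel ℝ 0ℓ
x <ᵣ y = ∃[ δ ] (0ℚ ℚ.< δ × ∃[ N ] (∀ n → N ℕ.≤ n → seq x n ℚ.+ δ ℚ.< seq y n))

abstract
  half+half : ∀ δ → ½ ℚ.* δ ℚ.+ ½ ℚ.* δ ≡ δ
  half+half δ = trans (sym (ℚ.*-distribʳ-+ δ ½ ½)) (ℚ.*-identityˡ δ)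

  half-pos : ∀ {δ} → 0ℚ ℚ.< δ → 0ℚ ℚ.< ½ ℚ.* δ
  half-pos {δ} δ>0 = subst (ℚ._< ½ ℚ.* δ) (ℚ.*-zeroʳ ½) (ℚ.*-monoʳ-<-pos ½ δ>0)

  ≤-⊔ˡ : ∀ {a b n} → a ⊔ b ℕ.≤ n → a ℕ.≤ n
  ≤-⊔ˡ {a} {b} = ℕ.≤-trans (ℕ.m≤m⊔n a b)

  ≤-⊔ʳ : ∀ {a b n} → a ⊔ b ℕ.≤ n → b ℕ.≤ n
  ≤-⊔ʳ {a} {b} = ℕ.≤-trans (ℕ.m≤n⊔m a b)

  bounded : ∀ f → Cauchy f → Σ[ N ∈ ℕ ] Σ[ B ∈ ℚ ] (0ℚ ℚ.< B × (∀ n → N ℕ.≤ n → ℚ.∣ f n ∣ ℚ.≤ B))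
  bounded f c with c 1ℚ (ℚ.positive⁻¹ 1ℚ)
  ... | N , h = N , 1ℚ ℚ.+ ℚ.∣ f N ∣
              , ℚ.+-mono-<-≤ (ℚ.positive⁻¹ 1ℚ) (ℚ.0≤∣p∣ (f N))
              , λ n N≤n → begin
                  ℚ.∣ f n ∣                              ≡⟨ cong ℚ.∣_∣ (split (f n) (f N)) ⟩
                  ℚ.∣ (f n ℚ.- f N) ℚ.+ f N ∣            ≤⟨ ℚ.∣p+q∣≤∣p∣+∣q∣ (f n ℚ.- f N) (f N) ⟩
                  ℚ.∣ f n ℚ.- f N ∣ ℚ.+ ℚ.∣ f N ∣        ≤⟨ ℚ.+-monoˡ-≤ ℚ.∣ f N ∣ (ℚ.<⇒≤ (h n N N≤n ℕ.≤-refl)) ⟩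
                  1ℚ ℚ.+ ℚ.∣ f N ∣                       ∎
    where
    open ℚ.≤-Reasoning
    open +-*-Solver
    split : ∀ a b → a ≡ (a ℚ.- b) ℚ.+ b
    split = solve 2 (λ a b → a := (a :- b) :+ b) refl

  const-cauchy : ∀ q → Cauchy (λ _ → q)
  const-cauchy q δ δ>0 = 0 , λ _ _ _ _ → subst (λ z → ℚ.∣ z ∣ ℚ.< δ) (sym (ℚ.+-inverseʳ q)) δ>0

  +-cauchy : ∀ f g → Cauchy f → Cauchy g → Cauchy (λ n → f n ℚ.+ g n)
  +-cauchy f g cf cg δ δ>0 with cf (½ ℚ.* δ) (half-pos δ>0) | cg (½ ℚ.* δ) (half-pos δ>0)
  ... | M , p | N , q = M ⊔ N , λ m n m≥ n≥ → begin-strict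
      ℚ.∣ (f m ℚ.+ g m) ℚ.- (f n ℚ.+ g n) ∣         ≡⟨ cong ℚ.∣_∣ (regroup (f m) (g m) (f n) (g n)) ⟩
      ℚ.∣ (f m ℚ.- f n) ℚ.+ (g m ℚ.- g n) ∣         ≤⟨ ℚ.∣p+q∣≤∣p∣+∣q∣ (f m ℚ.- f n) (g m ℚ.- g n) ⟩
      ℚ.∣ f m ℚ.- f n ∣ ℚ.+ ℚ.∣ g m ℚ.- g n ∣       <⟨ ℚ.+-mono-< (p m n (≤-⊔ˡ m≥) (≤-⊔ˡ n≥)) (q m n (≤-⊔ʳ m≥) (≤-⊔ʳ n≥)) ⟩
      ½ ℚ.* δ ℚ.+ ½ ℚ.* δ                           ≡⟨ half+half δ ⟩
      δ                                             ∎
    where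
    open ℚ.≤-Reasoning
    open +-*-Solver
    regroup : ∀ a b c d → (a ℚ.+ b) ℚ.- (c ℚ.+ d) ≡ (a ℚ.- c) ℚ.+ (b ℚ.- d)
    regroup = solve 4 (λ a b c d → (a :+ b) :- (c :+ d) := (a :- c) :+ (b :- d)) refl

  neg-cauchy : ∀ f → Cauchy f → Cauchy (λ n → ℚ.- f n)
  neg-cauchy f cf δ δ>0 with cf δ δ>0
  ... | N , p = N , λ m n m≥ n≥ → subst (ℚ._< δ) (eq (f m) (f n)) (p m n m≥ n≥)
    where
    open +-*-Solver
    eq : ∀ a b → ℚ.∣ a ℚ.- b ∣ ≡ ℚ.∣ (ℚ.- a) ℚ.- (ℚ.- b) ∣
    eq a b = trans (sym (ℚ.∣-p∣≡∣p∣ (a ℚ.- b)))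
      (cong ℚ.∣_∣ (solve 2 (λ a b → :- (a :- b) := (:- a) :- (:- b)) refl a b))

  shrink : ∀ C η → 0ℚ ℚ.< C → 0ℚ ℚ.< η → ∃[ γ ] (0ℚ ℚ.< γ × C ℚ.* γ ≡ η)
  shrink C η C>0 η>0 =
      ℚ.1/ C ℚ.* η
    , subst (ℚ._< ℚ.1/ C ℚ.* η) (ℚ.*-zeroʳ (ℚ.1/ C))
        (ℚ.*-monoʳ-<-pos (ℚ.1/ C) {{ℚ.1/pos⇒pos C}} η>0)
    , trans (sym (ℚ.*-assoc C (ℚ.1/ C) η))
        (trans (cong (ℚ._* η) (ℚ.*-inverseʳ C)) (ℚ.*-identityˡ η))
    where
    instance
      C-pos : ℚ.Positive C
      C-pos = ℚ.positive C>0
      C-nonZero : ℚ.NonZero C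
      C-nonZero = ℚ.pos⇒nonZero C

  scaled : ∀ {C γ η} p q → 0ℚ ℚ.< C → C ℚ.* γ ≡ η →
    ℚ.∣ p ∣ ℚ.≤ C → ℚ.∣ q ∣ ℚ.< γ → ℚ.∣ p ℚ.* q ∣ ℚ.< η
  scaled {C} {γ} {η} p q C>0 Cγ p≤C q<γ = begin-strict
    ℚ.∣ p ℚ.* q ∣             ≡⟨ ℚ.∣p*q∣≡∣p∣*∣q∣ p q ⟩
    ℚ.∣ p ∣ ℚ.* ℚ.∣ q ∣       ≤⟨ ℚ.*-monoʳ-≤-nonNeg ℚ.∣ q ∣ {{ℚ.nonNegative (ℚ.0≤∣p∣ q)}} p≤C ⟩
    C ℚ.* ℚ.∣ q ∣             <⟨ ℚ.*-monoʳ-<-pos C {{ℚ.positive C>0}} q<γ ⟩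
    C ℚ.* γ                   ≡⟨ Cγ ⟩
    η                         ∎
    where open ℚ.≤-Reasoning

  product-diff : ∀ {C γ δ} a b c d → 0ℚ ℚ.< C → C ℚ.* γ ≡ ½ ℚ.* δ →
    ℚ.∣ a ∣ ℚ.≤ C → ℚ.∣ d ∣ ℚ.≤ C → ℚ.∣ a ℚ.- c ∣ ℚ.< γ → ℚ.∣ b ℚ.- d ∣ ℚ.< γ →
    ℚ.∣ a ℚ.* b ℚ.- c ℚ.* d ∣ ℚ.< δ
  product-diff {C} {γ} {δ} a b c d C>0 Cγ a≤C d≤C ac bd = begin-strict
    ℚ.∣ a ℚ.* b ℚ.- c ℚ.* d ∣
      ≡⟨ cong ℚ.∣_∣ (regroup a b c d) ⟩
    ℚ.∣ a ℚ.* (b ℚ.- d) ℚ.+ d ℚ.* (a ℚ.- c) ∣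
      ≤⟨ ℚ.∣p+q∣≤∣p∣+∣q∣ (a ℚ.* (b ℚ.- d)) (d ℚ.* (a ℚ.- c)) ⟩
    ℚ.∣ a ℚ.* (b ℚ.- d) ∣ ℚ.+ ℚ.∣ d ℚ.* (a ℚ.- c) ∣
      <⟨ ℚ.+-mono-< (scaled a (b ℚ.- d) C>0 Cγ a≤C bd) (scaled d (a ℚ.- c) C>0 Cγ d≤C ac) ⟩
    ½ ℚ.* δ ℚ.+ ½ ℚ.* δ
      ≡⟨ half+half δ ⟩
    δ ∎
    where
    open ℚ.≤-Reasoning
    open +-*-Solver
    regroup : ∀ a b c d → a ℚ.* b ℚ.- c ℚ.* d ≡ a ℚ.* (b ℚ.- d) ℚ.+ d ℚ.* (a ℚ.- c)
    regroup = solve 4 (λ a b c d → a :* b :- c :* d := a :* (b :- d) :+ d :* (a :- c)) refl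

  +-pos : ∀ a b → 0ℚ ℚ.< a → 0ℚ ℚ.< b → 0ℚ ℚ.< a ℚ.+ b
  +-pos a b a>0 b>0 = ℚ.<-trans a>0
    (subst (ℚ._< a ℚ.+ b) (ℚ.+-identityʳ a) (ℚ.+-monoʳ-< a b>0))

  ≤-+ʳ : ∀ p a b → 0ℚ ℚ.< b → p ℚ.≤ a → p ℚ.≤ a ℚ.+ b
  ≤-+ʳ p a b b>0 p≤a = ℚ.≤-trans p≤a
    (subst (ℚ._≤ a ℚ.+ b) (ℚ.+-identityʳ a) (ℚ.+-monoʳ-≤ a (ℚ.<⇒≤ b>0)))

  ≤-+ˡ : ∀ p a b → 0ℚ ℚ.< a → p ℚ.≤ b → p ℚ.≤ a ℚ.+ b
  ≤-+ˡ p a b a>0 p≤b = subst (p ℚ.≤_) (ℚ.+-comm b a) (≤-+ʳ p b a a>0 p≤b)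

  common-bound : ∀ f g → Cauchy f → Cauchy g →
    Σ[ N ∈ ℕ ] Σ[ C ∈ ℚ ] (0ℚ ℚ.< C × (∀ n → N ℕ.≤ n → ℚ.∣ f n ∣ ℚ.≤ C × ℚ.∣ g n ∣ ℚ.≤ C))
  common-bound f g cf cg =
    let K , A , A>0 , fA = bounded f cf
        L , B , B>0 , gB = bounded g cg
    in K ⊔ L , A ℚ.+ B , +-pos A B A>0 B>0 , λ n n≥ →
         ≤-+ʳ ℚ.∣ f n ∣ A B B>0 (fA n (≤-⊔ˡ n≥))
       , ≤-+ˡ ℚ.∣ g n ∣ A B A>0 (gB n (≤-⊔ʳ {K} n≥))

  *-cauchy : ∀ f g → Cauchy f → Cauchy g → Cauchy (λ n → f n ℚ.* g n)
  *-cauchy f g cf cg δ δ>0 =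
    let K , C , C>0 , fg≤C = common-bound f g cf cg
        γ , γ>0 , Cγ = shrink C (½ ℚ.* δ) C>0 (half-pos δ>0)
        M , p = cf γ γ>0
        N , q = cg γ γ>0
    in K ⊔ (M ⊔ N) , λ m n m≥ n≥ →
      product-diff (f m) (g m) (f n) (g n) C>0 Cγ
        (proj₁ (fg≤C m (≤-⊔ˡ {K} m≥))) (proj₂ (fg≤C n (≤-⊔ˡ {K} n≥)))
        (p m n (≤-⊔ˡ {M} (≤-⊔ʳ {K} m≥)) (≤-⊔ˡ {M} (≤-⊔ʳ {K} n≥)))
        (q m n (≤-⊔ʳ {M} (≤-⊔ʳ {K} m≥)) (≤-⊔ʳ {M} (≤-⊔ʳ {K} n≥)))

ratℝ : ℚ → ℝ
ratℝ q = mkℝ (λ _ → q) (const-cauchy q)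

0ᵣ 1ᵣ : ℝ
0ᵣ = ratℝ 0ℚ
1ᵣ = ratℝ 1ℚ

_+ᵣ_ _-ᵣ_ _*ᵣ_ : ℝ → ℝ → ℝ
x +ᵣ y = mkℝ (λ n → seq x n ℚ.+ seq y n) (+-cauchy (seq x) (seq y) (cauchy x) (cauchy y))
x -ᵣ y = mkℝ (λ n → seq x n ℚ.- seq y n)
             (+-cauchy (seq x) (λ n → ℚ.- seq y n) (cauchy x) (neg-cauchy (seq y) (cauchy y)))
x *ᵣ y = mkℝ (λ n → seq x n ℚ.* seq y n) (*-cauchy (seq x) (seq y) (cauchy x) (cauchy y))

sumᵣ : List ℝ → ℝ
sumᵣ = foldr _+ᵣ_ 0ᵣ

-- |aₜ - L| < δ is written as a two-sided bound.
_⟶_ : (ℕ → ℝ) → ℝ → Set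
a ⟶ L = ∀ δ → 0ᵣ <ᵣ δ → ∃[ T ] (∀ t → T ℕ.≤ t → (L <ᵣ a t +ᵣ δ) × (a t <ᵣ L +ᵣ δ))

-- `points` lists every outcome once; `weight` is the probability mass function.
record FinSpace : Set₁ where
  field
    Outcome : Set
    points  : List Outcome
    weight  : Outcome → ℝ

open FinSpace public

prob : (Ω : FinSpace) {A : Pred (Outcome Ω) 0ℓ} → Decidable A → ℝ
prob Ω A? = sumᵣ (map (λ ω → if does (A? ω) then weight Ω ω else 0ᵣ) (points Ω))

Bern : ℝ → FinSpace
Bern p = record
  { Outcome = Bool
  ; points  = true ∷ false ∷ []
  ; weight  = λ b → if b then p else 1ᵣ -ᵣ p
  }

-- The entries of xs are meant to be distinct.
uniformOn : {A : Set} (xs : List A) → .{{ℕ.NonZero (length xs)}} → FinSpace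
uniformOn {A} xs = record
  { Outcome = A
  ; points  = xs
  ; weight  = λ _ → ratℝ (+ 1 ℚ./ length xs)
  }

-- Product measures express independence.
infixr 2 _⊗_

_⊗_ : FinSpace → FinSpace → FinSpace
Ω₁ ⊗ Ω₂ = record
  { Outcome = Outcome Ω₁ × Outcome Ω₂
  ; points  = cartesianProduct (points Ω₁) (points Ω₂)
  ; weight  = λ ω → weight Ω₁ (proj₁ ω) *ᵣ weight Ω₂ (proj₂ ω)
  }

consΠ : ∀ {n} {A : Fin (suc n) → Set} → A zero → (∀ i → A (suc i)) → ∀ i → A i
consΠ a f zero    = a
consΠ a f (suc i) = f i

choices : ∀ {n} {A : Fin n → Set} → (∀ i → List (A i)) → List (∀ i → A i)
choices {zero}  xs = [ (λ ()) ]
choices {suc n} xs = cartesianProductWith consΠ (xs zero) (choices (λ i → xs (suc i)))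

∏ : ∀ {n} → (Fin n → ℝ) → ℝ
∏ {zero}  f = 1ᵣ
∏ {suc n} f = f zero *ᵣ ∏ (f ∘ suc)

⨂ : ∀ {n} → (Fin n → FinSpace) → FinSpace
⨂ Ω = record
  { Outcome = ∀ i → Outcome (Ω i)
  ; points  = choices (λ i → points (Ω i))
  ; weight  = λ ω → ∏ (λ i → weight (Ω i) (ω i))
  }

-- Finite, connected and simple, with at least two vertices.
record Graph : Set₁ where
  field
    order     : ℕ
    Adj       : Rel (Fin order) 0ℓ
    adj?      : B.Decidable Adj
    adj-sym   : Symmetric Adj
    irrefl    : Irreflexive _≡_ Adj
    connected : ∀ u v → Star Adj u v
    2≤order   : 2 ℕ.≤ order

  V : Set
  V = Fin order

  neighbours : V → List V
  neighbours u = filter (adj? u) (allFin order)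

  private
    other : ∀ {n} → 2 ℕ.≤ n → (u : Fin n) → ∃[ v ] u ≢ v
    other (s≤s (s≤s _)) zero    = suc zero , λ ()
    other (s≤s (s≤s _)) (suc u) = zero , λ ()

    nonEmpty : ∀ {A : Set} {x : A} {xs} → x ∈ xs → ℕ.NonZero (length xs)
    nonEmpty (here _)  = _
    nonEmpty (there _) = _

  degree-nonZero : ∀ u → ℕ.NonZero (length (neighbours u))
  degree-nonZero u with other 2≤order u
  ... | v , u≢v with connected u v
  ...   | stop    = ⊥-elim (u≢v refl)
  ...   | uw ◅ _  = nonEmpty (∈-filter⁺ (adj? u) (∈-allFin _) uw)

open Graph public

module _ (n : ℕ) (3≤n : 3 ℕ.≤ n) where

  private
    instance
      n-nonZero : ℕ.NonZero n
      n-nonZero = ℕ.>-nonZero (ℕ.≤-trans (s≤s z≤n) 3≤n)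

  CycleAdj : Rel (Fin n) 0ℓ
  CycleAdj u v = (toℕ v ≡ suc (toℕ u) % n) ⊎ (toℕ u ≡ suc (toℕ v) % n)

  private
    no-loop : ∀ (u : Fin n) → toℕ u ≢ suc (toℕ u) % n
    no-loop u eq with ℕ.m≤n⇒m<n∨m≡n (toℕ<n u)
    ... | inj₁ 1+u<n = ℕ.1+n≢n (sym (trans eq (ℕ.m<n⇒m%n≡m 1+u<n)))
    ... | inj₂ 1+u≡n = ℕ.<⇒≢ 1<n (trans (cong suc (sym u≡0)) 1+u≡n)
      where
      1<n : 1 ℕ.< n
      1<n = ℕ.≤-trans (s≤s (s≤s z≤n)) 3≤n
      u≡0 : toℕ u ≡ 0
      u≡0 = trans eq (trans (cong (_% n) 1+u≡n) (ℕ.n%n≡0 n))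

    fromOrigin : ∀ k (k<n : k ℕ.< n) → Star CycleAdj (fromℕ< (ℕ.≤-trans (s≤s z≤n) k<n)) (fromℕ< k<n)
    fromOrigin zero    k<n = stop
    fromOrigin (suc k) k<n = fromOrigin k (ℕ.<⇒≤ k<n) ◅◅ (inj₁ step ◅ stop)
      where
      step : toℕ (fromℕ< k<n) ≡ suc (toℕ (fromℕ< (ℕ.<⇒≤ k<n))) % n
      step = trans (toℕ-fromℕ< k<n)
        (sym (trans (cong (λ j → suc j % n) (toℕ-fromℕ< (ℕ.<⇒≤ k<n))) (ℕ.m<n⇒m%n≡m k<n)))

    reach : ∀ u → Star CycleAdj (fromℕ< (ℕ.≤-trans (s≤s z≤n) 3≤n)) u
    reach u = subst (Star CycleAdj _) (fromℕ<-toℕ u (toℕ<n u)) (fromOrigin (toℕ u) (toℕ<n u))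

  cycle : Graph
  cycle = record
    { order     = n
    ; Adj       = CycleAdj
    ; adj?      = λ u v → (toℕ v ℕ.≟ suc (toℕ u) % n) ⊎-dec (toℕ u ℕ.≟ suc (toℕ v) % n)
    ; adj-sym   = swap
    ; irrefl    = λ { {u} refl → λ { (inj₁ e) → no-loop u e ; (inj₂ e) → no-loop u e } }
    ; connected = λ u v → reverse swap (reach u) ◅◅ reach v
    ; 2≤order   = ℕ.≤-trans (s≤s (s≤s z≤n)) 3≤n
    }

-- The law of the variables that determine the model up to time t: X₀(u) for
-- every vertex u, and ξₛ(u), Yₛ(u), ηₛ(u) for 1 ≤ s ≤ t; the triple at time s
-- has index s - 1.
NVM : ℝ → Graph → ℕ → FinSpace
NVM ε G t =
  ⨂ (λ (u : V G) → Bern (ratℝ ½)) ⊗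
  ⨂ (λ (s : Fin t) → ⨂ (λ (u : V G) →
      Bern ε ⊗ Bern (ratℝ ½) ⊗ uniformOn (neighbours G u) {{degree-nonZero G u}}))

module _ {ε : ℝ} {G : Graph} {t : ℕ} where

  -- The sum of I(ηₛ(u) = v) Xₛ₋₁(v) over the neighbours v of u is the state
  -- of the vertex ηₛ(u) at time s - 1.
  X : Outcome (NVM ε G t) → (s : ℕ) → .(s ℕ.≤ t) → V G → Bool
  X (X₀ , _)       zero    _   u = X₀ u
  X ω@(_ , noise) (suc s) s<t u =
    let ξ , Y , η = noise (fromℕ< s<t) u
    in if ξ then Y else X ω s (ℕ.<⇒≤ s<t) η

  observations : Outcome (NVM ε G t) → V G → Vec Bool (suc t)
  observations ω u = tabulate (λ s → X ω (toℕ s) (ℕ.s≤s⁻¹ (toℕ<n s)) u)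

Statistic : Set
Statistic = ∀ t → Vec Bool (suc t) → ℝ

record Subsetℝ : Set₁ where
  field
    Mem  : Pred ℝ 0ℓ
    resp : Mem Respects _≈ᵣ_

open Subsetℝ public

Disjoint : Subsetℝ → Subsetℝ → Set
Disjoint 𝒮₁ 𝒮₂ = ∀ x → Mem 𝒮₁ x → ¬ Mem 𝒮₂ x

module _ (ε : ℝ) (G₁ : Graph) (u₁ : V G₁) (G₂ : Graph) (u₂ : V G₂) (S : Statistic) where

  Separated : (𝒮₁ 𝒮₂ : ℕ → Subsetℝ) → ∀ t → Pred (Outcome (NVM ε G₁ t ⊗ NVM ε G₂ t)) 0ℓ
  Separated 𝒮₁ 𝒮₂ t (ω₁ , ω₂) =
    Mem (𝒮₁ t) (S t (observations {ε} {G₁} ω₁ u₁)) × Mem (𝒮₂ t) (S t (observations {ε} {G₂} ω₂ u₂))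

  -- The two models run independently. Decidability of the event gives meaning
  -- to its probability; it holds automatically in classical logic.
  Distinguishable : Set₁
  Distinguishable =
    Σ[ 𝒮₁ ∈ (ℕ → Subsetℝ) ] Σ[ 𝒮₂ ∈ (ℕ → Subsetℝ) ]
      (∀ t → Disjoint (𝒮₁ t) (𝒮₂ t)) ×
      Σ[ sep? ∈ (∀ t → Decidable (Separated 𝒮₁ 𝒮₂ t)) ]
        (λ t → prob (NVM ε G₁ t ⊗ NVM ε G₂ t) (sep? t)) ⟶ 1ᵣ

private
  shifted< : ∀ d t (i : Fin (t ∸ d)) → suc (toℕ i) ℕ.+ d ℕ.< suc t
  shifted< d t i = s≤s (go t d (toℕ<n i))
    where
    go : ∀ t d {k} → k ℕ.< t ∸ d → k ℕ.+ d ℕ.< t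
    go t       zero    {k} lt = subst (ℕ._< t) (sym (ℕ.+-identityʳ k)) lt
    go (suc t) (suc d) {k} lt = subst (ℕ._< suc t) (sym (ℕ.+-suc k d)) (s≤s (go t d lt))

-- The times i ∈ {1, …, t - d} are represented by suc (toℕ i).
repetitions : ∀ d t → Vec Bool (suc t) → List (Fin (t ∸ d))
repetitions d t x = filter (λ i → lookup x (now i) Bool.≟ lookup x (later i)) (allFin (t ∸ d))
  where
  later now : Fin (t ∸ d) → Fin (suc t)
  later i = fromℕ< (shifted< d t i)
  now   i = fromℕ< (ℕ.≤-<-trans (ℕ.m≤m+n (suc (toℕ i)) d) (shifted< d t i))

-- The value 0 over an empty range (t ≤ d) is a convention; it does not affect
-- limits as t → ∞.
frequency : ℕ → ℕ → ℚ
frequency k zero    = 0ℚ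
frequency k (suc m) = + k ℚ./ suc m

repetition : ℕ → Statistic
repetition d t x = ratℝ (frequency (length (repetitions d t x)) (t ∸ d))

{-# OPTIONS --safe #-}

-- Write spins as ±1. Followed backwards in time, a spin is copied along a
-- random walk that dies at the first noise, so the correlation of two spins is
-- the probability that their lineages meet alive. The same linear recursion
-- gives the correlations conditionally on any past configuration, and it
-- contracts at rate (1 - ε)². Hence the second moment of the centred sum of
-- repetitions grows linearly from every initial configuration, and
-- S^(d) concentrates by Chebyshev's inequality.
-- On C_n, the lineages of neighbours never meet when n is even and meet with
-- positive probability when n is odd, so S^(1) separates cycles of different
-- parity. Lineages at distance 2 perform a lazy walk on a cycle of length n/2
-- (n even) or n (n odd), and a comparison argument shows that they meet
-- strictly less often on the longer cycle, so S^(2) separates the rest.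
module Submission where

open import Defs
open import Data.Nat using (ℕ; _≤_; zero; suc; z≤n; s≤s; _%_; _/_; _⊔_; _∸_)
open import Data.Fin using (Fin; zero; suc; toℕ; fromℕ<)
open import Data.Sum using (_⊎_; inj₁; inj₂)
open import Relation.Binary.PropositionalEquality

open import Data.Bool using (Bool; true; false; if_then_else_; not)
import Data.Bool.Properties as Bool
open import Data.Empty using (⊥-elim)
import Data.Fin.Properties as Fin
import Data.Integer as ℤ
import Data.Integer.Properties as ℤ
open import Data.List using (List; []; _∷_; map; _++_; length; filter; tabulate; allFin; cartesianProductWith)
open import Data.List.Membership.Propositional using (_∈_)
open import Data.List.Membership.Propositional.Properties using (∈-filter⁺; ∈-filter⁻; ∈-allFin)
open import Data.List.Membership.Propositional.Properties.WithK using (unique∧set⇒bag)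
open import Data.List.Relation.Binary.BagAndSetEquality using (∼bag⇒↭)
open import Data.List.Relation.Binary.Permutation.Propositional using (_↭_; prep; swap)
  renaming (refl to ↭-refl; trans to ↭-trans)
open import Data.List.Relation.Binary.Permutation.Propositional.Properties using (↭-length)
open import Data.List.Relation.Unary.All using ([]; _∷_)
open import Data.List.Relation.Unary.AllPairs using ([]; _∷_)
open import Data.List.Relation.Unary.Any using (here; there)
open import Data.List.Relation.Unary.Unique.Propositional.Properties using (allFin⁺; filter⁺)
import Data.Nat as ℕ
import Data.Nat.DivMod as ℕ
import Data.Nat.Divisibility as ℕ
open import Data.Nat.Divisibility using (_∣_; divides; _∣?_)
import Data.Nat.Properties as ℕ
open import Data.Product using (∃-syntax; _×_; _,_; proj₁; proj₂)
open import Data.Rational using (ℚ; 0ℚ; 1ℚ; ½; _+_; _*_; _-_; -_; ∣_∣; toℚᵘ)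
  renaming (_≤_ to _≤ℚ_; _<_ to _<ℚ_)
import Data.Rational as ℚ
import Data.Rational.Properties as ℚ
open import Data.Rational.Solver using (module +-*-Solver)
open import Data.Rational.Unnormalised using (mkℚᵘ; *≡*; *≤*) renaming (_≃_ to _≃ᵘ_; _*_ to _*ᵘ_)
import Data.Rational.Unnormalised.Properties as ℚᵘ
import Data.Vec as Vec
open import Data.Vec.Properties using (lookup∘tabulate)
open import Function using (_∘_; id)
open import Function.Bundles using (mk⇔)
open import Level using (0ℓ)
open import Relation.Binary.Definitions using (tri<; tri≈; tri>)
open import Relation.Nullary using (Dec; yes; no; does; ¬_)
open import Relation.Nullary.Decidable using (_×-dec_; map′; dec-true; dec-false)
open import Relation.Unary using (Pred; Decidable)
open +-*-Solver using (solve; _:=_; _:+_; _:*_; _:-_; :-_; con)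

-- The obstacle is uniformity. Distinguishing sets are fixed before the outcome, and a probability
-- is a Cauchy sequence, so each estimate must hold with the same constants at all late indices `k`.
-- The witnesses of `0 < ε < 1` supply them: rationals with `0 < a ≤ 1 - ε ≤ b < 1` at every late
-- `k`, and `C = 1 / (1 - b)`, the sum of the geometric series. No limiting correlation is formed.
-- The sum up to time `t` is centred at the correlation computed with horizon `t`; contraction
-- controls the change of horizon uniformly in `k`, and the Cauchy property is used at one fixed
-- horizon only. This yields a single rational threshold for all late `k` and `t`. The second moment
-- is bounded from every configuration because the induction conditions on the first step, after
-- which the configuration is arbitrary. Lag 2 is forced within a parity class of even cycles: at
-- lag 1 they all have correlation 0.

-- Inequalities between rationals.

0≤1 : 0ℚ ≤ℚ 1ℚ
0≤1 = ℚ.nonNegative⁻¹ 1ℚ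

≤-by : ∀ {a b} c → 0ℚ ≤ℚ c → b ≡ a + c → a ≤ℚ b
≤-by {a} {b} c 0≤c eq = subst₂ _≤ℚ_ (ℚ.+-identityʳ a) (sym eq) (ℚ.+-monoʳ-≤ a 0≤c)

≤⇒0≤- : ∀ {a b} → a ≤ℚ b → 0ℚ ≤ℚ b - a
≤⇒0≤- {a} {b} a≤b = subst (_≤ℚ b - a) (ℚ.+-inverseʳ a) (ℚ.+-monoˡ-≤ (- a) a≤b)

0≤+ : ∀ {a b} → 0ℚ ≤ℚ a → 0ℚ ≤ℚ b → 0ℚ ≤ℚ a + b
0≤+ {a} {b} 0≤a 0≤b = subst (_≤ℚ a + b) (ℚ.+-identityˡ 0ℚ) (ℚ.+-mono-≤ 0≤a 0≤b)

*-monoˡ : ∀ {a b c} → 0ℚ ≤ℚ c → a ≤ℚ b → c * a ≤ℚ c * b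
*-monoˡ {c = c} 0≤c = ℚ.*-monoˡ-≤-nonNeg c {{ℚ.nonNegative 0≤c}}

*-mono : ∀ {a b c d} → 0ℚ ≤ℚ b → 0ℚ ≤ℚ c → a ≤ℚ b → c ≤ℚ d → a * c ≤ℚ b * d
*-mono {a} {b} {c} {d} 0≤b 0≤c a≤b c≤d =
  ℚ.≤-trans (ℚ.*-monoʳ-≤-nonNeg c {{ℚ.nonNegative 0≤c}} a≤b) (*-monoˡ 0≤b c≤d)

0≤* : ∀ {a b} → 0ℚ ≤ℚ a → 0ℚ ≤ℚ b → 0ℚ ≤ℚ a * b
0≤* {a} {b} 0≤a 0≤b = subst (_≤ℚ a * b) (ℚ.*-zeroʳ a) (*-monoˡ 0≤a 0≤b)

0<* : ∀ {a b} → 0ℚ <ℚ a → 0ℚ <ℚ b → 0ℚ <ℚ a * b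
0<* {a} {b} 0<a 0<b = ℚ.positive⁻¹ (a * b)
  {{ℚ.pos*pos⇒pos a {{ℚ.positive 0<a}} b {{ℚ.positive 0<b}}}}

p≤∣p∣ : ∀ p → p ≤ℚ ∣ p ∣
p≤∣p∣ p with ℚ.∣p∣≡p∨∣p∣≡-p p
... | inj₁ eq = ℚ.≤-reflexive (sym eq)
... | inj₂ eq with ℚ.≤-total 0ℚ p
...   | inj₁ 0≤p = ℚ.≤-reflexive (sym (ℚ.0≤p⇒∣p∣≡p 0≤p))
...   | inj₂ p≤0 = ℚ.≤-trans p≤0 (ℚ.0≤∣p∣ p)

-p≤∣p∣ : ∀ p → - p ≤ℚ ∣ p ∣
-p≤∣p∣ p = subst (- p ≤ℚ_) (ℚ.∣-p∣≡∣p∣ p) (p≤∣p∣ (- p))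

∣*∣≤ : ∀ {p q c d} → ∣ p ∣ ≤ℚ c → ∣ q ∣ ≤ℚ d → ∣ p * q ∣ ≤ℚ c * d
∣*∣≤ {p} {q} p≤c q≤d = subst (_≤ℚ _) (sym (ℚ.∣p*q∣≡∣p∣*∣q∣ p q))
  (*-mono (ℚ.≤-trans (ℚ.0≤∣p∣ p) p≤c) (ℚ.0≤∣p∣ q) p≤c q≤d)

∣+∣≤ : ∀ {p q c d} → ∣ p ∣ ≤ℚ c → ∣ q ∣ ≤ℚ d → ∣ p + q ∣ ≤ℚ c + d
∣+∣≤ {p} {q} p≤c q≤d = ℚ.≤-trans (ℚ.∣p+q∣≤∣p∣+∣q∣ p q) (ℚ.+-mono-≤ p≤c q≤d)

∣-∣-triangle : ∀ p q r → ∣ p - r ∣ ≤ℚ ∣ p - q ∣ + ∣ q - r ∣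
∣-∣-triangle p q r = subst (λ z → ∣ z ∣ ≤ℚ ∣ p - q ∣ + ∣ q - r ∣)
  (solve 3 (λ p q r → (p :- q) :+ (q :- r) := p :- r) refl p q r)
  (ℚ.∣p+q∣≤∣p∣+∣q∣ (p - q) (q - r))

-- Finite sums.

∑ : {A : Set} → List A → (A → ℚ) → ℚ
∑ []       f = 0ℚ
∑ (x ∷ xs) f = f x + ∑ xs f

module _ {A : Set} where

  ∑-cong : ∀ (xs : List A) {f g} → (∀ x → f x ≡ g x) → ∑ xs f ≡ ∑ xs g
  ∑-cong []       eq = refl
  ∑-cong (x ∷ xs) eq = cong₂ _+_ (eq x) (∑-cong xs eq)

  ∑-mono : ∀ (xs : List A) {f g} → (∀ x → f x ≤ℚ g x) → ∑ xs f ≤ℚ ∑ xs g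
  ∑-mono []       le = ℚ.≤-refl
  ∑-mono (x ∷ xs) le = ℚ.+-mono-≤ (le x) (∑-mono xs le)

  ∑-+ : ∀ (xs : List A) f g → ∑ xs (λ x → f x + g x) ≡ ∑ xs f + ∑ xs g
  ∑-+ []       f g = refl
  ∑-+ (x ∷ xs) f g = trans (cong ((f x + g x) +_) (∑-+ xs f g))
    (solve 4 (λ a b c d → (a :+ b) :+ (c :+ d) := (a :+ c) :+ (b :+ d)) refl (f x) (g x) (∑ xs f) (∑ xs g))

  ∑-*ˡ : ∀ (xs : List A) c f → ∑ xs (λ x → c * f x) ≡ c * ∑ xs f
  ∑-*ˡ []       c f = sym (ℚ.*-zeroʳ c)
  ∑-*ˡ (x ∷ xs) c f = trans (cong (c * f x +_) (∑-*ˡ xs c f)) (sym (ℚ.*-distribˡ-+ c (f x) (∑ xs f)))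

  ∣∑∣≤ : ∀ (xs : List A) f → ∣ ∑ xs f ∣ ≤ℚ ∑ xs (λ x → ∣ f x ∣)
  ∣∑∣≤ []       f = ℚ.≤-refl
  ∣∑∣≤ (x ∷ xs) f = ℚ.≤-trans (ℚ.∣p+q∣≤∣p∣+∣q∣ (f x) (∑ xs f)) (ℚ.+-monoʳ-≤ ∣ f x ∣ (∣∑∣≤ xs f))

  ∑-++ : ∀ (xs ys : List A) f → ∑ (xs ++ ys) f ≡ ∑ xs f + ∑ ys f
  ∑-++ []       ys f = sym (ℚ.+-identityˡ _)
  ∑-++ (x ∷ xs) ys f = trans (cong (f x +_) (∑-++ xs ys f)) (sym (ℚ.+-assoc (f x) _ _))

  ∑-↭ : ∀ {xs ys : List A} f → xs ↭ ys → ∑ xs f ≡ ∑ ys f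
  ∑-↭ f ↭-refl         = refl
  ∑-↭ f (prep x p)     = cong (f x +_) (∑-↭ f p)
  ∑-↭ f (swap {xs} {ys} x y p) = trans (cong (λ z → f x + (f y + z)) (∑-↭ f p))
    (solve 3 (λ a b c → a :+ (b :+ c) := b :+ (a :+ c)) refl (f x) (f y) (∑ ys f))
  ∑-↭ f (↭-trans p q) = trans (∑-↭ f p) (∑-↭ f q)

∑-map : ∀ {A B : Set} (g : A → B) xs f → ∑ (map g xs) f ≡ ∑ xs (f ∘ g)
∑-map g []       f = refl
∑-map g (x ∷ xs) f = cong (f (g x) +_) (∑-map g xs f)

∑-cartesianProductWith : ∀ {A B C : Set} (h : A → B → C) xs ys f →
  ∑ (cartesianProductWith h xs ys) f ≡ ∑ xs (λ x → ∑ ys (λ y → f (h x y)))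
∑-cartesianProductWith h []       ys f = refl
∑-cartesianProductWith h (x ∷ xs) ys f =
  trans (∑-++ (map (h x) ys) _ f) (cong₂ _+_ (∑-map (h x) ys f) (∑-cartesianProductWith h xs ys f))

-- Expectations on finite product spaces.

-- A probability in Defs is a Cauchy sequence whose k-th term is the rational
-- probability obtained by replacing every weight by its k-th term, so all
-- estimates are made in ℚ at a fixed k.
opaque
  E : (Ω : FinSpace) (k : ℕ) → (Outcome Ω → ℚ) → ℚ
  E Ω k F = ∑ (points Ω) (λ ω → seq (weight Ω ω) k * F ω)

IsProb : FinSpace → ℕ → Set
IsProb Ω k = (∀ ω → 0ℚ ≤ℚ seq (weight Ω ω) k) × E Ω k (λ _ → 1ℚ) ≡ 1ℚ

𝟙 : Bool → ℚ
𝟙 b = if b then 1ℚ else 0ℚ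

opaque
  unfolding E

  seq-prob : ∀ Ω {A : Pred (Outcome Ω) 0ℓ} (A? : Decidable A) k →
    seq (prob Ω A?) k ≡ E Ω k (λ ω → 𝟙 (does (A? ω)))
  seq-prob Ω A? k = go (points Ω)
    where
    term : ∀ (x : ℝ) b → seq (if b then x else 0ᵣ) k ≡ seq x k * 𝟙 b
    term x true  = sym (ℚ.*-identityʳ _)
    term x false = sym (ℚ.*-zeroʳ (seq x k))
    go : ∀ xs → seq (sumᵣ (map (λ ω → if does (A? ω) then weight Ω ω else 0ᵣ) xs)) k
              ≡ ∑ xs (λ ω → seq (weight Ω ω) k * 𝟙 (does (A? ω)))
    go []       = refl
    go (ω ∷ xs) = cong₂ _+_ (term (weight Ω ω) (does (A? ω))) (go xs)

module _ (Ω : FinSpace) (k : ℕ) where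

  private
    w : Outcome Ω → ℚ
    w ω = seq (weight Ω ω) k

  opaque
    unfolding E

    E-cong : ∀ {F G} → (∀ ω → F ω ≡ G ω) → E Ω k F ≡ E Ω k G
    E-cong eq = ∑-cong (points Ω) (λ ω → cong (w ω *_) (eq ω))

    E-+ : ∀ F G → E Ω k (λ ω → F ω + G ω) ≡ E Ω k F + E Ω k G
    E-+ F G = trans (∑-cong (points Ω) (λ ω → ℚ.*-distribˡ-+ (w ω) (F ω) (G ω))) (∑-+ (points Ω) _ _)

    E-*ˡ : ∀ c F → E Ω k (λ ω → c * F ω) ≡ c * E Ω k F
    E-*ˡ c F = trans
      (∑-cong (points Ω) (λ ω → solve 3 (λ a b c → a :* (b :* c) := b :* (a :* c)) refl (w ω) c (F ω)))
      (∑-*ˡ (points Ω) c _)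

    ∣E∣≤E∣∣ : (∀ ω → 0ℚ ≤ℚ w ω) → ∀ F → ∣ E Ω k F ∣ ≤ℚ E Ω k (λ ω → ∣ F ω ∣)
    ∣E∣≤E∣∣ 0≤w F = ℚ.≤-trans (∣∑∣≤ (points Ω) _)
      (ℚ.≤-reflexive (∑-cong (points Ω) (λ ω → trans (ℚ.∣p*q∣≡∣p∣*∣q∣ (w ω) (F ω))
        (cong (_* ∣ F ω ∣) (ℚ.0≤p⇒∣p∣≡p (0≤w ω))))))

    E-mono : (∀ ω → 0ℚ ≤ℚ w ω) → ∀ {F G} → (∀ ω → F ω ≤ℚ G ω) → E Ω k F ≤ℚ E Ω k G
    E-mono 0≤w le = ∑-mono (points Ω) (λ ω → *-monoˡ (0≤w ω) (le ω))

  module _ (isProb : IsProb Ω k) where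

    E-const : ∀ c → E Ω k (λ _ → c) ≡ c
    E-const c = trans (E-cong (λ _ → sym (ℚ.*-identityʳ c)))
      (trans (E-*ˡ c (λ _ → 1ℚ)) (trans (cong (c *_) (proj₂ isProb)) (ℚ.*-identityʳ c)))

    E-≤ : ∀ {F c} → (∀ ω → F ω ≤ℚ c) → E Ω k F ≤ℚ c
    E-≤ {F} {c} le = subst (E Ω k F ≤ℚ_) (E-const c) (E-mono (proj₁ isProb) le)

    ∣E∣≤ : ∀ {F c} → (∀ ω → ∣ F ω ∣ ≤ℚ c) → ∣ E Ω k F ∣ ≤ℚ c
    ∣E∣≤ {F} le = ℚ.≤-trans (∣E∣≤E∣∣ (proj₁ isProb) F) (E-≤ le)

opaque
  unfolding E

  E-⊗ : ∀ Ω₁ Ω₂ k F → E (Ω₁ ⊗ Ω₂) k F ≡ E Ω₁ k (λ a → E Ω₂ k (λ b → F (a , b)))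
  E-⊗ Ω₁ Ω₂ k F = trans (∑-cartesianProductWith _,_ (points Ω₁) (points Ω₂) _)
    (∑-cong (points Ω₁) (λ a → trans
      (∑-cong (points Ω₂) (λ b → ℚ.*-assoc (seq (weight Ω₁ a) k) (seq (weight Ω₂ b) k) (F (a , b))))
      (∑-*ˡ (points Ω₂) (seq (weight Ω₁ a) k) _)))

  E-⨂-suc : ∀ {n} (Ω : Fin (suc n) → FinSpace) k F →
    E (⨂ Ω) k F ≡ E (Ω zero) k (λ a → E (⨂ (λ i → Ω (suc i))) k (λ ω → F (consΠ a ω)))
  E-⨂-suc Ω k F = trans (∑-cartesianProductWith (consΠ {A = λ i → Outcome (Ω i)}) (points (Ω zero)) (choices (λ i → points (Ω (suc i)))) _)
    (∑-cong (points (Ω zero)) (λ a → trans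
      (∑-cong (choices (λ i → points (Ω (suc i)))) (λ ω →
        ℚ.*-assoc (seq (weight (Ω zero) a) k) (seq (∏ (λ i → weight (Ω (suc i)) (ω i))) k) (F (consΠ a ω))))
      (∑-*ˡ (choices (λ i → points (Ω (suc i)))) (seq (weight (Ω zero) a) k) _)))

  E-⨂-zero : ∀ (Ω : Fin 0 → FinSpace) k c → E (⨂ Ω) k (λ _ → c) ≡ c
  E-⨂-zero Ω k c = trans (ℚ.+-identityʳ (1ℚ * c)) (ℚ.*-identityˡ c)

  E-Bern : ∀ p k f → E (Bern p) k f ≡ seq p k * f true + (1ℚ - seq p k) * f false
  E-Bern p k f = cong (seq p k * f true +_) (ℚ.+-identityʳ _)

⊗-isProb : ∀ Ω₁ Ω₂ k → IsProb Ω₁ k → IsProb Ω₂ k → IsProb (Ω₁ ⊗ Ω₂) k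
⊗-isProb Ω₁ Ω₂ k p q =
    (λ ω → 0≤* (proj₁ p (proj₁ ω)) (proj₁ q (proj₂ ω)))
  , trans (E-⊗ Ω₁ Ω₂ k _) (trans (E-cong Ω₁ k (λ _ → proj₂ q)) (proj₂ p))

⨂-isProb : ∀ {n} (Ω : Fin n → FinSpace) k → (∀ i → IsProb (Ω i) k) → IsProb (⨂ Ω) k
⨂-isProb {zero}  Ω k p = (λ _ → 0≤1) , E-⨂-zero Ω k _
⨂-isProb {suc n} Ω k p =
    (λ ω → 0≤* (proj₁ (p zero) (ω zero)) (proj₁ (⨂-isProb (Ω ∘ suc) k (p ∘ suc)) (ω ∘ suc)))
  , trans (E-⨂-suc Ω k _) (trans (E-cong (Ω zero) k (λ _ → proj₂ (⨂-isProb (Ω ∘ suc) k (p ∘ suc)))) (proj₂ (p zero)))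

E-⨂-marginal : ∀ {n} (Ω : Fin n → FinSpace) k → (∀ i → IsProb (Ω i) k) →
  ∀ i (f : Outcome (Ω i) → ℚ) → E (⨂ Ω) k (λ ω → f (ω i)) ≡ E (Ω i) k f
E-⨂-marginal {suc n} Ω k p zero f = trans (E-⨂-suc Ω k _)
  (E-cong (Ω zero) k (λ a → E-const (⨂ (λ i → Ω (suc i))) k (⨂-isProb (Ω ∘ suc) k (p ∘ suc)) (f a)))
E-⨂-marginal {suc n} Ω k p (suc i) f = trans (E-⨂-suc Ω k _)
  (trans (E-const (Ω zero) k (p zero) _) (E-⨂-marginal (Ω ∘ suc) k (p ∘ suc) i f))

E-⨂-independent : ∀ {n} (Ω : Fin n → FinSpace) k → (∀ i → IsProb (Ω i) k) →
  ∀ i j → i ≢ j → (f : Outcome (Ω i) → ℚ) (g : Outcome (Ω j) → ℚ) →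
  E (⨂ Ω) k (λ ω → f (ω i) * g (ω j)) ≡ E (Ω i) k f * E (Ω j) k g
E-⨂-independent {suc n} Ω k p zero zero i≢j f g with () ← i≢j refl
E-⨂-independent {suc n} Ω k p zero (suc j) _ f g = begin
  E (⨂ Ω) k (λ ω → f (ω zero) * g (ω (suc j)))
    ≡⟨ E-⨂-suc Ω k _ ⟩
  E (Ω zero) k (λ a → E (⨂ (Ω ∘ suc)) k (λ ω → f a * g (ω j)))
    ≡⟨ E-cong (Ω zero) k (λ a → trans (E-*ˡ (⨂ (Ω ∘ suc)) k (f a) _)
         (trans (cong (f a *_) (E-⨂-marginal (Ω ∘ suc) k (p ∘ suc) j g)) (ℚ.*-comm (f a) _))) ⟩
  E (Ω zero) k (λ a → E (Ω (suc j)) k g * f a)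
    ≡⟨ E-*ˡ (Ω zero) k (E (Ω (suc j)) k g) f ⟩
  E (Ω (suc j)) k g * E (Ω zero) k f
    ≡⟨ ℚ.*-comm (E (Ω (suc j)) k g) _ ⟩
  E (Ω zero) k f * E (Ω (suc j)) k g ∎
  where open ≡-Reasoning
E-⨂-independent {suc n} Ω k p (suc i) zero i≢j f g =
  trans (E-cong (⨂ Ω) k (λ ω → ℚ.*-comm (f (ω (suc i))) (g (ω zero))))
    (trans (E-⨂-independent Ω k p zero (suc i) (i≢j ∘ sym) g f) (ℚ.*-comm (E (Ω zero) k g) _))
E-⨂-independent {suc n} Ω k p (suc i) (suc j) i≢j f g = trans (E-⨂-suc Ω k _)
  (trans (E-const (Ω zero) k (p zero) _)
    (E-⨂-independent (Ω ∘ suc) k (p ∘ suc) i j (i≢j ∘ cong suc) f g))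

-- Residues and neighbours on the cycle.

module Cycle (n : ℕ) (3≤n : 3 ≤ n) where

  private
    instance
      n-nonZero : ℕ.NonZero n
      n-nonZero = ℕ.>-nonZero (ℕ.≤-trans (s≤s z≤n) 3≤n)

  pos : ℕ → Fin n
  pos a = a ℕ.mod n

  -- Subtracting 1 modulo `n` is done by adding `n - 1`, so both neighbours are residues of natural
  -- numbers.
  succ pred : Fin n → Fin n
  succ u = pos (suc (toℕ u))
  pred u = pos (ℕ.pred n ℕ.+ toℕ u)

  toℕ-pos : ∀ a → toℕ (pos a) ≡ a % n
  toℕ-pos a = Fin.toℕ-fromℕ< (ℕ.m%n<n a n)

  pos-cong : ∀ {a b} → a % n ≡ b % n → pos a ≡ pos b
  pos-cong {a} {b} eq = Fin.toℕ-injective (trans (toℕ-pos a) (trans eq (sym (toℕ-pos b))))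

  pos-toℕ : ∀ u → pos (toℕ u) ≡ u
  pos-toℕ u = Fin.toℕ-injective (trans (toℕ-pos (toℕ u)) (ℕ.m<n⇒m%n≡m (Fin.toℕ<n u)))

  private
    pos-+-toℕ : ∀ c a → pos (c ℕ.+ toℕ (pos a)) ≡ pos (c ℕ.+ a)
    pos-+-toℕ c a = pos-cong (begin
      (c ℕ.+ toℕ (pos a)) % n                   ≡⟨ cong (λ r → (c ℕ.+ r) % n) (toℕ-pos a) ⟩
      (c ℕ.+ a % n) % n                         ≡⟨ ℕ.[m+kn]%n≡m%n (c ℕ.+ a % n) (a / n) n ⟨
      (c ℕ.+ a % n ℕ.+ a / n ℕ.* n) % n         ≡⟨ cong (_% n) (ℕ.+-assoc c (a % n) _) ⟩
      (c ℕ.+ (a % n ℕ.+ a / n ℕ.* n)) % n       ≡⟨ cong (λ r → (c ℕ.+ r) % n) (ℕ.m≡m%n+[m/n]*n a n) ⟨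
      (c ℕ.+ a) % n                             ∎)
      where open ≡-Reasoning

  pos-+-∣ : ∀ a {b} → n ∣ b → pos (a ℕ.+ b) ≡ pos a
  pos-+-∣ a n∣b = pos-cong (ℕ.%-remove-+ʳ a n∣b)

  -- Equal remainders cancel from the Euclidean divisions of `a` and `a + b`, which leaves `b` as a
  -- difference of multiples of `n`.
  pos-≡⇒∣ : ∀ a b → pos a ≡ pos (a ℕ.+ b) → n ∣ b
  pos-≡⇒∣ a b eq = ℕ.∣m+n∣m⇒∣n (divides ((a ℕ.+ b) / n) (ℕ.+-cancelˡ-≡ (a % n) _ _ (begin
      a % n ℕ.+ (a / n ℕ.* n ℕ.+ b)                    ≡⟨ ℕ.+-assoc (a % n) _ b ⟨
      a % n ℕ.+ a / n ℕ.* n ℕ.+ b                      ≡⟨ cong (ℕ._+ b) (ℕ.m≡m%n+[m/n]*n a n) ⟨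
      a ℕ.+ b                                          ≡⟨ ℕ.m≡m%n+[m/n]*n (a ℕ.+ b) n ⟩
      (a ℕ.+ b) % n ℕ.+ (a ℕ.+ b) / n ℕ.* n            ≡⟨ cong (ℕ._+ (a ℕ.+ b) / n ℕ.* n) rem ⟨
      a % n ℕ.+ (a ℕ.+ b) / n ℕ.* n                    ∎)))
      (ℕ.n∣m*n (a / n))
    where
    open ≡-Reasoning
    rem : a % n ≡ (a ℕ.+ b) % n
    rem = trans (sym (toℕ-pos a)) (trans (cong toℕ eq) (toℕ-pos (a ℕ.+ b)))

  succ-pos : ∀ a → succ (pos a) ≡ pos (suc a)
  succ-pos = pos-+-toℕ 1

  private
    pred-n+suc : ∀ a → ℕ.pred n ℕ.+ suc a ≡ a ℕ.+ n
    pred-n+suc a = trans (ℕ.+-suc (ℕ.pred n) a)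
      (trans (cong (ℕ._+ a) (ℕ.suc-pred n)) (ℕ.+-comm n a))

  pred-pos : ∀ a → pred (pos (suc a)) ≡ pos a
  pred-pos a = trans (pos-+-toℕ (ℕ.pred n) (suc a))
    (trans (cong pos (pred-n+suc a)) (pos-+-∣ a ℕ.∣-refl))

  pred-succ : ∀ u → pred (succ u) ≡ u
  pred-succ u = trans (pred-pos (toℕ u)) (pos-toℕ u)

  succ-pred : ∀ u → succ (pred u) ≡ u
  succ-pred u = trans (succ-pos (ℕ.pred n ℕ.+ toℕ u))
    (trans (cong pos (trans (sym (ℕ.+-suc (ℕ.pred n) (toℕ u))) (pred-n+suc (toℕ u))))
      (trans (pos-+-∣ (toℕ u) ℕ.∣-refl) (pos-toℕ u)))

  private
    pred≡pos⇒ : ∀ u → u ≡ pos (suc (toℕ (pred u)))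
    pred≡pos⇒ u = sym (succ-pred u)

  -- Going from `pred u` to `succ u` adds 2, so equality would force `n ∣ 2`, against `3 ≤ n`.
  succ≢pred : ∀ u → succ u ≢ pred u
  succ≢pred u eq = ℕ.<⇒≱ 3≤n (ℕ.∣⇒≤ (pos-≡⇒∣ a 2 (begin
      pos a               ≡⟨ pos-toℕ (pred u) ⟩
      pred u              ≡⟨ eq ⟨
      succ u              ≡⟨ cong succ (pred≡pos⇒ u) ⟩
      succ (pos (suc a))  ≡⟨ succ-pos (suc a) ⟩
      pos (suc (suc a))   ≡⟨ cong pos (ℕ.+-comm 2 a) ⟩
      pos (a ℕ.+ 2)       ∎)))
    where
    open ≡-Reasoning
    a = toℕ (pred u)

  private
    G = cycle n 3≤n

  -- The filtered list is ordered by index, which puts `succ u` first or last depending on `u`,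
  -- hence a permutation. Both lists are free of repetitions and have the same members.
  neighbours-↭ : ∀ u → neighbours G u ↭ succ u ∷ pred u ∷ []
  neighbours-↭ u = ∼bag⇒↭ (unique∧set⇒bag (filter⁺ (adj? G u) (allFin⁺ n)) ((succ≢pred u ∷ []) ∷ [] ∷ [])
    (λ {v} → mk⇔ (to v ∘ proj₂ ∘ ∈-filter⁻ (adj? G u) {xs = allFin n}) (from v)))
    where
    to : ∀ v → Adj G u v → v ∈ succ u ∷ pred u ∷ []
    to v (inj₁ v≡1+u) = here (Fin.toℕ-injective (trans v≡1+u (sym (toℕ-pos (suc (toℕ u))))))
    to v (inj₂ u≡1+v) = there (here (trans (sym (pred-succ v))
      (cong pred (sym (Fin.toℕ-injective {i = u} (trans u≡1+v (sym (toℕ-pos (suc (toℕ v))))))))))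
    from : ∀ v → v ∈ succ u ∷ pred u ∷ [] → v ∈ neighbours G u
    from v (here refl) = ∈-filter⁺ (adj? G u) (∈-allFin _) (inj₁ (toℕ-pos (suc (toℕ u))))
    from v (there (here refl)) = ∈-filter⁺ (adj? G u) (∈-allFin _)
      (inj₂ (trans (cong toℕ (sym (succ-pred u))) (toℕ-pos (suc (toℕ (pred u))))))

  avg : (Fin n → ℚ) → Fin n → ℚ
  avg f u = ½ * (f (succ u) + f (pred u))

  private
    half : ∀ l .{{_ : ℕ.NonZero l}} → l ≡ 2 → ℤ.+ 1 ℚ./ l ≡ ½
    half l refl = refl

  opaque
    unfolding E

    E-neighbours : ∀ k u f → E (uniformOn (neighbours G u) {{degree-nonZero G u}}) k f ≡ avg f u
    E-neighbours k u f = trans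
      (∑-*ˡ (neighbours G u) ((ℤ.+ 1 ℚ./ length (neighbours G u)) {{degree-nonZero G u}}) f)
      (cong₂ _*_ (half (length (neighbours G u)) {{degree-nonZero G u}} (↭-length (neighbours-↭ u)))
        (trans (∑-↭ f (neighbours-↭ u)) (cong (f (succ u) +_) (ℚ.+-identityʳ (f (pred u))))))

  avg-cong : ∀ {f g} → (∀ v → f v ≡ g v) → ∀ u → avg f u ≡ avg g u
  avg-cong eq u = cong₂ (λ x y → ½ * (x + y)) (eq (succ u)) (eq (pred u))

  avg-*ˡ : ∀ c f u → avg (λ v → c * f v) u ≡ c * avg f u
  avg-*ˡ c f u = solve 3 (λ c x y → con ½ :* (c :* x :+ c :* y) := c :* (con ½ :* (x :+ y)))
    refl c (f (succ u)) (f (pred u))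

  avg-mono : ∀ {f g} → (∀ v → f v ≤ℚ g v) → ∀ u → avg f u ≤ℚ avg g u
  avg-mono le u = *-monoˡ (ℚ.nonNegative⁻¹ ½) (ℚ.+-mono-≤ (le (succ u)) (le (pred u)))

  avg-const : ∀ c u → avg (λ _ → c) u ≡ c
  avg-const c u = solve 1 (λ c → con ½ :* (c :+ c) := c) refl c

  avg-- : ∀ f g u → avg f u - avg g u ≡ avg (λ v → f v - g v) u
  avg-- f g u = solve 4 (λ a b c d →
      con ½ :* (a :+ b) :- con ½ :* (c :+ d) := con ½ :* ((a :- c) :+ (b :- d)))
    refl (f (succ u)) (f (pred u)) (g (succ u)) (g (pred u))

  ∣avg∣≤ : ∀ {f c} → (∀ v → ∣ f v ∣ ≤ℚ c) → ∀ u → ∣ avg f u ∣ ≤ℚ c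
  ∣avg∣≤ {f} {c} le u = ℚ.≤-trans
    (∣*∣≤ {c = ½} {d = c + c} ℚ.≤-refl (∣+∣≤ (le (succ u)) (le (pred u)))) (ℚ.≤-reflexive (avg-const c u))

  E-avg : ∀ Ω k (F : Outcome Ω → Fin n → ℚ) u →
    E Ω k (λ ω → avg (F ω) u) ≡ avg (λ v → E Ω k (λ ω → F ω v)) u
  E-avg Ω k F u = trans (E-*ˡ Ω k ½ (λ ω → F ω (succ u) + F ω (pred u)))
    (cong (½ *_) (E-+ Ω k (λ ω → F ω (succ u)) (λ ω → F ω (pred u))))

-- Backward averaging operators and their contraction.

2ℚ : ℚ
2ℚ = 1ℚ + 1ℚ

infixr 8 _^_
_^_ : ℚ → ℕ → ℚ
b ^ zero  = 1ℚ
b ^ suc i = b * b ^ i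

0≤^ : ∀ {b} → 0ℚ ≤ℚ b → ∀ i → 0ℚ ≤ℚ b ^ i
0≤^ 0≤b zero    = 0≤1
0≤^ 0≤b (suc i) = 0≤* 0≤b (0≤^ 0≤b i)

spin : Bool → ℚ
spin b = if b then 1ℚ else - 1ℚ

spin² : ∀ b → spin b * spin b ≡ 1ℚ
spin² true  = refl
spin² false = refl

∣spin∣≤1 : ∀ b → ∣ spin b ∣ ≤ℚ 1ℚ
∣spin∣≤1 true  = ℚ.≤-refl
∣spin∣≤1 false = ℚ.≤-refl

module Averaging (n : ℕ) (3≤n : 3 ≤ n) (α : ℚ) where

  open Cycle n 3≤n

  -- M d is the d-fold backward step of one surviving lineage, L that of two
  -- lineages that coalesce when they meet.
  M : ℕ → (Fin n → ℚ) → Fin n → ℚ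
  M zero    f u = f u
  M (suc d) f u = α * avg (M d f) u

  avg₂ : (Fin n → Fin n → ℚ) → Fin n → Fin n → ℚ
  avg₂ κ u v = avg (λ a → avg (κ a) v) u

  L : (Fin n → Fin n → ℚ) → Fin n → Fin n → ℚ
  L κ u v = if does (u Fin.≟ v) then 1ℚ else α * (α * avg₂ κ u v)

  L^ : ℕ → (Fin n → Fin n → ℚ) → Fin n → Fin n → ℚ
  L^ zero    κ = κ
  L^ (suc i) κ = L (L^ i κ)

  diagonal : Fin n → Fin n → ℚ
  diagonal u v = 𝟙 (does (u Fin.≟ v))

  -- The probability that two lineages meet alive within `i` steps, which is the correlation of two
  -- spins at time `i` when the initial spins are independent and fair.
  meet : ℕ → Fin n → Fin n → ℚ
  meet i = L^ i diagonal

  M-cong : ∀ d {f g} → (∀ v → f v ≡ g v) → ∀ u → M d f u ≡ M d g u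
  M-cong zero    eq u = eq u
  M-cong (suc d) eq u = cong (α *_) (avg-cong (M-cong d eq) u)

  -- Conditioning on the earliest step of the dynamics produces an innermost averaging; `M-suc`,
  -- like `L^-suc` for pairs, absorbs it into the iterate.
  M-suc : ∀ d f u → M d (M 1 f) u ≡ M (suc d) f u
  M-suc zero    f u = refl
  M-suc (suc d) f u = cong (α *_) (avg-cong (M-suc d f) u)

  M-*ˡ : ∀ d c f u → M d (λ v → c * f v) u ≡ c * M d f u
  M-*ˡ zero    c f u = refl
  M-*ˡ (suc d) c f u = trans (cong (α *_) (trans (avg-cong (M-*ˡ d c f) u) (avg-*ˡ c (M d f) u)))
    (solve 3 (λ a c x → a :* (c :* x) := c :* (a :* x)) refl α c (avg (M d f) u))

  E-M : ∀ Ω k (F : Outcome Ω → Fin n → ℚ) d u →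
    E Ω k (λ ω → M d (F ω) u) ≡ M d (λ v → E Ω k (λ ω → F ω v)) u
  E-M Ω k F zero    u = refl
  E-M Ω k F (suc d) u = trans (E-*ˡ Ω k α (λ ω → avg (M d (F ω)) u))
    (cong (α *_) (trans (E-avg Ω k (λ ω → M d (F ω)) u) (avg-cong (E-M Ω k F d) u)))

  L-cong : ∀ {κ κ′} → (∀ u v → κ u v ≡ κ′ u v) → ∀ u v → L κ u v ≡ L κ′ u v
  L-cong eq u v with does (u Fin.≟ v)
  ... | true  = refl
  ... | false = cong (λ z → α * (α * z)) (avg-cong (λ a → avg-cong (eq a) v) u)

  L^-suc : ∀ i κ → L^ i (L κ) ≡ L^ (suc i) κ
  L^-suc zero    κ = refl
  L^-suc (suc i) κ = cong L (L^-suc i κ)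

  L^-+ : ∀ i j κ → L^ (i ℕ.+ j) κ ≡ L^ i (L^ j κ)
  L^-+ zero    j κ = refl
  L^-+ (suc i) j κ = cong L (L^-+ i j κ)

  L^-cong : ∀ i {κ κ′} → (∀ u v → κ u v ≡ κ′ u v) → ∀ u v → L^ i κ u v ≡ L^ i κ′ u v
  L^-cong zero    eq = eq
  L^-cong (suc i) eq = L-cong (L^-cong i eq)

  -- `L` is affine rather than linear, with the constant 1 on the diagonal; it commutes with the
  -- expectation since the total mass is 1.
  E-L^ : ∀ Ω k → IsProb Ω k → (F : Outcome Ω → Fin n → Fin n → ℚ) → ∀ i u v →
    E Ω k (λ ω → L^ i (F ω) u v) ≡ L^ i (λ a b → E Ω k (λ ω → F ω a b)) u v
  E-L^ Ω k p F zero    u v = refl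
  E-L^ Ω k p F (suc i) u v with does (u Fin.≟ v)
  ... | true  = E-const Ω k p 1ℚ
  ... | false = trans (E-*ˡ Ω k α _) (cong (α *_) (trans (E-*ˡ Ω k α _) (cong (α *_)
    (trans (E-avg Ω k (λ ω a → avg (L^ i (F ω) a) v) u)
      (avg-cong (λ a → trans (E-avg Ω k (λ ω → L^ i (F ω) a) v)
        (avg-cong (λ b → E-L^ Ω k p F i a b) v)) u)))))

  module _ {b : ℚ} (0≤α : 0ℚ ≤ℚ α) (α≤b : α ≤ℚ b) (b≤1 : b ≤ℚ 1ℚ) where

    private
      0≤b : 0ℚ ≤ℚ b
      0≤b = ℚ.≤-trans 0≤α α≤b

      α≤1 : α ≤ℚ 1ℚ
      α≤1 = ℚ.≤-trans α≤b b≤1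

      ∣α*∣≤ : ∀ {p c} → ∣ p ∣ ≤ℚ c → ∣ α * p ∣ ≤ℚ α * c
      ∣α*∣≤ = ∣*∣≤ (ℚ.≤-reflexive (ℚ.0≤p⇒∣p∣≡p 0≤α))

    -- Of the two survival factors one is bounded by 1 and the other by `b`, the bound on `α` shared
    -- by all late `k`.
    shrink-≤ : ∀ {c} → 0ℚ ≤ℚ c → α * (α * c) ≤ℚ b * c
    shrink-≤ {c} 0≤c = *-mono 0≤b (0≤* 0≤α 0≤c) α≤b
      (subst (α * c ≤ℚ_) (ℚ.*-identityˡ c) (*-mono 0≤1 0≤c α≤1 ℚ.≤-refl))

    M-contracts : ∀ d {f g c} → 0ℚ ≤ℚ c → (∀ v → ∣ f v - g v ∣ ≤ℚ c) → ∀ u → ∣ M d f u - M d g u ∣ ≤ℚ c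
    M-contracts zero    0≤c le u = le u
    M-contracts (suc d) {f} {g} {c} 0≤c le u = ℚ.≤-trans
      (subst (λ z → ∣ z ∣ ≤ℚ 1ℚ * c) eq
        (∣*∣≤ (subst (_≤ℚ 1ℚ) (sym (ℚ.0≤p⇒∣p∣≡p 0≤α)) α≤1) (∣avg∣≤ (M-contracts d {f} {g} 0≤c le) u)))
      (ℚ.≤-reflexive (ℚ.*-identityˡ c))
      where
      eq : α * avg (λ v → M d f v - M d g v) u ≡ α * avg (M d f) u - α * avg (M d g) u
      eq = trans (cong (α *_) (sym (avg-- (M d f) (M d g) u)))
        (solve 3 (λ a x y → a :* (x :- y) := a :* x :- a :* y) refl α (avg (M d f) u) (avg (M d g) u))

    -- On the diagonal the constants cancel in the difference. Off it, averaging does not increase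
    -- the distance, and the survival of both lineages gives the factor.
    L-contracts : ∀ {κ κ′ c} → 0ℚ ≤ℚ c → (∀ u v → ∣ κ u v - κ′ u v ∣ ≤ℚ c) →
      ∀ u v → ∣ L κ u v - L κ′ u v ∣ ≤ℚ b * c
    L-contracts {κ} {κ′} {c} 0≤c le u v with does (u Fin.≟ v)
    ... | true  = 0≤* 0≤b 0≤c
    ... | false = ℚ.≤-trans
      (subst (λ z → ∣ z ∣ ≤ℚ α * (α * c)) eq
        (∣α*∣≤ (∣α*∣≤ (∣avg∣≤ (λ a → ∣avg∣≤ (le a) v) u))))
      (shrink-≤ 0≤c)
      where
      eq : α * (α * avg (λ a → avg (λ b → κ a b - κ′ a b) v) u)
         ≡ α * (α * avg₂ κ u v) - α * (α * avg₂ κ′ u v)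
      eq = trans
        (cong (λ z → α * (α * z)) (trans
          (avg-cong (λ a → sym (avg-- (κ a) (κ′ a) v)) u)
          (sym (avg-- (λ a → avg (κ a) v) (λ a → avg (κ′ a) v) u))))
        (solve 3 (λ a x y → a :* (a :* (x :- y)) := a :* (a :* x) :- a :* (a :* y)) refl
          α (avg₂ κ u v) (avg₂ κ′ u v))

    L^-contracts : ∀ i {κ κ′ c} → 0ℚ ≤ℚ c → (∀ u v → ∣ κ u v - κ′ u v ∣ ≤ℚ c) →
      ∀ u v → ∣ L^ i κ u v - L^ i κ′ u v ∣ ≤ℚ b ^ i * c
    L^-contracts zero    {κ} {κ′} {c} 0≤c le u v = subst (∣ _ ∣ ≤ℚ_) (sym (ℚ.*-identityˡ c)) (le u v)
    L^-contracts (suc i) {κ} {κ′} {c} 0≤c le u v = subst (∣ _ ∣ ≤ℚ_) (sym (ℚ.*-assoc b (b ^ i) c))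
      (L-contracts {L^ i κ} {L^ i κ′} (0≤* (0≤^ 0≤b i) 0≤c) (L^-contracts i {κ} {κ′} 0≤c le) u v)

    0≤meet : ∀ i u v → 0ℚ ≤ℚ meet i u v
    0≤meet zero u v with does (u Fin.≟ v)
    ... | true  = 0≤1
    ... | false = ℚ.≤-refl
    0≤meet (suc i) u v with does (u Fin.≟ v)
    ... | true  = 0≤1
    ... | false = 0≤* 0≤α (0≤* 0≤α (subst (_≤ℚ avg₂ (meet i) u v) (avg-const 0ℚ u)
      (avg-mono (λ a → subst (_≤ℚ avg (meet i a) v) (avg-const 0ℚ v) (avg-mono (0≤meet i a) v)) u)))

    meet≤1 : ∀ i u v → meet i u v ≤ℚ 1ℚ
    meet≤1 zero u v with does (u Fin.≟ v)
    ... | true  = ℚ.≤-refl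
    ... | false = 0≤1
    meet≤1 (suc i) u v with does (u Fin.≟ v)
    ... | true  = ℚ.≤-refl
    ... | false = ℚ.≤-trans
      (*-monoˡ 0≤α (*-monoˡ 0≤α (subst (avg₂ (meet i) u v ≤ℚ_) (avg-const 1ℚ u)
        (avg-mono (λ a → subst (avg (meet i a) v ≤ℚ_) (avg-const 1ℚ v) (avg-mono (meet≤1 i a) v)) u))))
      (ℚ.≤-trans (shrink-≤ 0≤1) (subst (_≤ℚ 1ℚ) (sym (ℚ.*-identityʳ b)) b≤1))

    ∣M∣≤1 : ∀ d {f} → (∀ v → ∣ f v ∣ ≤ℚ 1ℚ) → ∀ u → ∣ M d f u ∣ ≤ℚ 1ℚ
    ∣M∣≤1 zero    le u = le u
    ∣M∣≤1 (suc d) {f} le u = ∣*∣≤ {c = 1ℚ} {d = 1ℚ} (subst (_≤ℚ 1ℚ) (sym (ℚ.0≤p⇒∣p∣≡p 0≤α)) α≤1) (∣avg∣≤ (∣M∣≤1 d {f} le) u)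

    ∣meet∣≤1 : ∀ i u v → ∣ meet i u v ∣ ≤ℚ 1ℚ
    ∣meet∣≤1 i u v = subst (_≤ℚ 1ℚ) (sym (ℚ.0≤p⇒∣p∣≡p (0≤meet i u v))) (meet≤1 i u v)

    -- Iterates of `L` forget where they start: `meet T` is the `i`-fold image of `meet (T - i)`, so
    -- both sides are images of kernels bounded by 1, hence initially at distance at most 2.
    M-meet-close : ∀ d i T → i ≤ T → ∀ κ → (∀ u v → ∣ κ u v ∣ ≤ℚ 1ℚ) → ∀ u →
      ∣ M d (L^ i κ u) u - M d (meet T u) u ∣ ≤ℚ b ^ i * 2ℚ
    M-meet-close d i T i≤T κ ∣κ∣≤1 u = M-contracts d {L^ i κ u} {meet T u} (0≤* (0≤^ 0≤b i) (ℚ.nonNegative⁻¹ 2ℚ))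
      (λ v → subst (λ κ′ → ∣ L^ i κ u v - κ′ u v ∣ ≤ℚ b ^ i * 2ℚ)
        (trans (sym (L^-+ i (T ℕ.∸ i) diagonal)) (cong meet (ℕ.m+[n∸m]≡n i≤T)))
        (L^-contracts i {κ} {meet (T ℕ.∸ i)} (ℚ.nonNegative⁻¹ 2ℚ) close u v)) u
      where
      close : ∀ u v → ∣ κ u v - meet (T ℕ.∸ i) u v ∣ ≤ℚ 2ℚ
      close u v = ℚ.≤-trans (ℚ.∣p-q∣≤∣p∣+∣q∣ (κ u v) (meet (T ℕ.∸ i) u v))
        (ℚ.+-mono-≤ (∣κ∣≤1 u v) (∣meet∣≤1 (T ℕ.∸ i) u v))

-- Expected spins and products of spins along the dynamics.

module Dynamics (ε : ℝ) (k : ℕ) (0≤ε : 0ℚ ≤ℚ seq ε k) (ε≤1 : seq ε k ≤ℚ 1ℚ)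
                (n : ℕ) (3≤n : 3 ≤ n) where

  α : ℚ
  α = 1ℚ - seq ε k

  open Cycle n 3≤n
  open Averaging n 3≤n α

  private
    G = cycle n 3≤n

  Uniform Site : Fin n → FinSpace
  Uniform u = uniformOn (neighbours G u) {{degree-nonZero G u}}
  Site u = Bern ε ⊗ Bern (ratℝ ½) ⊗ Uniform u

  Step : FinSpace
  Step = ⨂ Site

  Noise : ℕ → FinSpace
  Noise t = ⨂ (λ (_ : Fin t) → Step)

  Config : Set
  Config = Fin n → Bool

  step : Outcome Step → Config → Config
  step ν x u = let ξ , Y , η = ν u in if ξ then Y else x η

  -- Unlike `X`, which recurses on the last time step, `run` consumes the earliest noise first, so
  -- conditioning on the first step restarts it from a new configuration. Beyond the horizon it
  -- stays at the last configuration by default.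
  run : ∀ t → Config → Outcome (Noise t) → ℕ → Config
  run t       x ω zero    = x
  run zero    x ω (suc s) = x
  run (suc t) x ω (suc s) = run t (step (ω zero) x) (ω ∘ suc) s

  Bern-isProb : ∀ p → 0ℚ ≤ℚ seq p k → seq p k ≤ℚ 1ℚ → IsProb (Bern p) k
  Bern-isProb p 0≤p p≤1 = (λ { true → 0≤p ; false → ≤⇒0≤- p≤1 })
    , trans (E-Bern p k (λ _ → 1ℚ)) (solve 1 (λ p → p :* con 1ℚ :+ (con 1ℚ :- p) :* con 1ℚ := con 1ℚ) refl (seq p k))

  coin-isProb : IsProb (Bern (ratℝ ½)) k
  coin-isProb = Bern-isProb (ratℝ ½) (ℚ.nonNegative⁻¹ ½) (≤-by ½ (ℚ.nonNegative⁻¹ ½) refl)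

  Uniform-isProb : ∀ u → IsProb (Uniform u) k
  Uniform-isProb u = (λ _ → ℚ.nonNegative⁻¹ _ {{ℚ.normalize-nonNeg 1 _ {{degree-nonZero G u}}}})
    , trans (E-neighbours k u (λ _ → 1ℚ)) (avg-const 1ℚ u)

  Site-isProb : ∀ u → IsProb (Site u) k
  Site-isProb u = ⊗-isProb (Bern ε) (Bern (ratℝ ½) ⊗ Uniform u) k (Bern-isProb ε 0≤ε ε≤1)
    (⊗-isProb (Bern (ratℝ ½)) (Uniform u) k coin-isProb (Uniform-isProb u))

  Step-isProb : IsProb Step k
  Step-isProb = ⨂-isProb Site k Site-isProb

  Noise-isProb : ∀ t → IsProb (Noise t) k
  Noise-isProb t = ⨂-isProb (λ (_ : Fin t) → Step) k (λ _ → Step-isProb)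

  E-Noise-suc : ∀ t F → E (Noise (suc t)) k F ≡ E Step k (λ ν → E (Noise t) k (λ ω → F (consΠ ν ω)))
  E-Noise-suc t F = E-⨂-suc (λ (_ : Fin (suc t)) → Step) k F

  -- With probability `ε` the new spin is a fair coin, of mean 0; otherwise it copies a uniform
  -- neighbour.
  E-Site : ∀ u x → E (Site u) k (λ ν → spin (if proj₁ ν then proj₁ (proj₂ ν) else x (proj₂ (proj₂ ν))))
                 ≡ α * avg (spin ∘ x) u
  E-Site u x = begin
    E (Site u) k _
      ≡⟨ E-⊗ (Bern ε) _ k _ ⟩
    E (Bern ε) k (λ ξ → E (Bern (ratℝ ½) ⊗ Uniform u) k (λ ν → spin (if ξ then proj₁ ν else x (proj₂ ν))))
      ≡⟨ E-Bern ε k (λ ξ → E (Bern (ratℝ ½) ⊗ Uniform u) k (λ ν → spin (if ξ then proj₁ ν else x (proj₂ ν)))) ⟩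
    seq ε k * E (Bern (ratℝ ½) ⊗ Uniform u) k (spin ∘ proj₁)
      + α * E (Bern (ratℝ ½) ⊗ Uniform u) k (spin ∘ x ∘ proj₂)
      ≡⟨ cong₂ (λ a b → seq ε k * a + α * b) fresh copied ⟩
    seq ε k * 0ℚ + α * avg (spin ∘ x) u
      ≡⟨ solve 3 (λ e a b → e :* con 0ℚ :+ a :* b := a :* b) refl (seq ε k) α (avg (spin ∘ x) u) ⟩
    α * avg (spin ∘ x) u ∎
    where
    open ≡-Reasoning
    fresh : E (Bern (ratℝ ½) ⊗ Uniform u) k (spin ∘ proj₁) ≡ 0ℚ
    fresh = trans (E-⊗ (Bern (ratℝ ½)) (Uniform u) k (spin ∘ proj₁))
      (trans (E-cong (Bern (ratℝ ½)) k (λ Y → E-const (Uniform u) k (Uniform-isProb u) (spin Y)))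
        (E-Bern (ratℝ ½) k spin))
    copied : E (Bern (ratℝ ½) ⊗ Uniform u) k (spin ∘ x ∘ proj₂) ≡ avg (spin ∘ x) u
    copied = trans (E-⊗ (Bern (ratℝ ½)) (Uniform u) k (spin ∘ x ∘ proj₂))
      (trans (E-const (Bern (ratℝ ½)) k coin-isProb _) (E-neighbours k u (spin ∘ x)))

  pairSpin : Config → Fin n → Fin n → ℚ
  pairSpin x u v = spin (x u) * spin (x v)

  ∣pairSpin∣≤1 : ∀ x u v → ∣ pairSpin x u v ∣ ≤ℚ 1ℚ
  ∣pairSpin∣≤1 x u v = ∣*∣≤ (∣spin∣≤1 (x u)) (∣spin∣≤1 (x v))

  E-spin : ∀ x u → E Step k (λ ν → spin (step ν x u)) ≡ M 1 (spin ∘ x) u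
  E-spin x u = trans (E-⨂-marginal Site k Site-isProb u _) (E-Site u x)

  -- A squared spin is 1, which gives the diagonal. Distinct sites have independent noise, so there
  -- the product of the two means is a double average.
  E-pairSpin : ∀ x u v → E Step k (λ ν → pairSpin (step ν x) u v) ≡ L (pairSpin x) u v
  E-pairSpin x u v with u Fin.≟ v
  ... | yes refl = trans (E-cong Step k (λ ν → spin² (step ν x u))) (proj₂ Step-isProb)
  ... | no u≢v = trans (E-⨂-independent Site k Site-isProb u v u≢v _ _)
    (trans (cong₂ _*_ (E-Site u x) (E-Site v x)) (begin
      α * avg σ u * (α * avg σ v)      ≡⟨ solve 3 (λ a x y → a :* x :* (a :* y) := a :* (a :* (y :* x))) refl α (avg σ u) (avg σ v) ⟩
      α * (α * (avg σ v * avg σ u))    ≡⟨ cong (λ z → α * (α * z)) (avg-*ˡ (avg σ v) σ u) ⟨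
      α * (α * avg (λ a → avg σ v * σ a) u)
        ≡⟨ cong (λ z → α * (α * z)) (avg-cong (λ a → trans (ℚ.*-comm (avg σ v) (σ a)) (sym (avg-*ˡ (σ a) σ v))) u) ⟩
      α * (α * avg₂ (pairSpin x) u v)  ∎))
    where
    open ≡-Reasoning
    σ = spin ∘ x

  E-run-spin : ∀ t d x u → d ≤ t → E (Noise t) k (λ ω → spin (run t x ω d u)) ≡ M d (spin ∘ x) u
  E-run-spin t zero x u _ = E-const (Noise t) k (Noise-isProb t) (spin (x u))
  E-run-spin (suc t) (suc d) x u (s≤s d≤t) = begin
    E (Noise (suc t)) k _
      ≡⟨ E-Noise-suc t _ ⟩
    E Step k (λ ν → E (Noise t) k (λ ω → spin (run t (step ν x) ω d u)))
      ≡⟨ E-cong Step k (λ ν → E-run-spin t d (step ν x) u d≤t) ⟩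
    E Step k (λ ν → M d (spin ∘ step ν x) u)
      ≡⟨ E-M Step k (λ ν → spin ∘ step ν x) d u ⟩
    M d (λ v → E Step k (λ ν → spin (step ν x v))) u
      ≡⟨ M-cong d (E-spin x) u ⟩
    M d (M 1 (spin ∘ x)) u
      ≡⟨ M-suc d (spin ∘ x) u ⟩
    M (suc d) (spin ∘ x) u ∎
    where open ≡-Reasoning

  -- Backwards in time, the lineage of the later observation first travels alone for `d` steps, from
  -- `u` to some `v`. The lineages from `u` and `v` then run together for `i` steps and are
  -- evaluated on `x`.
  E-run-pair : ∀ t i d x u → i ℕ.+ d ≤ t →
    E (Noise t) k (λ ω → spin (run t x ω i u) * spin (run t x ω (i ℕ.+ d) u)) ≡ M d (L^ i (pairSpin x) u) u
  E-run-pair t zero d x u d≤t = trans (E-*ˡ (Noise t) k (spin (x u)) _)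
    (trans (cong (spin (x u) *_) (E-run-spin t d x u d≤t)) (sym (M-*ˡ d (spin (x u)) (spin ∘ x) u)))
  E-run-pair (suc t) (suc i) d x u (s≤s i+d≤t) = begin
    E (Noise (suc t)) k _
      ≡⟨ E-Noise-suc t _ ⟩
    E Step k (λ ν → E (Noise t) k (λ ω → spin (run t (step ν x) ω i u) * spin (run t (step ν x) ω (i ℕ.+ d) u)))
      ≡⟨ E-cong Step k (λ ν → E-run-pair t i d (step ν x) u i+d≤t) ⟩
    E Step k (λ ν → M d (L^ i (pairSpin (step ν x)) u) u)
      ≡⟨ E-M Step k (λ ν → L^ i (pairSpin (step ν x)) u) d u ⟩
    M d (λ v → E Step k (λ ν → L^ i (pairSpin (step ν x)) u v)) u
      ≡⟨ M-cong d (λ v → trans (E-L^ Step k Step-isProb (pairSpin ∘ λ ν → step ν x) i u v)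
           (trans (L^-cong i (E-pairSpin x) u v) (cong (λ κ → κ u v) (L^-suc i (pairSpin x))))) u ⟩
    M d (L^ (suc i) (pairSpin x) u) u ∎
    where open ≡-Reasoning

-- Second moment of the centred sum.

ι : ℕ → ℚ
ι zero    = 0ℚ
ι (suc m) = 1ℚ + ι m

module Excess (d : ℕ) (R : ℚ) where

  g : (ℕ → Bool) → ℕ → ℚ
  g β i = spin (β i) * spin (β (i ℕ.+ d)) - R

  W : (ℕ → Bool) → ℕ → ℕ → ℚ
  W β i zero    = 0ℚ
  W β i (suc m) = g β i + W β (suc i) m

  -- Once the first step is conditioned on, the path is read one step later; this lowers the start
  -- of the window accordingly.
  W-shift : ∀ β i m → W β (suc i) m ≡ W (β ∘ suc) i m
  W-shift β i zero    = refl
  W-shift β i (suc m) = cong (g β (suc i) +_) (W-shift β (suc i) m)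

module MomentBound (C : ℚ) (0≤C : 0ℚ ≤ℚ C) where

  -- Bounds the expected product of the term at 0 with a window that starts `e` places before `d`:
  -- each of these `e` places costs the crude `2 * 2`, and everything from `d` on costs
  -- `2 * (2 * C)`.
  crossBound : ℕ → ℚ
  crossBound zero    = 2ℚ * (2ℚ * C)
  crossBound (suc e) = 2ℚ * 2ℚ + crossBound e

  0≤crossBound : ∀ e → 0ℚ ≤ℚ crossBound e
  0≤crossBound zero    = 0≤* (ℚ.nonNegative⁻¹ 2ℚ) (0≤* (ℚ.nonNegative⁻¹ 2ℚ) 0≤C)
  0≤crossBound (suc e) = 0≤+ (ℚ.nonNegative⁻¹ (2ℚ * 2ℚ)) (0≤crossBound e)

  -- The cost of adding one term to the square: its own square and twice its product with the window
  -- starting at 1, that is `d′` places before `d = suc d′`.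
  momentBound : ℕ → ℚ
  momentBound d′ = 2ℚ * 2ℚ + 2ℚ * crossBound d′

module SecondMoment (ε : ℝ) (k : ℕ) (0≤ε : 0ℚ ≤ℚ seq ε k) (ε≤1 : seq ε k ≤ℚ 1ℚ)
                    (n : ℕ) (3≤n : 3 ≤ n) (b C : ℚ)
                    (α≤b : 1ℚ - seq ε k ≤ℚ b) (b≤1 : b ≤ℚ 1ℚ) (0≤C : 0ℚ ≤ℚ C) (1+bC≡C : 1ℚ + b * C ≡ C)
                    (d′ T : ℕ) (u : Fin n) where

  open Dynamics ε k 0≤ε ε≤1 n 3≤n
  open Averaging n 3≤n α
  open MomentBound C 0≤C

  private
    d : ℕ
    d = suc d′

    0≤α : 0ℚ ≤ℚ α
    0≤α = ≤⇒0≤- ε≤1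

    0≤b : 0ℚ ≤ℚ b
    0≤b = ℚ.≤-trans 0≤α α≤b

    K : ℚ
    K = momentBound d′

    0≤2C : 0ℚ ≤ℚ 2ℚ * C
    0≤2C = 0≤* (ℚ.nonNegative⁻¹ 2ℚ) 0≤C

  -- The horizon `T` is kept finite and stands in for the limiting correlation; every time `i ≤ T`
  -- is within `b ^ i * 2` of it.
  centre : ℚ
  centre = M d (meet T u) u

  open Excess d centre

  private
    obs : ∀ t → Config → Outcome (Noise t) → ℕ → Bool
    obs t x ω s = run t x ω s u

    ∣g∣≤2 : ∀ β i → ∣ g β i ∣ ≤ℚ 2ℚ
    ∣g∣≤2 β i = ℚ.≤-trans (ℚ.∣p-q∣≤∣p∣+∣q∣ (spin (β i) * spin (β (i ℕ.+ d))) centre)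
      (ℚ.+-mono-≤ (∣*∣≤ (∣spin∣≤1 (β i)) (∣spin∣≤1 (β (i ℕ.+ d))))
        (∣M∣≤1 0≤α α≤b b≤1 d {meet T u} (∣meet∣≤1 0≤α α≤b b≤1 T u) u))

  -- The term at time `i` has mean within `b ^ i * 2` of 0 by `M-meet-close`, and `1 + b * C ≡ C`
  -- closes the geometric series. The last term looks at time `i + m - 1 + d = i + m + d′`.
  ∣E-W∣≤ : ∀ t x i m → i ℕ.+ m ℕ.+ d′ ≤ t → t ≤ T →
    ∣ E (Noise t) k (λ ω → W (obs t x ω) i m) ∣ ≤ℚ b ^ i * (2ℚ * C)
  ∣E-W∣≤ t x i zero _ _ = subst (λ z → ∣ z ∣ ≤ℚ b ^ i * (2ℚ * C))
    (sym (E-const (Noise t) k (Noise-isProb t) 0ℚ)) (0≤* (0≤^ 0≤b i) 0≤2C)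
  ∣E-W∣≤ t x i (suc m) le t≤T = begin
    ∣ E (Noise t) k (λ ω → g (obs t x ω) i + W (obs t x ω) (suc i) m) ∣
      ≡⟨ cong ∣_∣ (trans (E-+ (Noise t) k _ _) (cong (_+ E (Noise t) k (λ ω → W (obs t x ω) (suc i) m)) (trans (E-+ (Noise t) k _ _)
           (cong₂ _+_ (E-run-pair t i d x u i+d≤t) (E-const (Noise t) k (Noise-isProb t) (- centre)))))) ⟩
    ∣ (M d (L^ i (pairSpin x) u) u - centre) + E (Noise t) k (λ ω → W (obs t x ω) (suc i) m) ∣
      ≤⟨ ∣+∣≤ (M-meet-close 0≤α α≤b b≤1 d i T i≤T (pairSpin x) (∣pairSpin∣≤1 x) u)
           (∣E-W∣≤ t x (suc i) m (subst (λ z → z ℕ.+ d′ ≤ t) (ℕ.+-suc i m) le) t≤T) ⟩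
    b ^ i * 2ℚ + b * b ^ i * (2ℚ * C)
      ≡⟨ solve 4 (λ p b c two → p :* two :+ b :* p :* (two :* c) := p :* (two :* (con 1ℚ :+ b :* c)))
           refl (b ^ i) b C 2ℚ ⟩
    b ^ i * (2ℚ * (1ℚ + b * C))
      ≡⟨ cong (λ z → b ^ i * (2ℚ * z)) 1+bC≡C ⟩
    b ^ i * (2ℚ * C) ∎
    where
    open ℚ.≤-Reasoning
    i+d≤t : i ℕ.+ d ≤ t
    i+d≤t = ℕ.≤-trans (ℕ.≤-trans (ℕ.≤-reflexive (sym (ℕ.+-assoc i 1 d′)))
      (ℕ.+-monoˡ-≤ d′ (ℕ.+-monoʳ-≤ i (s≤s (z≤n {m}))))) le
    i≤T : i ≤ T
    i≤T = ℕ.≤-trans (ℕ.m≤m+n i d) (ℕ.≤-trans i+d≤t t≤T)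

  -- Markov property at time `e`: after conditioning on the first `e` steps, `φ` is a constant of
  -- size at most 2 and the window starts at 0 from an arbitrary configuration.
  ∣E-φW∣≤ : ∀ e t x (φ : Bool → ℚ) → (∀ y → ∣ φ y ∣ ≤ℚ 2ℚ) → ∀ m → e ℕ.+ m ℕ.+ d′ ≤ t → t ≤ T →
    ∣ E (Noise t) k (λ ω → φ (obs t x ω e) * W (obs t x ω) e m) ∣ ≤ℚ 2ℚ * (2ℚ * C)
  ∣E-φW∣≤ zero t x φ ∣φ∣≤2 m le t≤T = subst (λ z → ∣ z ∣ ≤ℚ 2ℚ * (2ℚ * C))
    (sym (E-*ˡ (Noise t) k (φ (x u)) _))
    (∣*∣≤ (∣φ∣≤2 (x u)) (subst (∣ E (Noise t) k (λ ω → W (obs t x ω) 0 m) ∣ ≤ℚ_)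
      (ℚ.*-identityˡ (2ℚ * C)) (∣E-W∣≤ t x 0 m le t≤T)))
  ∣E-φW∣≤ (suc e) (suc t) x φ ∣φ∣≤2 m (s≤s le) t<T = subst (λ z → ∣ z ∣ ≤ℚ 2ℚ * (2ℚ * C))
    (sym (trans (E-Noise-suc t _) (E-cong Step k (λ ν → E-cong (Noise t) k (λ ω →
      cong (φ (obs t (step ν x) ω e) *_) (W-shift (obs (suc t) x (consΠ ν ω)) e m))))))
    (∣E∣≤ Step k Step-isProb (λ ν → ∣E-φW∣≤ e t (step ν x) φ ∣φ∣≤2 m le (ℕ.<⇒≤ t<T)))

  -- The term at 0 involves times 0 and `d` only, so it is a function of the spin at `d` once `x` is
  -- given. Terms before `d` are bounded one by one until the Markov property applies.
  ∣E-gW∣≤ : ∀ e i → e ℕ.+ i ≡ d → ∀ t x m → i ℕ.+ m ℕ.+ d′ ≤ t → t ≤ T →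
    ∣ E (Noise t) k (λ ω → g (obs t x ω) 0 * W (obs t x ω) i m) ∣ ≤ℚ crossBound e
  ∣E-gW∣≤ zero i refl t x m le t≤T = ∣E-φW∣≤ d t x (λ y → spin (x u) * spin y - centre)
    -- An artificial path with value `x u` at 0 and `y` later turns the bound on `g` into the bound
    -- required of `φ`.
    (λ y → ∣g∣≤2 (λ { zero → x u ; (suc _) → y }) 0) m le t≤T
  ∣E-gW∣≤ (suc e) i eq t x zero _ _ = subst (λ z → ∣ z ∣ ≤ℚ crossBound (suc e))
    (sym (trans (E-cong (Noise t) k (λ ω → ℚ.*-zeroʳ (g (obs t x ω) 0)))
      (E-const (Noise t) k (Noise-isProb t) 0ℚ))) (0≤crossBound (suc e))
  ∣E-gW∣≤ (suc e) i eq t x (suc m) le t≤T = subst (λ z → ∣ z ∣ ≤ℚ crossBound (suc e))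
    (sym (trans (E-cong (Noise t) k (λ ω → ℚ.*-distribˡ-+ (g (obs t x ω) 0) (g (obs t x ω) i) _)) (E-+ (Noise t) k _ _)))
    (∣+∣≤ (∣E∣≤ (Noise t) k (Noise-isProb t) (λ ω → ∣*∣≤ (∣g∣≤2 (obs t x ω) 0) (∣g∣≤2 (obs t x ω) i)))
      (∣E-gW∣≤ e (suc i) (trans (ℕ.+-suc e i) eq) t x m (subst (λ z → z ℕ.+ d′ ≤ t) (ℕ.+-suc i m) le) t≤T))

  -- Split off the first term and expand the square: `K` pays for its square and the cross term, and
  -- the remaining window restarts after one step from an arbitrary configuration. The window
  -- starting at 1 in `E-W²≤-tail` is also that of the repetition statistic.
  E-W²≤ : ∀ m t x → m ℕ.+ d′ ≤ t → t ≤ T →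
    E (Noise t) k (λ ω → W (obs t x ω) 0 m * W (obs t x ω) 0 m) ≤ℚ ι m * K
  E-W²≤-tail : ∀ m t x → suc m ℕ.+ d′ ≤ t → t ≤ T →
    E (Noise t) k (λ ω → W (obs t x ω) 1 m * W (obs t x ω) 1 m) ≤ℚ ι m * K

  E-W²≤ zero t x _ _ = ℚ.≤-reflexive (trans (E-const (Noise t) k (Noise-isProb t) 0ℚ) (sym (ℚ.*-zeroˡ K)))
  E-W²≤ (suc m) t x le t≤T = begin
    E (Noise t) k (λ ω → (G ω + Z ω) * (G ω + Z ω))
      ≡⟨ E-cong (Noise t) k (λ ω → solve 2 (λ g v → (g :+ v) :* (g :+ v) := (g :* g :+ con 2ℚ :* (g :* v)) :+ v :* v) refl (G ω) (Z ω)) ⟩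
    E (Noise t) k (λ ω → (G ω * G ω + 2ℚ * (G ω * Z ω)) + Z ω * Z ω)
      ≡⟨ trans (E-+ (Noise t) k _ _) (cong (_+ E (Noise t) k (λ ω → Z ω * Z ω))
           (trans (E-+ (Noise t) k _ _) (cong (E (Noise t) k (λ ω → G ω * G ω) +_) (E-*ˡ (Noise t) k 2ℚ _)))) ⟩
    (E (Noise t) k (λ ω → G ω * G ω) + 2ℚ * E (Noise t) k (λ ω → G ω * Z ω)) + E (Noise t) k (λ ω → Z ω * Z ω)
      ≤⟨ ℚ.+-mono-≤ (ℚ.+-mono-≤
           (E-≤ (Noise t) k (Noise-isProb t) (λ ω → ℚ.≤-trans (p≤∣p∣ _) (∣*∣≤ (∣g∣≤2 (obs t x ω) 0) (∣g∣≤2 (obs t x ω) 0))))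
           (*-monoˡ {c = 2ℚ} (ℚ.nonNegative⁻¹ 2ℚ) (ℚ.≤-trans (p≤∣p∣ _) (∣E-gW∣≤ d′ 1 (ℕ.+-comm d′ 1) t x m le t≤T))))
           (E-W²≤-tail m t x le t≤T) ⟩
    K + ι m * K
      ≡⟨ solve 2 (λ k m → k :+ m :* k := (con 1ℚ :+ m) :* k) refl K (ι m) ⟩
    ι (suc m) * K ∎
    where
    open ℚ.≤-Reasoning
    G Z : Outcome (Noise t) → ℚ
    G ω = g (obs t x ω) 0
    Z ω = W (obs t x ω) 1 m

  E-W²≤-tail m (suc t) x (s≤s le) t<T = subst (_≤ℚ ι m * K)
    (sym (trans (E-Noise-suc t _) (E-cong Step k (λ ν → E-cong (Noise t) k (λ ω →
      cong (λ w → w * w) (W-shift (obs (suc t) x (consΠ ν ω)) 0 m))))))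
    (E-≤ Step k Step-isProb (λ ν → E-W²≤ m t (step ν x) le (ℕ.<⇒≤ t<T)))

-- Comparison of meeting probabilities for the lazy walk.

-- The average at the point `suc j`, indexed to avoid subtraction: when both ends of a distance
-- `2 (j + 1)` move by one, half the distance becomes `j`, `j + 1` (twice) or `j + 2`. The nesting
-- is that of `avg₂`.
lazy : (ℕ → ℚ) → ℕ → ℚ
lazy f j = ½ * (½ * (f (suc j) + f j) + ½ * (f (suc (suc j)) + f (suc j)))

-- The probability that two lineages at distance 2 j meet alive within i steps;
-- hit j tells whether distance 2 j is 0 on the cycle.
r : ℚ → (ℕ → Bool) → ℕ → ℕ → ℚ
r α hit zero    j       = 𝟙 (hit j)
r α hit (suc i) zero    = 1ℚ
r α hit (suc i) (suc j) = if hit (suc j) then 1ℚ else α * (α * lazy (r α hit i) j)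

private
  0≤½ : 0ℚ ≤ℚ ½
  0≤½ = ℚ.nonNegative⁻¹ ½

lazy-mono : ∀ {f g} j → f j ≤ℚ g j → f (suc j) ≤ℚ g (suc j) → f (suc (suc j)) ≤ℚ g (suc (suc j)) →
  lazy f j ≤ℚ lazy g j
lazy-mono j p q s = *-monoˡ 0≤½ (ℚ.+-mono-≤ (*-monoˡ 0≤½ (ℚ.+-mono-≤ q p)) (*-monoˡ 0≤½ (ℚ.+-mono-≤ s q)))

lazy-const : ∀ c j → lazy (λ _ → c) j ≡ c
lazy-const c j = solve 1 (λ c → con ½ :* (con ½ :* (c :+ c) :+ con ½ :* (c :+ c)) := c) refl c

^≤1 : ∀ {c} → 0ℚ ≤ℚ c → c ≤ℚ 1ℚ → ∀ i → c ^ i ≤ℚ 1ℚ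
^≤1 0≤c c≤1 zero    = ℚ.≤-refl
^≤1 {c} 0≤c c≤1 (suc i) = *-mono {b = 1ℚ} {d = 1ℚ} 0≤1 (0≤^ 0≤c i) c≤1 (^≤1 0≤c c≤1 i)

module _ {α b : ℚ} (0≤α : 0ℚ ≤ℚ α) (α≤b : α ≤ℚ b) (b≤1 : b ≤ℚ 1ℚ) where

  private
    αα≤b : α * (α * 1ℚ) ≤ℚ b
    αα≤b = subst₂ _≤ℚ_ (cong (α *_) (sym (ℚ.*-identityʳ α))) (ℚ.*-identityʳ b)
      (*-mono (ℚ.≤-trans 0≤α α≤b) 0≤α α≤b (ℚ.≤-trans α≤b b≤1))

  0≤r : ∀ hit i j → 0ℚ ≤ℚ r α hit i j
  0≤r hit zero j with hit j
  ... | true  = 0≤1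
  ... | false = ℚ.≤-refl
  0≤r hit (suc i) zero = 0≤1
  0≤r hit (suc i) (suc j) with hit (suc j)
  ... | true  = 0≤1
  ... | false = 0≤* 0≤α (0≤* 0≤α (subst (_≤ℚ lazy (r α hit i) j) (lazy-const 0ℚ j)
    (lazy-mono {λ _ → 0ℚ} {r α hit i} j (0≤r hit i j) (0≤r hit i (suc j)) (0≤r hit i (suc (suc j))))))

  r≤1 : ∀ hit i j → r α hit i j ≤ℚ 1ℚ
  step≤b : ∀ hit i j → α * (α * lazy (r α hit i) j) ≤ℚ b
  step≤b hit i j = ℚ.≤-trans (*-monoˡ 0≤α (*-monoˡ 0≤α (subst (lazy (r α hit i) j ≤ℚ_) (lazy-const 1ℚ j)
    (lazy-mono {r α hit i} {λ _ → 1ℚ} j (r≤1 hit i j) (r≤1 hit i (suc j)) (r≤1 hit i (suc (suc j))))))) αα≤b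

  r≤1 hit zero j with hit j
  ... | true  = ℚ.≤-refl
  ... | false = 0≤1
  r≤1 hit (suc i) zero = ℚ.≤-refl
  r≤1 hit (suc i) (suc j) with hit (suc j)
  ... | true  = ℚ.≤-refl
  ... | false = ℚ.≤-trans (step≤b hit i j) b≤1

  -- Lineages that have not met must both survive at least one more step.
  r-miss≤b : ∀ hit i j → hit (suc j) ≡ false → r α hit i (suc j) ≤ℚ b
  r-miss≤b hit zero j eq rewrite eq = ℚ.≤-trans 0≤α α≤b
  r-miss≤b hit (suc i) j eq rewrite eq = step≤b hit i j

  module _ {a : ℚ} (0≤a : 0ℚ ≤ℚ a) (a≤α : a ≤ℚ α) where

    private
      -- Each of the four joint moves has weight `¼`, so `c` is a lower bound for the weight of one
      -- prescribed move survived by both lineages.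
      ¼ c : ℚ
      ¼ = ½ * ½
      c = a * (a * ¼)

      0≤¼ : 0ℚ ≤ℚ ¼
      0≤¼ = ℚ.nonNegative⁻¹ ¼

      0≤c : 0ℚ ≤ℚ c
      0≤c = 0≤* 0≤a (0≤* 0≤a 0≤¼)

      a≤1 : a ≤ℚ 1ℚ
      a≤1 = ℚ.≤-trans a≤α (ℚ.≤-trans α≤b b≤1)

      c≤1 : c ≤ℚ 1ℚ
      c≤1 = *-mono {b = 1ℚ} {d = 1ℚ} 0≤1 (0≤* 0≤a 0≤¼) a≤1
        (*-mono {b = 1ℚ} {d = 1ℚ} 0≤1 0≤¼ a≤1 (≤-by {¼} (1ℚ - ¼) (ℚ.nonNegative⁻¹ (1ℚ - ¼)) refl))

      c*≤ : ∀ {p q} → 0ℚ ≤ℚ p → ¼ * p ≤ℚ q → c * p ≤ℚ α * (α * q)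
      c*≤ {p} {q} 0≤p le = subst (_≤ℚ α * (α * q))
        (solve 3 (λ a f p → a :* (a :* (f :* p)) := (a :* (a :* f)) :* p) refl a ¼ p)
        (*-mono 0≤α (0≤* 0≤a (0≤* 0≤¼ 0≤p)) a≤α (*-mono 0≤α (0≤* 0≤¼ 0≤p) a≤α le))

    -- Keep only the walk that goes straight to 0: `j` moves, each of weight at least `c`, which fit
    -- into `i` steps.
    r-lower : ∀ hit → hit 0 ≡ true → ∀ i j → j ≤ i → c ^ j ≤ℚ r α hit i j
    r-lower hit hit0 zero    zero _ rewrite hit0 = ℚ.≤-refl
    r-lower hit hit0 (suc i) zero _ = ℚ.≤-refl
    r-lower hit hit0 (suc i) (suc j) (s≤s j≤i) with hit (suc j)
    ... | true  = ^≤1 0≤c c≤1 (suc j)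
    ... | false = c*≤ (0≤^ 0≤c j) (ℚ.≤-trans (*-monoˡ 0≤¼ (r-lower hit hit0 i j j≤i))
      (≤-by (¼ * ((x + x) + y)) (0≤* 0≤¼ (0≤+ (0≤+ (0≤r hit i (suc j)) (0≤r hit i (suc j))) (0≤r hit i (suc (suc j)))))
        (solve 3 (λ x y z → con ½ :* (con ½ :* (x :+ z) :+ con ½ :* (y :+ x))
            := con ½ :* con ½ :* z :+ con ½ :* con ½ :* (x :+ x :+ y)) refl x y (r α hit i j))))
      where
      x = r α hit i (suc j)
      y = r α hit i (suc (suc j))

    -- On 0 ≤ j ≤ m the difference of the two meeting probabilities solves the
    -- same recursion, with boundary values 0 at 0 and at least 1 - b at m.
    module _ (hit₁ hit₂ : ℕ → Bool) (hit₁0 : hit₁ 0 ≡ true) (m : ℕ) (hit₁m : hit₁ m ≡ true)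
             (miss₂ : ∀ j → suc j ≤ m → hit₂ (suc j) ≡ false) where

      -- Within the segment the second walk is absorbed at most at 0, where the first is absorbed
      -- too. Induction on time stays inside it: a point not absorbed for `hit₁` lies strictly below
      -- `m`, so its upper neighbour is still at most `m`.
      r-compare : ∀ i j → j ≤ m → r α hit₂ i j ≤ℚ r α hit₁ i j
      r-compare zero zero _ rewrite hit₁0 = r≤1 hit₂ 0 0
      r-compare zero (suc j) j<m rewrite miss₂ j j<m = 0≤r hit₁ 0 (suc j)
      r-compare (suc i) zero _ = ℚ.≤-refl
      r-compare (suc i) (suc j) j<m with hit₁ (suc j) in eq
      ... | true  = r≤1 hit₂ (suc i) (suc j)
      ... | false rewrite miss₂ j j<m = *-monoˡ 0≤α (*-monoˡ 0≤α (lazy-mono {r α hit₂ i} {r α hit₁ i} j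
              (r-compare i j (ℕ.<⇒≤ j<m)) (r-compare i (suc j) j<m) (r-compare i (suc (suc j)) 1+j<m)))
        where
        1+j<m : suc (suc j) ≤ m
        1+j<m with ℕ.m≤n⇒m<n∨m≡n j<m
        ... | inj₁ lt = lt
        ... | inj₂ refl with () ← trans (sym hit₁m) eq

      -- Follow the `e` upward moves from `suc j` to `m`, each of weight at least `c`; `r-compare`
      -- makes the other terms of the average nonnegative. A point already absorbed for `hit₁` has
      -- the full gap `1 - b`.
      r-gap : ∀ e i j → e ≤ i → e ℕ.+ suc j ≡ m → c ^ e * (1ℚ - b) ≤ℚ r α hit₁ i (suc j) - r α hit₂ i (suc j)
      r-gap-hit : ∀ e i j → hit₁ (suc j) ≡ true → hit₂ (suc j) ≡ false →
        c ^ e * (1ℚ - b) ≤ℚ r α hit₁ i (suc j) - r α hit₂ i (suc j)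
      r-gap-hit e i j eq₁ eq₂ = ℚ.≤-trans
        (subst (c ^ e * (1ℚ - b) ≤ℚ_) (ℚ.*-identityˡ (1ℚ - b))
          (*-mono 0≤1 (≤⇒0≤- b≤1) (^≤1 0≤c c≤1 e) ℚ.≤-refl))
        (ℚ.+-mono-≤ (ℚ.≤-reflexive (sym (r-hit i))) (ℚ.neg-antimono-≤ (r-miss≤b hit₂ i j eq₂)))
        where
        r-hit : ∀ i → r α hit₁ i (suc j) ≡ 1ℚ
        r-hit zero    rewrite eq₁ = refl
        r-hit (suc i) rewrite eq₁ = refl

      r-gap zero    i j _ refl = r-gap-hit zero i j hit₁m (miss₂ j ℕ.≤-refl)
      r-gap (suc e) (suc i) j (s≤s e≤i) eq with hit₁ (suc j) in eq₁ | miss₂ j (subst (suc j ≤_) eq (ℕ.m≤n+m (suc j) (suc e)))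
      ... | true  | eq₂ = subst (λ z → c ^ suc e * (1ℚ - b) ≤ℚ z - r α hit₂ (suc i) (suc j))
        (cong (if_then 1ℚ else α * (α * lazy (r α hit₁ i) j)) eq₁) (r-gap-hit (suc e) (suc i) j eq₁ eq₂)
      ... | false | eq₂ rewrite eq₂ = begin
        c * c ^ e * (1ℚ - b)
          ≡⟨ ℚ.*-assoc c (c ^ e) (1ℚ - b) ⟩
        c * (c ^ e * (1ℚ - b))
          ≤⟨ c*≤ (0≤* (0≤^ 0≤c e) (≤⇒0≤- b≤1)) (ℚ.≤-trans (*-monoˡ 0≤¼ (r-gap e i (suc j) e≤i (trans (ℕ.+-suc e (suc j)) eq)))
               (≤-by (¼ * ((D (suc j) + D (suc j)) + D j))
                 (0≤* 0≤¼ (0≤+ (0≤+ (0≤D (suc j) j<m) (0≤D (suc j) j<m)) (0≤D j (ℕ.<⇒≤ j<m))))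
                 (solve 3 (λ x y z → con ½ :* (con ½ :* (x :+ z) :+ con ½ :* (y :+ x))
                     := con ½ :* con ½ :* y :+ con ½ :* con ½ :* (x :+ x :+ z)) refl (D (suc j)) (D (suc (suc j))) (D j)))) ⟩
        α * (α * lazy D j)
          ≡⟨ solve 7 (λ a x y z x′ y′ z′ →
               a :* (a :* (con ½ :* (con ½ :* ((x :- x′) :+ (z :- z′)) :+ con ½ :* ((y :- y′) :+ (x :- x′)))))
               := a :* (a :* (con ½ :* (con ½ :* (x :+ z) :+ con ½ :* (y :+ x))))
                  :- a :* (a :* (con ½ :* (con ½ :* (x′ :+ z′) :+ con ½ :* (y′ :+ x′))))) refl
               α (r α hit₁ i (suc j)) (r α hit₁ i (suc (suc j))) (r α hit₁ i j)
                 (r α hit₂ i (suc j)) (r α hit₂ i (suc (suc j))) (r α hit₂ i j) ⟩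
        α * (α * lazy (r α hit₁ i) j) - α * (α * lazy (r α hit₂ i) j) ∎
        where
        open ℚ.≤-Reasoning
        D : ℕ → ℚ
        D j = r α hit₁ i j - r α hit₂ i j
        0≤D : ∀ j → j ≤ m → 0ℚ ≤ℚ D j
        0≤D j j≤m = ≤⇒0≤- (r-compare i j j≤m)
        j<m : suc j ≤ m
        j<m = subst (suc j ≤_) eq (ℕ.m≤n+m (suc j) (suc e))

-- Meeting probabilities on the cycle.

parity : ℕ → Bool
parity zero    = false
parity (suc a) = not (parity a)

parity-+-even : ∀ a h → parity (a ℕ.+ (h ℕ.+ h)) ≡ parity a
parity-+-even a zero    = cong parity (ℕ.+-identityʳ a)
parity-+-even a (suc h) = trans (cong parity (trans (ℕ.+-suc a (h ℕ.+ suc h)) (cong (λ z → suc z) (trans (cong (a ℕ.+_) (ℕ.+-suc h h)) (ℕ.+-suc a (h ℕ.+ h))))))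
  (trans (Bool.not-involutive _) (parity-+-even a h))

module Meeting (n : ℕ) (3≤n : 3 ≤ n) (α : ℚ) where

  open Cycle n 3≤n
  open Averaging n 3≤n α

  private
    instance
      n-nonZero : ℕ.NonZero n
      n-nonZero = ℕ.>-nonZero (ℕ.≤-trans (s≤s z≤n) 3≤n)

  hit : ℕ → Bool
  hit j = does (n ∣? j ℕ.+ j)

  ≟-diag : ∀ (u : Fin n) → does (u Fin.≟ u) ≡ true
  ≟-diag u with u Fin.≟ u
  ... | yes _  = refl
  ... | no u≢u = ⊥-elim (u≢u refl)

  meet-diag : ∀ i u → meet i u u ≡ 1ℚ
  meet-diag zero    u rewrite ≟-diag u = refl
  meet-diag (suc i) u rewrite ≟-diag u = refl

  ≟-sym : ∀ (u v : Fin n) → does (u Fin.≟ v) ≡ does (v Fin.≟ u)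
  ≟-sym u v with u Fin.≟ v | v Fin.≟ u
  ... | yes _   | yes _   = refl
  ... | no _    | no _    = refl
  ... | yes u≡v | no v≢u  = ⊥-elim (v≢u (sym u≡v))
  ... | no u≢v  | yes v≡u = ⊥-elim (u≢v (sym v≡u))

  meet-sym : ∀ i u v → meet i u v ≡ meet i v u
  meet-sym zero    u v = cong 𝟙 (≟-sym u v)
  meet-sym (suc i) u v rewrite ≟-sym u v =
    cong (λ z → if does (v Fin.≟ u) then 1ℚ else α * (α * z)) (trans
      (cong₂ (λ p q → ½ * (½ * p + ½ * q))
        (cong₂ _+_ (meet-sym i (succ u) (succ v)) (meet-sym i (succ u) (pred v)))
        (cong₂ _+_ (meet-sym i (pred u) (succ v)) (meet-sym i (pred u) (pred v))))
      (solve 4 (λ a b c d → con ½ :* (con ½ :* (a :+ b) :+ con ½ :* (c :+ d))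
                         := con ½ :* (con ½ :* (a :+ c) :+ con ½ :* (b :+ d))) refl
        (meet i (succ v) (succ u)) (meet i (pred v) (succ u)) (meet i (succ v) (pred u)) (meet i (pred v) (pred u))))

  ≟-pos : ∀ a m → does (pos a Fin.≟ pos (a ℕ.+ m)) ≡ does (n ∣? m)
  ≟-pos a m with pos a Fin.≟ pos (a ℕ.+ m) | n ∣? m
  ... | yes _  | yes _  = refl
  ... | no _   | no _   = refl
  ... | yes eq | no n∤m = ⊥-elim (n∤m (pos-≡⇒∣ a m eq))
  ... | no neq | yes n∣m = ⊥-elim (neq (sym (pos-+-∣ a n∣m)))

  hit0 : hit 0 ≡ true
  hit0 with n ∣? 0
  ... | yes _  = refl
  ... | no n∤0 = ⊥-elim (n∤0 (n ℕ.∣0))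

  private
    shift : ∀ a → pos (suc (a ℕ.+ ℕ.pred n)) ≡ pos a
    shift a = trans (cong pos (trans (sym (ℕ.+-suc a (ℕ.pred n))) (cong (a ℕ.+_) (ℕ.suc-pred n)))) (pos-+-∣ a ℕ.∣-refl)

  -- The base point is first rewritten as a successor, by adding `n`, so that `pred` has an explicit
  -- representative. The four terms of `avg₂` then match those of `lazy` in order.
  meet-even : ∀ i a j → meet i (pos a) (pos (a ℕ.+ (j ℕ.+ j))) ≡ r α hit i j
  meet-even-suc : ∀ i a j → meet i (pos (suc a)) (pos (suc a ℕ.+ (j ℕ.+ j))) ≡ r α hit i j

  meet-even i a j = trans
    (cong₂ (meet i) (sym (shift a)) (trans (sym (shift (a ℕ.+ (j ℕ.+ j)))) (cong (λ z → pos (suc z)) (begin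
      a ℕ.+ (j ℕ.+ j) ℕ.+ ℕ.pred n     ≡⟨ ℕ.+-assoc a _ _ ⟩
      a ℕ.+ (j ℕ.+ j ℕ.+ ℕ.pred n)     ≡⟨ cong (a ℕ.+_) (ℕ.+-comm (j ℕ.+ j) _) ⟩
      a ℕ.+ (ℕ.pred n ℕ.+ (j ℕ.+ j))   ≡⟨ ℕ.+-assoc a _ _ ⟨
      a ℕ.+ ℕ.pred n ℕ.+ (j ℕ.+ j)     ∎))))
    (meet-even-suc i (a ℕ.+ ℕ.pred n) j)
    where open ≡-Reasoning

  meet-even-suc zero    a j       = cong 𝟙 (≟-pos (suc a) (j ℕ.+ j))
  meet-even-suc (suc i) a zero    = trans (cong (λ z → meet (suc i) (pos (suc a)) (pos (suc z))) (ℕ.+-identityʳ a))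
    (meet-diag (suc i) (pos (suc a)))
  meet-even-suc (suc i) a (suc j) rewrite ≟-pos (suc a) (suc j ℕ.+ suc j) =
    cong (λ z → if hit (suc j) then 1ℚ else α * (α * z)) (cong₂ (λ p q → ½ * (½ * p + ½ * q))
      (cong₂ _+_
        (trans (cong₂ (meet i) (succ-pos (suc a)) (succ-pos c)) (meet-even i (2 ℕ.+ a) (suc j)))
        (trans (cong₂ (meet i) (succ-pos (suc a)) (trans pred-c (cong pos (begin
           a ℕ.+ suc (j ℕ.+ suc j)    ≡⟨ cong (λ z → a ℕ.+ suc z) (ℕ.+-suc j j) ⟩
           a ℕ.+ suc (suc (j ℕ.+ j))  ≡⟨ ℕ.+-suc a _ ⟩
           suc (a ℕ.+ suc (j ℕ.+ j))  ≡⟨ cong suc (ℕ.+-suc a _) ⟩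
           2 ℕ.+ a ℕ.+ (j ℕ.+ j)      ∎)))) (meet-even i (2 ℕ.+ a) j)))
      (cong₂ _+_
        (trans (cong₂ (meet i) (pred-pos a) (trans (succ-pos c) (cong pos (begin
           suc (suc (a ℕ.+ (suc j ℕ.+ suc j)))   ≡⟨ cong suc (ℕ.+-suc a _) ⟨
           suc (a ℕ.+ suc (suc j ℕ.+ suc j))     ≡⟨ ℕ.+-suc a _ ⟨
           a ℕ.+ suc (suc (suc j ℕ.+ suc j))     ≡⟨ cong (λ z → a ℕ.+ suc z) (ℕ.+-suc (suc j) (suc j)) ⟨
           a ℕ.+ (suc (suc j) ℕ.+ suc (suc j))   ∎)))) (meet-even i a (suc (suc j))))
        (trans (cong₂ (meet i) (pred-pos a) pred-c) (meet-even i a (suc j)))))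
    where
    open ≡-Reasoning
    c : ℕ
    c = suc a ℕ.+ (suc j ℕ.+ suc j)
    pred-c : pred (pos c) ≡ pos (a ℕ.+ (suc j ℕ.+ suc j))
    pred-c = pred-pos (a ℕ.+ (suc j ℕ.+ suc j))

  meet-two-steps : ∀ i u → meet i u (succ (succ u)) ≡ r α hit i 1
  meet-two-steps i u = trans (cong₂ (meet i) (sym (pos-toℕ u))
    (trans (succ-pos (suc (toℕ u))) (cong pos (ℕ.+-comm 2 (toℕ u))))) (meet-even i (toℕ u) 1)

  -- On an odd cycle one step is the same displacement as `1 + n = 2 (h + 1)` steps, an even number.
  meet-one-step-odd : ∀ h → n ≡ suc (h ℕ.+ h) → ∀ i u → meet i u (succ u) ≡ r α hit i (suc h)
  meet-one-step-odd h n≡ i u = trans (cong₂ (meet i) (sym (pos-toℕ u))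
    (trans (sym (pos-+-∣ (suc (toℕ u)) ℕ.∣-refl)) (cong pos (begin
      suc (toℕ u) ℕ.+ n                ≡⟨ cong (suc (toℕ u) ℕ.+_) n≡ ⟩
      suc (toℕ u) ℕ.+ suc (h ℕ.+ h)    ≡⟨ ℕ.+-suc (toℕ u) _ ⟨
      toℕ u ℕ.+ suc (suc (h ℕ.+ h))    ≡⟨ cong (λ z → toℕ u ℕ.+ suc z) (ℕ.+-suc h h) ⟨
      toℕ u ℕ.+ (suc h ℕ.+ suc h)      ∎)))) (meet-even i (toℕ u) (suc h))
    where open ≡-Reasoning

  module _ (h : ℕ) (n≡ : n ≡ h ℕ.+ h) where

    private
      colour : Fin n → Bool
      colour u = parity (toℕ u)

      parity-% : ∀ a → parity (a % n) ≡ parity a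
      parity-% a = sym (trans (cong parity (ℕ.m≡m%n+[m/n]*n a n)) (go (a / n)))
        where
        go : ∀ q → parity (a % n ℕ.+ q ℕ.* n) ≡ parity (a % n)
        go zero    = cong parity (ℕ.+-identityʳ (a % n))
        go (suc q) = trans (cong parity (trans (cong (a % n ℕ.+_) (ℕ.+-comm n (q ℕ.* n))) (sym (ℕ.+-assoc (a % n) _ n))))
          (trans (cong (λ z → parity (a % n ℕ.+ q ℕ.* n ℕ.+ z)) n≡)
            (trans (parity-+-even (a % n ℕ.+ q ℕ.* n) h) (go q)))

      colour-succ : ∀ u → colour (succ u) ≡ not (colour u)
      colour-succ u = trans (cong parity (toℕ-pos (suc (toℕ u)))) (parity-% (suc (toℕ u)))

      colour-pred : ∀ u → colour (pred u) ≡ not (colour u)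
      colour-pred u = trans (sym (Bool.not-involutive (colour (pred u))))
        (cong not (trans (sym (colour-succ (pred u))) (cong colour (succ-pred u))))

    -- Each step flips the colours of both lineages, so opposite colours stay opposite and the
    -- lineages never coincide.
    meet-bipartite : ∀ i u v → colour u ≡ not (colour v) → meet i u v ≡ 0ℚ
    meet-bipartite i u v eq with u Fin.≟ v in dec
    ... | yes refl = ⊥-elim (Bool.not-¬ refl eq)
    meet-bipartite zero u v eq | no _ rewrite dec = refl
    meet-bipartite (suc i) u v eq | no _ rewrite dec = trans
      (cong (λ z → α * (α * z)) (cong₂ (λ p q → ½ * (½ * p + ½ * q))
        (cong₂ _+_ (next succ succ colour-succ colour-succ) (next succ pred colour-succ colour-pred))
        (cong₂ _+_ (next pred succ colour-pred colour-succ) (next pred pred colour-pred colour-pred))))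
      (solve 1 (λ a → a :* (a :* con 0ℚ) := con 0ℚ) refl α)
      where
      next : (f g : Fin n → Fin n) → (∀ w → colour (f w) ≡ not (colour w)) → (∀ w → colour (g w) ≡ not (colour w)) →
        meet i (f u) (g v) ≡ 0ℚ
      next f g cf cg = meet-bipartite i (f u) (g v) (trans (cf u) (cong not (trans eq (sym (cg v)))))

    M₁-meet-even : ∀ i u → M 1 (meet i u) u ≡ 0ℚ
    M₁-meet-even i u = trans
      (cong₂ (λ p q → α * (½ * (p + q)))
        (meet-bipartite i u (succ u) (trans (sym (Bool.not-involutive _)) (cong not (sym (colour-succ u)))))
        (meet-bipartite i u (pred u) (trans (sym (Bool.not-involutive _)) (cong not (sym (colour-pred u))))))
      (ℚ.*-zeroʳ α)

  M₁-meet-odd : ∀ h → n ≡ suc (h ℕ.+ h) → ∀ i u → M 1 (meet i u) u ≡ α * r α hit i (suc h)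
  M₁-meet-odd h n≡ i u = trans
    (cong₂ (λ p q → α * (½ * (p + q))) (meet-one-step-odd h n≡ i u)
      (trans (meet-sym i u (pred u)) (trans (cong (meet i (pred u)) (sym (succ-pred u))) (meet-one-step-odd h n≡ i (pred u)))))
    (cong (α *_) (avg-const (r α hit i (suc h)) u))

  -- Of the four two-step paths from `u`, two return to `u`, where the lineages have met, and two
  -- end at distance 2.
  M₂-meet : ∀ i u → M 2 (meet i u) u ≡ α * (α * (½ * (r α hit i 1 + 1ℚ)))
  M₂-meet i u = trans
    (cong₂ (λ p q → α * (½ * (α * (½ * p) + α * (½ * q))))
      (cong₂ _+_ (meet-two-steps i u) (trans (cong (meet i u) (pred-succ u)) (meet-diag i u)))
      (cong₂ _+_ (trans (cong (meet i u) (succ-pred u)) (meet-diag i u))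
        (trans (meet-sym i u (pred (pred u)))
          (trans (cong (meet i (pred (pred u))) (sym (trans (cong succ (succ-pred (pred u))) (succ-pred u))))
            (meet-two-steps i (pred (pred u)))))))
    (solve 2 (λ a p → a :* (con ½ :* (a :* (con ½ :* (p :+ con 1ℚ)) :+ a :* (con ½ :* (con 1ℚ :+ p))))
                   := a :* (a :* (con ½ :* (p :+ con 1ℚ)))) refl α (r α hit i 1))

-- Archimedean estimates and geometric decay.

toℚᵘ-ι : ∀ m → toℚᵘ (ι m) ≃ᵘ mkℚᵘ (ℤ.+ m) 0
toℚᵘ-ι zero    = ℚᵘ.≃-refl
toℚᵘ-ι (suc m) = ℚᵘ.≃-trans (ℚ.toℚᵘ-homo-+ 1ℚ (ι m))
  (ℚᵘ.≃-trans (ℚᵘ.+-congʳ (toℚᵘ 1ℚ) (toℚᵘ-ι m))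
    (*≡* (trans (ℤ.*-identityʳ _) (trans (cong (λ z → ℤ.+ 1 ℤ.+ z) (ℤ.*-identityʳ (ℤ.+ m)))
      (sym (ℤ.*-identityʳ (ℤ.+ suc m)))))))

/-*-ι : ∀ c m → (ℤ.+ c ℚ./ suc m) * ι (suc m) ≡ ι c
/-*-ι c m = ℚ.toℚᵘ-injective (begin
  toℚᵘ ((ℤ.+ c ℚ./ suc m) * ι (suc m))          ≈⟨ ℚ.toℚᵘ-homo-* (ℤ.+ c ℚ./ suc m) (ι (suc m)) ⟩
  toℚᵘ (ℤ.+ c ℚ./ suc m) *ᵘ toℚᵘ (ι (suc m))    ≈⟨ ℚᵘ.*-cong (ℚ.toℚᵘ-fromℚᵘ (mkℚᵘ (ℤ.+ c) m)) (toℚᵘ-ι (suc m)) ⟩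
  mkℚᵘ (ℤ.+ c) m *ᵘ mkℚᵘ (ℤ.+ suc m) 0           ≈⟨ *≡* (trans (ℤ.*-identityʳ _) (cong (λ z → ℤ.+ c ℤ.* ℤ.+ z) (sym (ℕ.*-identityʳ (suc m))))) ⟩
  mkℚᵘ (ℤ.+ c) 0                                 ≈⟨ ℚᵘ.≃-sym (toℚᵘ-ι c) ⟩
  toℚᵘ (ι c)                                     ∎)
  where open ℚᵘ.≃-Reasoning

0≤ι : ∀ m → 0ℚ ≤ℚ ι m
0≤ι zero    = ℚ.≤-refl
0≤ι (suc m) = 0≤+ 0≤1 (0≤ι m)

ι-mono : ∀ {m n} → m ≤ n → ι m ≤ℚ ι n
ι-mono {n = n} z≤n = 0≤ι n
ι-mono (s≤s le)    = ℚ.+-monoʳ-≤ 1ℚ (ι-mono le)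

≤-ι : ∀ p → ∃[ m ] p ≤ℚ ι m
≤-ι p@record{} = m , ℚ.toℚᵘ-cancel-≤ (ℚᵘ.≤-respʳ-≃ (ℚᵘ.≃-sym (toℚᵘ-ι m)) (*≤* (bound (ℚ.↥ p))))
  where
  m = ℤ.∣ ℚ.↥ p ∣
  bound : ∀ i → i ℤ.* ℤ.+ 1 ℤ.≤ ℤ.+ ℤ.∣ i ∣ ℤ.* ℚ.↧ p
  bound (ℤ.+ a)      = subst₂ ℤ._≤_ (ℤ.pos-* a 1) (ℤ.pos-* a (ℚ.↧ₙ p)) (ℤ.+≤+ (ℕ.*-monoʳ-≤ a (s≤s z≤n)))
  bound (ℤ.-[1+ a ]) = ℤ.-≤+

archimedean : ∀ p {y} → 0ℚ <ℚ y → ∃[ m ] (∀ s → m ≤ s → p ≤ℚ ι s * y)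
archimedean p {y} 0<y with shrink y 1ℚ 0<y (ℚ.positive⁻¹ 1ℚ)
... | y⁻¹ , 0<y⁻¹ , y*y⁻¹≡1 with ≤-ι (p * y⁻¹)
...   | m , le = m , λ s m≤s → ℚ.≤-trans (ℚ.≤-reflexive (begin
      p                ≡⟨ ℚ.*-identityʳ p ⟨
      p * 1ℚ           ≡⟨ cong (p *_) y*y⁻¹≡1 ⟨
      p * (y * y⁻¹)    ≡⟨ solve 3 (λ p y z → p :* (y :* z) := (p :* z) :* y) refl p y y⁻¹ ⟩
      (p * y⁻¹) * y    ∎))
      (ℚ.*-monoʳ-≤-nonNeg y {{ℚ.nonNegative (ℚ.<⇒≤ 0<y)}} (ℚ.≤-trans le (ι-mono m≤s)))
  where open ≡-Reasoning

-- A reciprocal form of Bernoulli's inequality; the induction rests on `(1 - δ) (1 + (s + 1) δ) = 1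
-- + s δ - (s + 1) δ²`.
bernoulli : ∀ {δ} → 0ℚ ≤ℚ δ → 0ℚ ≤ℚ 1ℚ - δ → ∀ s → (1ℚ - δ) ^ s * (1ℚ + ι s * δ) ≤ℚ 1ℚ
bernoulli {δ} 0≤δ 0≤b zero = ℚ.≤-reflexive (solve 1 (λ d → con 1ℚ :* (con 1ℚ :+ con 0ℚ :* d) := con 1ℚ) refl δ)
bernoulli {δ} 0≤δ 0≤b (suc s) = ℚ.≤-trans
  (≤-by ((1ℚ - δ) ^ s * ((1ℚ + ι s) * (δ * δ)))
    (0≤* (0≤^ 0≤b s) (0≤* (0≤ι (suc s)) (0≤* 0≤δ 0≤δ)))
    (solve 3 (λ d p s → p :* (con 1ℚ :+ s :* d)
        := (con 1ℚ :- d) :* p :* (con 1ℚ :+ (con 1ℚ :+ s) :* d) :+ p :* ((con 1ℚ :+ s) :* (d :* d)))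
      refl δ ((1ℚ - δ) ^ s) (ι s)))
  (bernoulli 0≤δ 0≤b s)

-- For `s` so large that `p ≤ s δ η`, Bernoulli's inequality absorbs the factor `s δ`.
^-decay : ∀ {δ η} → 0ℚ <ℚ δ → 0ℚ ≤ℚ 1ℚ - δ → 0ℚ <ℚ η → ∀ p → ∃[ m ] (∀ s → m ≤ s → (1ℚ - δ) ^ s * p ≤ℚ η)
^-decay {δ} {η} 0<δ 0≤b 0<η p = let m , le = archimedean p {δ * η} (0<* 0<δ 0<η) in m , λ s m≤s → begin
  (1ℚ - δ) ^ s * p                    ≤⟨ *-monoˡ {p} {ι s * (δ * η)} {(1ℚ - δ) ^ s} (0≤^ {1ℚ - δ} 0≤b s) (le s m≤s) ⟩
  (1ℚ - δ) ^ s * (ι s * (δ * η))      ≤⟨ ≤-by ((1ℚ - δ) ^ s * η) (0≤* {(1ℚ - δ) ^ s} (0≤^ {1ℚ - δ} 0≤b s) (ℚ.<⇒≤ 0<η)) (regroup ((1ℚ - δ) ^ s) (ι s)) ⟩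
  (1ℚ - δ) ^ s * (1ℚ + ι s * δ) * η   ≤⟨ ℚ.*-monoʳ-≤-nonNeg η {{ℚ.nonNegative (ℚ.<⇒≤ 0<η)}} (bernoulli {δ} (ℚ.<⇒≤ 0<δ) 0≤b s) ⟩
  1ℚ * η                              ≡⟨ ℚ.*-identityˡ η ⟩
  η                                   ∎
  where
  open ℚ.≤-Reasoning
  regroup : ∀ p s → p * (1ℚ + s * δ) * η ≡ p * (s * (δ * η)) + p * η
  regroup p s = solve 4 (λ p s d e → p :* (con 1ℚ :+ s :* d) :* e := p :* (s :* (d :* e)) :+ p :* e) refl p s δ η

-- One threshold for all late approximations and times.

module _ (n : ℕ) (3≤n : 3 ≤ n) (α : ℕ → ℚ) (cauchy-α : Cauchy α) where

  open Cycle n 3≤n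
  private
    module A k = Averaging n 3≤n (α k)

  cauchy-avg : ∀ (f : ℕ → Fin n → ℚ) → (∀ v → Cauchy (λ k → f k v)) → ∀ u → Cauchy (λ k → avg (f k) u)
  cauchy-avg f cf u = *-cauchy (λ _ → ½) (λ k → f k (succ u) + f k (pred u)) (const-cauchy ½)
    (+-cauchy (λ k → f k (succ u)) (λ k → f k (pred u)) (cf (succ u)) (cf (pred u)))

  cauchy-M : ∀ d (f : ℕ → Fin n → ℚ) → (∀ v → Cauchy (λ k → f k v)) → ∀ u → Cauchy (λ k → A.M k d (f k) u)
  cauchy-M zero    f cf u = cf u
  cauchy-M (suc d) f cf u = *-cauchy α (λ k → avg (A.M k d (f k)) u) cauchy-α
    (cauchy-avg (λ k → A.M k d (f k)) (cauchy-M d f cf) u)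

  -- For a fixed number of steps this is a polynomial in `α k`.
  cauchy-meet : ∀ i u v → Cauchy (λ k → A.meet k i u v)
  cauchy-meet zero u v = const-cauchy (𝟙 (does (u Fin.≟ v)))
  cauchy-meet (suc i) u v with does (u Fin.≟ v)
  ... | true  = const-cauchy 1ℚ
  ... | false = *-cauchy α (λ k → α k * A.avg₂ k (A.meet k i) u v) cauchy-α
    (*-cauchy α (λ k → A.avg₂ k (A.meet k i) u v) cauchy-α
      (cauchy-avg (λ k a → avg (A.meet k i a) v) (λ a → cauchy-avg (λ k → A.meet k i a) (cauchy-meet i a) v) u))

-- Both centres are anchored at one index `k₀` and one time `s`. With `margin` a quarter of the gap,
-- `q` lies at least two margins from either anchored value; one margin is lost to the drift in `k`
-- and `T`, one remains.
module Threshold (δ : ℚ) (0<δ : 0ℚ <ℚ δ) (0≤b : 0ℚ ≤ℚ 1ℚ - δ) (N : ℕ) (c₁ c₂ : ℕ → ℕ → ℚ)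
  (close₁ : ∀ k s T → N ≤ k → s ≤ T → ∣ c₁ k s - c₁ k T ∣ ≤ℚ (1ℚ - δ) ^ s * 2ℚ)
  (close₂ : ∀ k s T → N ≤ k → s ≤ T → ∣ c₂ k s - c₂ k T ∣ ≤ℚ (1ℚ - δ) ^ s * 2ℚ)
  (cauchy₁ : ∀ T → Cauchy (λ k → c₁ k T)) (cauchy₂ : ∀ T → Cauchy (λ k → c₂ k T))
  (g : ℚ) (0<g : 0ℚ <ℚ g) (s₁ : ℕ) (gap : ∀ k T → N ≤ k → s₁ ≤ T → g ≤ℚ c₁ k T - c₂ k T) where

  margin : ℚ
  margin = ½ * (½ * g)

  0<margin : 0ℚ <ℚ margin
  0<margin = half-pos (half-pos 0<g)

  private
    η : ℚ
    η = ½ * margin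

    0<η : 0ℚ <ℚ η
    0<η = half-pos 0<margin

    4margin≡g : (margin + margin) + (margin + margin) ≡ g
    4margin≡g = trans (cong₂ _+_ (half+half (½ * g)) (half+half (½ * g))) (half+half g)

    s₂ : ℕ
    s₂ = proj₁ (^-decay 0<δ 0≤b 0<η 2ℚ)

  s : ℕ
  s = s₁ ⊔ s₂

  private
    decay : (1ℚ - δ) ^ s * 2ℚ ≤ℚ η
    decay = proj₂ (^-decay 0<δ 0≤b 0<η 2ℚ) s (ℕ.m≤n⊔m s₁ s₂)

    K₁ K₂ : ℕ
    K₁ = proj₁ (cauchy₁ s η 0<η)
    K₂ = proj₁ (cauchy₂ s η 0<η)

  k₀ : ℕ
  k₀ = N ⊔ (K₁ ⊔ K₂)

  N≤ : ∀ {k} → k₀ ≤ k → N ≤ k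
  N≤ = ≤-⊔ˡ {N}

  private
    -- First `k` moves at the fixed time `s`, by the Cauchy property, then `T` moves at fixed `k`,
    -- by contraction; each costs half a margin.
    near : ∀ (c : ℕ → ℕ → ℚ) {T K} → (∀ k → N ≤ k → ∣ c k s - c k T ∣ ≤ℚ (1ℚ - δ) ^ s * 2ℚ) →
      (∀ k k′ → K ≤ k → K ≤ k′ → ∣ c k s - c k′ s ∣ <ℚ η) → K ≤ k₀ → ∀ k → k₀ ≤ k →
      ∣ c k₀ s - c k T ∣ ≤ℚ margin
    near c {T} cl h K≤k₀ k k₀≤k = subst (∣ c k₀ s - c k T ∣ ≤ℚ_) (half+half margin)
      (ℚ.≤-trans (∣-∣-triangle (c k₀ s) (c k s) (c k T))
        (ℚ.+-mono-≤ (ℚ.<⇒≤ (h k₀ k K≤k₀ (ℕ.≤-trans K≤k₀ k₀≤k))) (ℚ.≤-trans (cl k (N≤ k₀≤k)) decay)))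

    above : ∀ x y z m → 0ℚ ≤ℚ x - y - ((m + m) + (m + m)) → x - z ≤ℚ m → (y + (m + m)) + m ≤ℚ z
    above x y z m p q = ≤-by ((x - y - ((m + m) + (m + m))) + (m - (x - z))) (0≤+ p (≤⇒0≤- q))
      (solve 4 (λ x y z m → z := ((y :+ (m :+ m)) :+ m) :+ ((x :- y :- ((m :+ m) :+ (m :+ m))) :+ (m :- (x :- z))))
        refl x y z m)

    below : ∀ y z m → - (y - z) ≤ℚ m → z ≤ℚ (y + (m + m)) - m
    below y z m q = ≤-by (m - - (y - z)) (≤⇒0≤- q)
      (solve 3 (λ y z m → (y :+ (m :+ m)) :- m := z :+ (m :- (:- (y :- z)))) refl y z m)

  q : ℚ
  q = c₂ k₀ s + (margin + margin)

  threshold : ∀ k T → k₀ ≤ k → s ≤ T → q + margin ≤ℚ c₁ k T × c₂ k T ≤ℚ q - margin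
  threshold k T k₀≤k s≤T =
      above (c₁ k₀ s) (c₂ k₀ s) (c₁ k T) margin
        (≤⇒0≤- (subst (_≤ℚ c₁ k₀ s - c₂ k₀ s) (sym 4margin≡g) (gap k₀ s (N≤ ℕ.≤-refl) (ℕ.m≤m⊔n s₁ s₂))))
        (ℚ.≤-trans (p≤∣p∣ (c₁ k₀ s - c₁ k T)) (near c₁ (λ k N≤k → close₁ k s T N≤k s≤T)
          (proj₂ (cauchy₁ s η 0<η)) (≤-⊔ˡ {K₁} (≤-⊔ʳ {N} ℕ.≤-refl)) k k₀≤k))
    , below (c₂ k₀ s) (c₂ k T) margin
        (ℚ.≤-trans (-p≤∣p∣ (c₂ k₀ s - c₂ k T)) (near c₂ (λ k N≤k → close₂ k s T N≤k s≤T)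
          (proj₂ (cauchy₂ s η 0<η)) (≤-⊔ʳ {K₁} (≤-⊔ʳ {N} ℕ.≤-refl)) k k₀≤k))

-- From observations to the centred sum.

0≤p² : ∀ p → 0ℚ ≤ℚ p * p
0≤p² p with ℚ.≤-total 0ℚ p
... | inj₁ 0≤p = 0≤* 0≤p 0≤p
... | inj₂ p≤0 = subst (0ℚ ≤ℚ_) (solve 1 (λ p → (:- p) :* (:- p) := p :* p) refl p)
  (0≤* (ℚ.neg-antimono-≤ p≤0) (ℚ.neg-antimono-≤ p≤0))

∣∣²-mono : ∀ {c p} → 0ℚ ≤ℚ c → c ≤ℚ ∣ p ∣ → c * c ≤ℚ p * p
∣∣²-mono {c} {p} 0≤c c≤p = subst (c * c ≤ℚ_)
  (trans (sym (ℚ.∣p*q∣≡∣p∣*∣q∣ p p)) (ℚ.0≤p⇒∣p∣≡p (0≤p² p)))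
  (*-mono (ℚ.0≤∣p∣ p) 0≤c c≤p c≤p)

spin-agree : ∀ x y → spin x * spin y ≡ spin (does (x Bool.≟ y))
spin-agree true  true  = refl
spin-agree true  false = refl
spin-agree false true  = refl
spin-agree false false = refl

module _ (d : ℕ) (R : ℚ) where

  open Excess d R

  -- A sum of `m` signs with `l` positive ones is `2 l - m`. The enumeration `f` is arbitrary so
  -- that the induction can pass to its tail.
  W-count : ∀ (β : ℕ → Bool) {A : Set} {P : Pred A 0ℓ} (P? : Decidable P) m (f : Fin m → A) i →
    (∀ j → spin (β (i ℕ.+ toℕ j)) * spin (β (i ℕ.+ toℕ j ℕ.+ d)) ≡ spin (does (P? (f j)))) →
    W β i m ≡ 2ℚ * ι (length (filter P? (tabulate f))) - ι m - ι m * R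
  W-count β P? zero f i eq = solve 1 (λ r → con 0ℚ := con 2ℚ :* con 0ℚ :- con 0ℚ :- con 0ℚ :* r) refl R
  W-count β P? (suc m) f i eq = trans
    (cong₂ (λ p w → p - R + w)
      (trans (cong (λ z → spin (β z) * spin (β (z ℕ.+ d))) (sym (ℕ.+-identityʳ i))) (eq zero))
      (W-count β P? m (f ∘ suc) (suc i)
        (λ j → trans (cong (λ z → spin (β z) * spin (β (z ℕ.+ d))) (sym (ℕ.+-suc i (toℕ j)))) (eq (suc j)))))
    first
    where
    rest : ℕ
    rest = length (filter P? (tabulate (f ∘ suc)))
    first : spin (does (P? (f zero))) - R + (2ℚ * ι rest - ι m - ι m * R)
      ≡ 2ℚ * ι (length (filter P? (tabulate f))) - ι (suc m) - ι (suc m) * R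
    first with does (P? (f zero))
    ... | true  = solve 3 (λ r l m →
        con 1ℚ :- r :+ (con 2ℚ :* l :- m :- m :* r)
        := con 2ℚ :* (con 1ℚ :+ l) :- (con 1ℚ :+ m) :- (con 1ℚ :+ m) :* r) refl R (ι rest) (ι m)
    ... | false = solve 3 (λ r l m →
        con (- 1ℚ) :- r :+ (con 2ℚ :* l :- m :- m :* r)
        := con 2ℚ :* l :- (con 1ℚ :+ m) :- (con 1ℚ :+ m) :* r) refl R (ι rest) (ι m)

module Observed (ε : ℝ) (k : ℕ) (0≤ε : 0ℚ ≤ℚ seq ε k) (ε≤1 : seq ε k ≤ℚ 1ℚ) (n : ℕ) (3≤n : 3 ≤ n) where

  open Dynamics ε k 0≤ε ε≤1 n 3≤n

  private
    G = cycle n 3≤n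

  -- Removing the first noise amounts to changing the initial configuration; this reconciles the
  -- recursion of `X` on the last step with that of `run` on the first.
  X-suc : ∀ t (X₀ : Config) (ω : Outcome (Noise (suc t))) s (s≤t : s ≤ t) u →
    X {ε} {G} {suc t} (X₀ , ω) (suc s) (s≤s s≤t) u ≡ X {ε} {G} {t} (step (ω zero) X₀ , ω ∘ suc) s s≤t u
  X-suc t X₀ ω zero    s≤t u = refl
  X-suc (suc t) X₀ ω (suc s) (s≤s s≤t) u =
    cong (if proj₁ (ω (suc (fromℕ< (s≤s s≤t))) u) then proj₁ (proj₂ (ω (suc (fromℕ< (s≤s s≤t))) u)) else_)
      (X-suc (suc t) X₀ ω s (ℕ.≤-trans s≤t (ℕ.n≤1+n t)) (proj₂ (proj₂ (ω (suc (fromℕ< (s≤s s≤t))) u))))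

  X≡run : ∀ t X₀ (ω : Outcome (Noise t)) s (s≤t : s ≤ t) u → X {ε} {G} {t} (X₀ , ω) s s≤t u ≡ run t X₀ ω s u
  X≡run t       X₀ ω zero    _         u = refl
  X≡run (suc t) X₀ ω (suc s) (s≤s s≤t) u =
    trans (X-suc t X₀ ω s s≤t u) (X≡run t (step (ω zero) X₀) (ω ∘ suc) s s≤t u)

  lookup-observations : ∀ t X₀ (ω : Outcome (Noise t)) u j .(j≤t : j ℕ.< suc t) →
    Vec.lookup (observations {ε} {G} (X₀ , ω) u) (fromℕ< j≤t) ≡ run t X₀ ω j u
  lookup-observations t X₀ ω u j j≤t = trans
    (lookup∘tabulate (λ s → X {ε} {G} {t} (X₀ , ω) (toℕ s) (ℕ.s≤s⁻¹ (Fin.toℕ<n s)) u) (fromℕ< j≤t))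
    (trans (X≡run t X₀ ω (toℕ (fromℕ< j≤t)) (ℕ.s≤s⁻¹ (Fin.toℕ<n (fromℕ< j≤t))) u)
      (cong (λ s → run t X₀ ω s u) (Fin.toℕ-fromℕ< j≤t)))

  repetitionFrequency : ∀ d t → Fin n → Outcome (NVM ε G t) → ℚ
  repetitionFrequency d t u ω = frequency (length (repetitions d t (observations {ε} {G} ω u))) (t ∸ d)

  excess : ∀ d R t → Fin n → Outcome (NVM ε G t) → ℚ
  excess d R t u ω = Excess.W d R (λ s → run t (proj₁ ω) (proj₂ ω) s u) 1 (t ∸ d)

  -- Agreeing spins have product 1 and differing ones -1, so the mean product is twice the frequency
  -- minus 1. A nonempty range excludes the conventional value of `frequency`.
  frequency-excess : ∀ d R t u ω m → t ∸ d ≡ suc m →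
    (2ℚ * repetitionFrequency d t u ω - 1ℚ - R) * ι (t ∸ d) ≡ excess d R t u ω
  frequency-excess d R t u (X₀ , ω) m t∸d≡ = trans (scaled-count (t ∸ d) t∸d≡)
    (sym (W-count d R (λ s → run t X₀ ω s u) _ (t ∸ d) id 1 (λ j →
      agree (suc (toℕ j)) (suc (toℕ j) ℕ.+ d) (s≤s (ℕ.m+n≤o⇒m≤o (suc (toℕ j)) (bound j))) (s≤s (bound j)))))
    where
    cnt : ℕ
    cnt = length (repetitions d t (observations {ε} {G} (X₀ , ω) u))
    agree : ∀ a b .(a≤t : a ℕ.< suc t) .(b≤t : b ℕ.< suc t) →
      spin (run t X₀ ω a u) * spin (run t X₀ ω b u) ≡
      spin (does (Vec.lookup (observations {ε} {G} (X₀ , ω) u) (fromℕ< a≤t)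
                  Bool.≟ Vec.lookup (observations {ε} {G} (X₀ , ω) u) (fromℕ< b≤t)))
    agree a b a≤t b≤t = trans
      (cong₂ (λ x y → spin x * spin y) (sym (lookup-observations t X₀ ω u a a≤t)) (sym (lookup-observations t X₀ ω u b b≤t)))
      (spin-agree (Vec.lookup (observations {ε} {G} (X₀ , ω) u) (fromℕ< a≤t))
                  (Vec.lookup (observations {ε} {G} (X₀ , ω) u) (fromℕ< b≤t)))
    d≤t : d ≤ t
    d≤t = ℕ.<⇒≤ (ℕ.m∸n≢0⇒n<m {t} {d} (λ eq → ℕ.1+n≢0 (trans (sym t∸d≡) eq)))
    bound : ∀ (j : Fin (t ∸ d)) → suc (toℕ j) ℕ.+ d ≤ t
    bound j = ℕ.m≤o∸n⇒m+n≤o (suc (toℕ j)) d≤t (Fin.toℕ<n j)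
    scaled-count : ∀ M → M ≡ suc m → (2ℚ * frequency cnt M - 1ℚ - R) * ι M ≡ 2ℚ * ι cnt - ι M - ι M * R
    scaled-count _ refl = trans
      (solve 4 (λ two y r m → (two :* y :- con 1ℚ :- r) :* m := two :* (y :* m) :- m :- m :* r) refl
        2ℚ (ℤ.+ cnt ℚ./ suc m) R (ι (suc m)))
      (cong (λ z → 2ℚ * z - ι (suc m) - ι (suc m) * R) (/-*-ι cnt m))

-- Chebyshev's inequality on the product of the two models.

NVM-isProb : ∀ ε k → 0ℚ ≤ℚ seq ε k → seq ε k ≤ℚ 1ℚ → ∀ n (3≤n : 3 ≤ n) t → IsProb (NVM ε (cycle n 3≤n) t) k
NVM-isProb ε k 0≤ε ε≤1 n 3≤n t = ⊗-isProb (⨂ (λ (_ : Fin n) → Bern (ratℝ ½))) (D.Noise t) k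
  (⨂-isProb (λ (_ : Fin n) → Bern (ratℝ ½)) k (λ _ → D.coin-isProb)) (D.Noise-isProb t)
  where module D = Dynamics ε k 0≤ε ε≤1 n 3≤n

E-proj₁ : ∀ Ω₁ Ω₂ k → IsProb Ω₂ k → ∀ F → E (Ω₁ ⊗ Ω₂) k (F ∘ proj₁) ≡ E Ω₁ k F
E-proj₁ Ω₁ Ω₂ k p₂ F = trans (E-⊗ Ω₁ Ω₂ k (F ∘ proj₁)) (E-cong Ω₁ k (λ ω → E-const Ω₂ k p₂ (F ω)))

E-proj₂ : ∀ Ω₁ Ω₂ k → IsProb Ω₁ k → ∀ F → E (Ω₁ ⊗ Ω₂) k (F ∘ proj₂) ≡ E Ω₂ k F
E-proj₂ Ω₁ Ω₂ k p₁ F = trans (E-⊗ Ω₁ Ω₂ k (F ∘ proj₂)) (E-const Ω₁ k p₁ (E Ω₂ k F))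

-- Pointwise form with a union bound: `x` and `y` are normalised squared deviations, at least 1
-- whenever the corresponding event fails.
chebyshev : ∀ {P Q : Set} (p? : Dec P) (q? : Dec Q) {x y} → 0ℚ ≤ℚ x → 0ℚ ≤ℚ y →
  (¬ P → 1ℚ ≤ℚ x) → (¬ Q → 1ℚ ≤ℚ y) → 1ℚ - (x + y) ≤ℚ 𝟙 (does (p? ×-dec q?))
chebyshev (yes _) (yes _) {x} {y} 0≤x 0≤y _ _ =
  ≤-by (x + y) (0≤+ 0≤x 0≤y) (solve 2 (λ x y → con 1ℚ := con 1ℚ :- (x :+ y) :+ (x :+ y)) refl x y)
chebyshev (no ¬p) q? {x} {y} 0≤x 0≤y h _ =
  ≤-by ((x - 1ℚ) + y) (0≤+ (≤⇒0≤- (h ¬p)) 0≤y) (solve 2 (λ x y → con 0ℚ := con 1ℚ :- (x :+ y) :+ ((x :- con 1ℚ) :+ y)) refl x y)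
chebyshev (yes _) (no ¬q) {x} {y} 0≤x 0≤y _ h =
  ≤-by ((y - 1ℚ) + x) (0≤+ (≤⇒0≤- (h ¬q)) 0≤x) (solve 2 (λ x y → con 0ℚ := con 1ℚ :- (x :+ y) :+ ((y :- con 1ℚ) :+ x)) refl x y)

centre : ℝ → ∀ n → 3 ≤ n → ℕ → Fin n → ℕ → ℕ → ℚ
centre ε n 3≤n d u k T = Averaging.M n 3≤n (1ℚ - seq ε k) d (Averaging.meet n 3≤n (1ℚ - seq ε k) T u) u

module Separation (ε : ℝ) (b C : ℚ) (b≤1 : b ≤ℚ 1ℚ) (0≤C : 0ℚ ≤ℚ C) (1+bC≡C : 1ℚ + b * C ≡ C) (N : ℕ)
  (0≤ε : ∀ k → N ≤ k → 0ℚ ≤ℚ seq ε k) (ε≤1 : ∀ k → N ≤ k → seq ε k ≤ℚ 1ℚ)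
  (α≤b : ∀ k → N ≤ k → 1ℚ - seq ε k ≤ℚ b)
  (d′ : ℕ) (c : ℚ) (0<c : 0ℚ <ℚ c) (k₀ s₀ : ℕ) (N≤k₀ : N ≤ k₀) where

  private
    d : ℕ
    d = suc d′

    K : ℚ
    K = MomentBound.momentBound C 0≤C d′

  -- The deterministic half of concentration: closeness to the centre forces `P`. The second moment
  -- supplies the probability of closeness.
  Concentrates : (n : ℕ) → 3 ≤ n → Fin n → (ℚ → Set) → Set
  Concentrates n 3≤n u P = ∀ k T → k₀ ≤ k → s₀ ≤ T → ∀ y →
    ∣ 2ℚ * y - 1ℚ - centre ε n 3≤n d u k T ∣ <ℚ c → P y

  module OneCycle (n : ℕ) (3≤n : 3 ≤ n) (u : Fin n) (k : ℕ) (k₀≤k : k₀ ≤ k) (t : ℕ) (m : ℕ) (t∸d≡ : t ∸ d ≡ suc m) where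

    private
      G = cycle n 3≤n
      N≤k = ℕ.≤-trans N≤k₀ k₀≤k

    open Observed ε k (0≤ε k N≤k) (ε≤1 k N≤k) n 3≤n using (repetitionFrequency; excess; frequency-excess) public

    R : ℚ
    R = centre ε n 3≤n d u k t

    Z : Outcome (NVM ε G t) → ℚ
    Z = excess d R t u

    t∸d+d≡t : t ∸ d ℕ.+ d ≡ t
    t∸d+d≡t = ℕ.m∸n+n≡m (ℕ.<⇒≤ (ℕ.m∸n≢0⇒n<m {t} {d} (λ eq → ℕ.1+n≢0 (trans (sym t∸d≡) eq))))

    -- The bound holds from every initial configuration, so averaging over `X₀` preserves it. The
    -- horizon of the centre is `t` itself.
    E-Z²≤ : E (NVM ε G t) k (λ ω → Z ω * Z ω) ≤ℚ ι (t ∸ d) * K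
    E-Z²≤ = ℚ.≤-trans
      (ℚ.≤-reflexive (E-⊗ (⨂ (λ (_ : Fin n) → Bern (ratℝ ½))) (D.Noise t) k (λ ω → Z ω * Z ω)))
      (E-≤ (⨂ (λ (_ : Fin n) → Bern (ratℝ ½))) k (⨂-isProb (λ (_ : Fin n) → Bern (ratℝ ½)) k (λ _ → D.coin-isProb))
        (λ X₀ → S.E-W²≤-tail (t ∸ d) t X₀
          (ℕ.≤-reflexive (trans (sym (ℕ.+-suc (t ∸ d) d′)) t∸d+d≡t)) ℕ.≤-refl))
      where
      module D = Dynamics ε k (0≤ε k N≤k) (ε≤1 k N≤k) n 3≤n
      module S = SecondMoment ε k (0≤ε k N≤k) (ε≤1 k N≤k) n 3≤n b C (α≤b k N≤k) b≤1 0≤C 1+bC≡C d′ t u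

    far : s₀ ≤ t → ∀ {P} → Concentrates n 3≤n u P → ∀ ω → ¬ P (repetitionFrequency d t u ω) →
      (c * ι (t ∸ d)) * (c * ι (t ∸ d)) ≤ℚ Z ω * Z ω
    far s₀≤t conc ω ¬P = ∣∣²-mono (0≤* (ℚ.<⇒≤ 0<c) (0≤ι (t ∸ d))) (begin
      c * ι (t ∸ d)               ≤⟨ ℚ.*-monoʳ-≤-nonNeg (ι (t ∸ d)) {{ℚ.nonNegative (0≤ι (t ∸ d))}}
                                       (ℚ.≮⇒≥ (λ lt → ¬P (conc k t k₀≤k s₀≤t (repetitionFrequency d t u ω) lt))) ⟩
      ∣ y ∣ * ι (t ∸ d)           ≡⟨ cong (∣ y ∣ *_) (ℚ.0≤p⇒∣p∣≡p (0≤ι (t ∸ d))) ⟨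
      ∣ y ∣ * ∣ ι (t ∸ d) ∣       ≡⟨ ℚ.∣p*q∣≡∣p∣*∣q∣ y (ι (t ∸ d)) ⟨
      ∣ y * ι (t ∸ d) ∣           ≡⟨ cong ∣_∣ (frequency-excess d R t u ω m t∸d≡) ⟩
      ∣ Z ω ∣                     ∎)
      where
      open ℚ.≤-Reasoning
      y : ℚ
      y = 2ℚ * repetitionFrequency d t u ω - 1ℚ - R

  module TwoCycles (n₁ n₂ : ℕ) (h₁ : 3 ≤ n₁) (h₂ : 3 ≤ n₂) (u₁ : Fin n₁) (u₂ : Fin n₂)
    (𝒮₁ 𝒮₂ : Subsetℝ) (disjoint : Disjoint 𝒮₁ 𝒮₂)
    (mem₁? : ∀ y → Dec (Mem 𝒮₁ (ratℝ y))) (mem₂? : ∀ y → Dec (Mem 𝒮₂ (ratℝ y)))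
    (conc₁ : Concentrates n₁ h₁ u₁ (Mem 𝒮₁ ∘ ratℝ)) (conc₂ : Concentrates n₂ h₂ u₂ (Mem 𝒮₂ ∘ ratℝ)) where

    private
      G₁ = cycle n₁ h₁
      G₂ = cycle n₂ h₂

      freq : ∀ G (u : V G) t → Outcome (NVM ε G t) → ℚ
      freq G u t ω = frequency (length (repetitions d t (observations {ε} {G} ω u))) (t ∸ d)

      sep? : ∀ t → Decidable (Separated ε G₁ u₁ G₂ u₂ (repetition d) (λ _ → 𝒮₁) (λ _ → 𝒮₂) t)
      sep? t (ω₁ , ω₂) = mem₁? (freq G₁ u₁ t ω₁) ×-dec mem₂? (freq G₂ u₂ t ω₂)

      Ω : ℕ → FinSpace
      Ω t = NVM ε G₁ t ⊗ NVM ε G₂ t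

      prob₁ : ∀ k → N ≤ k → ∀ t → IsProb (NVM ε G₁ t) k
      prob₁ k N≤k = NVM-isProb ε k (0≤ε k N≤k) (ε≤1 k N≤k) n₁ h₁

      prob₂ : ∀ k → N ≤ k → ∀ t → IsProb (NVM ε G₂ t) k
      prob₂ k N≤k = NVM-isProb ε k (0≤ε k N≤k) (ε≤1 k N≤k) n₂ h₂

      Ω-isProb : ∀ k → N ≤ k → ∀ t → IsProb (Ω t) k
      Ω-isProb k N≤k t = ⊗-isProb (NVM ε G₁ t) (NVM ε G₂ t) k (prob₁ k N≤k t) (prob₂ k N≤k t)

      𝟙≤1 : ∀ β → 𝟙 β ≤ℚ 1ℚ
      𝟙≤1 true  = ℚ.≤-refl
      𝟙≤1 false = 0≤1

      prob≤1 : ∀ k → N ≤ k → ∀ t → seq (prob (Ω t) (sep? t)) k ≤ℚ 1ℚ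
      prob≤1 k N≤k t = subst (_≤ℚ 1ℚ) (sym (seq-prob (Ω t) (sep? t) k))
        (E-≤ (Ω t) k (Ω-isProb k N≤k t) (λ ω → 𝟙≤1 (does (sep? t ω))))

      module _ (k : ℕ) (k₀≤k : k₀ ≤ k) (t : ℕ) (s₀≤t : s₀ ≤ t) (m : ℕ) (t∸d≡ : t ∸ d ≡ suc m)
               (η : ℚ) (large : K + K ≤ℚ ι (t ∸ d) * (c * c * η)) where

        N≤k : N ≤ k
        N≤k = ℕ.≤-trans N≤k₀ k₀≤k

        module O₁ = OneCycle n₁ h₁ u₁ k k₀≤k t m t∸d≡
        module O₂ = OneCycle n₂ h₂ u₂ k k₀≤k t m t∸d≡

        M : ℚ
        M = ι (t ∸ d)

        0<M : 0ℚ <ℚ M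
        0<M = subst (λ z → 0ℚ <ℚ ι z) (sym t∸d≡) (ℚ.<-≤-trans (ℚ.positive⁻¹ 1ℚ)
          (≤-by (ι m) (0≤ι m) refl))

        -- Chebyshev's normalisation: `κ` is the inverse square of the least deviation `c * M` of
        -- the sum when the event fails.
        scale : ∃[ κ ] (0ℚ <ℚ κ × (c * M) * (c * M) * κ ≡ 1ℚ)
        scale = shrink ((c * M) * (c * M)) 1ℚ (0<* (0<* 0<c 0<M) (0<* 0<c 0<M)) (ℚ.positive⁻¹ 1ℚ)

        κ : ℚ
        κ = proj₁ scale

        0≤κ : 0ℚ ≤ℚ κ
        0≤κ = ℚ.<⇒≤ (proj₁ (proj₂ scale))

        1≤κ* : ∀ {z} → (c * M) * (c * M) ≤ℚ z → 1ℚ ≤ℚ κ * z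
        1≤κ* {z} le = subst (_≤ℚ κ * z) (trans (ℚ.*-comm κ ((c * M) * (c * M))) (proj₂ (proj₂ scale))) (*-monoˡ 0≤κ le)

        sq₁ : Outcome (NVM ε G₁ t) → ℚ
        sq₁ ω = O₁.Z ω * O₁.Z ω

        sq₂ : Outcome (NVM ε G₂ t) → ℚ
        sq₂ ω = O₂.Z ω * O₂.Z ω

        pointwise : ∀ ω → 1ℚ + - κ * (sq₁ (proj₁ ω) + sq₂ (proj₂ ω)) ≤ℚ 𝟙 (does (sep? t ω))
        pointwise (ω₁ , ω₂) = subst (_≤ℚ 𝟙 (does (sep? t (ω₁ , ω₂))))
          (solve 3 (λ k x y → con 1ℚ :- (k :* x :+ k :* y) := con 1ℚ :+ (:- k) :* (x :+ y)) refl κ (sq₁ ω₁) (sq₂ ω₂))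
          (chebyshev (mem₁? (freq G₁ u₁ t ω₁)) (mem₂? (freq G₂ u₂ t ω₂))
            (0≤* 0≤κ (0≤p² (O₁.Z ω₁))) (0≤* 0≤κ (0≤p² (O₂.Z ω₂)))
            (λ ¬mem → 1≤κ* (O₁.far s₀≤t {Mem 𝒮₁ ∘ ratℝ} conc₁ ω₁ ¬mem))
            (λ ¬mem → 1≤κ* (O₂.far s₀≤t {Mem 𝒮₂ ∘ ratℝ} conc₂ ω₂ ¬mem)))

        -- The two normalised second moments sum to at most `2 K / (c² M)`, which `large` bounds by
        -- `η`.
        1-η≤prob : 1ℚ - η ≤ℚ seq (prob (Ω t) (sep? t)) k
        1-η≤prob = begin
          1ℚ - η
            ≤⟨ ≤-by (κ * (M * (M * (c * c * η) - (K + K)))) (0≤* 0≤κ (0≤* (0≤ι (t ∸ d)) (≤⇒0≤- large))) budget ⟩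
          1ℚ + - κ * (M * K + M * K)
            ≤⟨ ℚ.+-monoʳ-≤ 1ℚ (subst₂ _≤ℚ_ (neg-* (M * K + M * K)) (neg-* (E₁ + E₂))
                 (ℚ.neg-antimono-≤ (*-monoˡ 0≤κ (ℚ.+-mono-≤ O₁.E-Z²≤ O₂.E-Z²≤)))) ⟩
          1ℚ + - κ * (E₁ + E₂)
            ≡⟨ cong₂ (λ x y → 1ℚ + - κ * (x + y))
                 (E-proj₁ (NVM ε G₁ t) (NVM ε G₂ t) k (prob₂ k N≤k t) sq₁)
                 (E-proj₂ (NVM ε G₁ t) (NVM ε G₂ t) k (prob₁ k N≤k t) sq₂) ⟨
          1ℚ + - κ * (E (Ω t) k (sq₁ ∘ proj₁) + E (Ω t) k (sq₂ ∘ proj₂))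
            ≡⟨ cong₂ (λ x y → x + - κ * y) (E-const (Ω t) k (Ω-isProb k N≤k t) 1ℚ) (E-+ (Ω t) k (sq₁ ∘ proj₁) (sq₂ ∘ proj₂)) ⟨
          E (Ω t) k (λ _ → 1ℚ) + - κ * E (Ω t) k (λ ω → sq₁ (proj₁ ω) + sq₂ (proj₂ ω))
            ≡⟨ cong (E (Ω t) k (λ _ → 1ℚ) +_) (E-*ˡ (Ω t) k (- κ) (λ ω → sq₁ (proj₁ ω) + sq₂ (proj₂ ω))) ⟨
          E (Ω t) k (λ _ → 1ℚ) + E (Ω t) k (λ ω → - κ * (sq₁ (proj₁ ω) + sq₂ (proj₂ ω)))
            ≡⟨ E-+ (Ω t) k (λ _ → 1ℚ) (λ ω → - κ * (sq₁ (proj₁ ω) + sq₂ (proj₂ ω))) ⟨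
          E (Ω t) k (λ ω → 1ℚ + - κ * (sq₁ (proj₁ ω) + sq₂ (proj₂ ω)))
            ≤⟨ E-mono (Ω t) k (proj₁ (Ω-isProb k N≤k t)) pointwise ⟩
          E (Ω t) k (λ ω → 𝟙 (does (sep? t ω)))
            ≡⟨ seq-prob (Ω t) (sep? t) k ⟨
          seq (prob (Ω t) (sep? t)) k ∎
          where
          open ℚ.≤-Reasoning
          E₁ E₂ : ℚ
          E₁ = E (NVM ε G₁ t) k sq₁
          E₂ = E (NVM ε G₂ t) k sq₂
          neg-* : ∀ x → - (κ * x) ≡ - κ * x
          neg-* x = ℚ.neg-distribˡ-* κ x
          budget : 1ℚ + - κ * (M * K + M * K) ≡ 1ℚ - η + κ * (M * (M * (c * c * η) - (K + K)))
          budget = trans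
            (solve 5 (λ κ M K c η →
                con 1ℚ :+ (:- κ) :* (M :* K :+ M :* K)
                := con 1ℚ :- (c :* M) :* (c :* M) :* κ :* η :+ κ :* (M :* (M :* (c :* c :* η) :- (K :+ K))))
              refl κ M K c η)
            (cong (λ z → 1ℚ - z + κ * (M * (M * (c * c * η) - (K + K))))
              (trans (cong (_* η) (proj₂ (proj₂ scale))) (ℚ.*-identityˡ η)))

      limit : (λ t → prob (Ω t) (sep? t)) ⟶ 1ᵣ
      -- From this time on `t - d` exceeds `m₀`: the range is nonempty and long enough for the
      -- bound, whatever `k` is.
      limit δ (δ₀ , 0<δ₀ , N′ , δ₀<) = s₀ ⊔ (suc m₀ ℕ.+ d) , λ t T≤t →
          (η , half-pos 0<δ₀ , k₀ ⊔ N′ , λ k k≥ → begin-strict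
            1ℚ + η                                       ≡⟨ split ⟩
            (1ℚ - η) + (0ℚ + δ₀)                         <⟨ ℚ.+-mono-≤-< (lower t T≤t k (≤-⊔ˡ {k₀} k≥)) (δ₀< k (≤-⊔ʳ {k₀} k≥)) ⟩
            seq (prob (Ω t) (sep? t)) k + seq δ k        ∎)
        , (η , half-pos 0<δ₀ , k₀ ⊔ N′ , λ k k≥ → begin-strict
            seq (prob (Ω t) (sep? t)) k + η              ≤⟨ ℚ.+-mono-≤ (prob≤1 k (ℕ.≤-trans N≤k₀ (≤-⊔ˡ {k₀} k≥)) t)
                                                              (≤-by η (ℚ.<⇒≤ (half-pos 0<δ₀)) (trans (ℚ.+-identityˡ δ₀) (sym (half+half δ₀)))) ⟩
            1ℚ + (0ℚ + δ₀)                               <⟨ ℚ.+-monoʳ-< 1ℚ (δ₀< k (≤-⊔ʳ {k₀} k≥)) ⟩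
            1ℚ + seq δ k                                 ∎)
        where
        open ℚ.≤-Reasoning
        -- Half of `δ₀` pays for the missing probability; the other half is the gap that witnesses
        -- `<ᵣ`.
        η : ℚ
        η = ½ * δ₀
        arch : ∃[ m ] (∀ s → m ≤ s → K + K ≤ℚ ι s * (c * c * η))
        arch = archimedean (K + K) {c * c * η} (0<* (0<* 0<c 0<c) (half-pos 0<δ₀))
        m₀ : ℕ
        m₀ = proj₁ arch
        split : 1ℚ + η ≡ (1ℚ - η) + (0ℚ + δ₀)
        split = trans (solve 1 (λ e → con 1ℚ :+ e := (con 1ℚ :- e) :+ (con 0ℚ :+ (e :+ e))) refl η)
          (cong (λ z → (1ℚ - η) + (0ℚ + z)) (half+half δ₀))
        lower : ∀ t → s₀ ⊔ (suc m₀ ℕ.+ d) ≤ t → ∀ k → k₀ ≤ k → 1ℚ - η ≤ℚ seq (prob (Ω t) (sep? t)) k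
        lower t T≤t k k₀≤k = 1-η≤prob k k₀≤k t (≤-⊔ˡ {s₀} T≤t) (ℕ.pred (t ∸ d))
          (sym (ℕ.suc-pred (t ∸ d) {{ℕ.>-nonZero (ℕ.≤-trans (s≤s z≤n) m₀<)}})) η
          (proj₂ arch (t ∸ d) (ℕ.<⇒≤ m₀<))
          where
          m₀< : suc m₀ ≤ t ∸ d
          m₀< = ℕ.m+n≤o⇒m≤o∸n (suc m₀) (≤-⊔ʳ {s₀} T≤t)

    distinguishable : Distinguishable ε G₁ u₁ G₂ u₂ (repetition d)
    distinguishable = (λ _ → 𝒮₁) , (λ _ → 𝒮₂) , (λ _ → disjoint) , sep? , limit

-- Rational half-lines as distinguishing sets.

0<- : ∀ {a b} → a <ℚ b → 0ℚ <ℚ b - a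
0<- {a} {b} a<b = subst (_<ℚ b - a) (ℚ.+-inverseʳ a) (ℚ.+-monoˡ-< (- a) a<b)

<-by : ∀ {a b} c → 0ℚ <ℚ c → b ≡ a + c → a <ℚ b
<-by {a} {b} c 0<c eq = subst₂ _<ℚ_ (ℚ.+-identityʳ a) (sym eq) (ℚ.+-monoʳ-< a 0<c)

rat-<ᵣ : ∀ {p q} → p <ℚ q → ratℝ p <ᵣ ratℝ q
rat-<ᵣ {p} {q} p<q = ½ * (q - p) , 0<η , 0 , λ _ _ → <-by (½ * (q - p)) 0<η
    (trans (solve 2 (λ p q → q := p :+ (q :- p)) refl p q)
      (trans (cong (p +_) (sym (half+half (q - p)))) (sym (ℚ.+-assoc p (½ * (q - p)) (½ * (q - p))))))
  where
  0<η : 0ℚ <ℚ ½ * (q - p)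
  0<η = half-pos (0<- p<q)

rat-<ᵣ⁻¹ : ∀ {p q} → ratℝ p <ᵣ ratℝ q → p <ℚ q
rat-<ᵣ⁻¹ {p} {q} (δ , 0<δ , N , h) = ℚ.<-trans (<-by δ 0<δ refl) (h N ℕ.≤-refl)

-- The statistic takes rational values, where comparison with a rational threshold is decidable;
-- this yields `sep?`.
_<ᵣ?_ : ∀ p q → Dec (ratℝ p <ᵣ ratℝ q)
p <ᵣ? q = map′ rat-<ᵣ rat-<ᵣ⁻¹ (p ℚ.<? q)

private
  bound-near : ∀ p x y δ → p + δ <ℚ x → ∣ x - y ∣ <ℚ ½ * δ → p + ½ * δ <ℚ y
  bound-near p x y δ p<x x~y = <-by ((x - (p + δ)) + (½ * δ - (x - y)))
    (ℚ.+-mono-< (0<- p<x) (0<- (ℚ.≤-<-trans (p≤∣p∣ (x - y)) x~y)))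
    (trans (solve 5 (λ p x y d h → y := (p :+ (d :- h)) :+ ((x :- (p :+ d)) :+ (h :- (x :- y)))) refl p x y δ (½ * δ))
      (cong (λ z → p + z + ((x - (p + δ)) + (½ * δ - (x - y)))) δ-½δ))
    where
    δ-½δ : δ - ½ * δ ≡ ½ * δ
    δ-½δ = trans (cong (_- ½ * δ) (sym (half+half δ))) (solve 1 (λ h → h :+ h :- h := h) refl (½ * δ))

-- Passing to an equal real costs half of the gap witnessing the inequality. For `below` the
-- argument is applied to the negatives.
above below : ℚ → Subsetℝ
above p = record
  { Mem  = λ x → ratℝ p <ᵣ x
  ; resp = λ { {x} {y} x≈y (δ , 0<δ , N , h) →
      let N′ , near = x≈y (½ * δ) (half-pos 0<δ)
      in ½ * δ , half-pos 0<δ , N ⊔ N′ , λ n n≥ →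
           bound-near p (seq x n) (seq y n) δ (h n (≤-⊔ˡ {N} n≥)) (near n (≤-⊔ʳ {N} n≥)) }
  }
below p = record
  { Mem  = λ x → x <ᵣ ratℝ p
  ; resp = λ { {x} {y} x≈y (δ , 0<δ , N , h) →
      let N′ , near = x≈y (½ * δ) (half-pos 0<δ)
      in ½ * δ , half-pos 0<δ , N ⊔ N′ , λ n n≥ →
           flip (seq y n) (½ * δ) (bound-near (- p) (- seq x n) (- seq y n) δ
             (flip′ (seq x n) δ (h n (≤-⊔ˡ {N} n≥)))
             (subst (_<ℚ ½ * δ) (trans (sym (ℚ.∣-p∣≡∣p∣ (seq x n - seq y n)))
               (cong ∣_∣ (solve 2 (λ x y → :- (x :- y) := (:- x) :- (:- y)) refl (seq x n) (seq y n))))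
               (near n (≤-⊔ʳ {N} n≥)))) }
  }
  where
  flip : ∀ y e → - p + e <ℚ - y → y + e <ℚ p
  flip y e lt = <-by (- y - (- p + e)) (0<- lt) (solve 3 (λ y e p → p := (y :+ e) :+ ((:- y) :- ((:- p) :+ e))) refl y e p)
  flip′ : ∀ y e → y + e <ℚ p → - p + e <ℚ - y
  flip′ y e lt = <-by (p - (y + e)) (0<- lt) (solve 3 (λ y e p → :- y := ((:- p) :+ e) :+ (p :- (y :+ e))) refl y e p)

above-below-disjoint : ∀ p x → ratℝ p <ᵣ x → ¬ (x <ᵣ ratℝ p)
above-below-disjoint p x (δ , 0<δ , N , h) (δ′ , 0<δ′ , N′ , h′) = ℚ.<-irrefl {p} refl
  (ℚ.<-trans (<-by δ 0<δ refl) (ℚ.<-trans (h n (ℕ.m≤m⊔n N N′)) (ℚ.<-trans (<-by δ′ 0<δ′ refl) (h′ n (ℕ.m≤n⊔m N N′)))))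
  where n = N ⊔ N′

-- A frequency `y` corresponds to the correlation `2 y - 1`, so the threshold `q` becomes
-- `½ * (1 + q)`; the margin absorbs the deviation.
above-threshold : ∀ y q m c → q + m ≤ℚ c → ∣ 2ℚ * y - 1ℚ - c ∣ <ℚ m → ½ * (1ℚ + q) <ℚ y
above-threshold y q m c q+m≤c near = <-by (½ * ((c - (q + m)) + (m - - (2ℚ * y - 1ℚ - c))))
  (half-pos (ℚ.≤-<-trans (≤⇒0≤- q+m≤c)
    (<-by (m - - (2ℚ * y - 1ℚ - c)) (0<- (ℚ.≤-<-trans (-p≤∣p∣ (2ℚ * y - 1ℚ - c)) near)) refl)))
  (solve 4 (λ y q m c → y := con ½ :* (con 1ℚ :+ q)
      :+ con ½ :* ((c :- (q :+ m)) :+ (m :- (:- (con 2ℚ :* y :- con 1ℚ :- c))))) refl y q m c)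

below-threshold : ∀ y q m c → c ≤ℚ q - m → ∣ 2ℚ * y - 1ℚ - c ∣ <ℚ m → y <ℚ ½ * (1ℚ + q)
below-threshold y q m c c≤q-m near = <-by (½ * (((q - m) - c) + (m - (2ℚ * y - 1ℚ - c))))
  (half-pos (ℚ.≤-<-trans (≤⇒0≤- c≤q-m)
    (<-by (m - (2ℚ * y - 1ℚ - c)) (0<- (ℚ.≤-<-trans (p≤∣p∣ (2ℚ * y - 1ℚ - c)) near)) refl)))
  (solve 4 (λ y q m c → con ½ :* (con 1ℚ :+ q) := y
      :+ con ½ :* (((q :- m) :- c) :+ (m :- (con 2ℚ :* y :- con 1ℚ :- c)))) refl y q m c)

-- Parity and divisibility.

0<^ : ∀ {c} → 0ℚ <ℚ c → ∀ i → 0ℚ <ℚ c ^ i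
0<^ 0<c zero    = ℚ.positive⁻¹ 1ℚ
0<^ 0<c (suc i) = 0<* 0<c (0<^ 0<c i)

even⊎odd : ∀ n → (∃[ h ] n ≡ h ℕ.+ h) ⊎ (∃[ h ] n ≡ suc (h ℕ.+ h))
even⊎odd zero = inj₁ (0 , refl)
even⊎odd (suc n) with even⊎odd n
... | inj₁ (h , n≡) = inj₂ (h , cong suc n≡)
... | inj₂ (h , n≡) = inj₁ (suc h , cong suc (trans n≡ (sym (ℕ.+-suc h h))))

≢⇒<⊎> : ∀ {m n} → m ≢ n → m ℕ.< n ⊎ n ℕ.< m
≢⇒<⊎> {m} {n} m≢n with ℕ.<-cmp m n
... | tri< m<n _ _ = inj₁ m<n
... | tri≈ _ m≡n _ = ⊥-elim (m≢n m≡n)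
... | tri> _ _ n<m = inj₂ n<m

-- A quotient 0 is excluded by positivity, 1 by parity, and anything larger by size.
odd∤double : ∀ h j → suc j ≤ suc (h ℕ.+ h) → suc j ≢ suc (h ℕ.+ h) → ¬ (suc (h ℕ.+ h) ∣ suc j ℕ.+ suc j)
odd∤double h j le ne (divides zero ())
odd∤double h j le ne (divides 1 eq) = false≢true (begin
  parity (suc j ℕ.+ suc j)       ≡⟨ parity-+-even 0 (suc j) ⟩
  false                          ∎) (begin
  parity (suc j ℕ.+ suc j)       ≡⟨ cong parity (trans eq (ℕ.+-identityʳ _)) ⟩
  parity (1 ℕ.+ (h ℕ.+ h))       ≡⟨ parity-+-even 1 h ⟩
  true                           ∎)
  where
  open ≡-Reasoning
  false≢true : ∀ {x : Bool} → x ≡ false → ¬ (x ≡ true)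
  false≢true refl ()
odd∤double h j le ne (divides (suc (suc q)) eq) = ℕ.<-irrefl eq (ℕ.<-≤-trans
  (ℕ.+-mono-< lt lt) (ℕ.≤-trans (ℕ.≤-reflexive (cong (n ℕ.+_) (sym (ℕ.+-identityʳ n))))
    (ℕ.+-monoʳ-≤ n (ℕ.+-monoʳ-≤ n z≤n))))
  where
  n = suc (h ℕ.+ h)
  lt = ℕ.≤∧≢⇒< le ne

two-step-gap : ∀ g a α x y → 0ℚ ≤ℚ g → 0ℚ ≤ℚ a → a ≤ℚ α → g ≤ℚ x - y →
  a * (a * (½ * g)) ≤ℚ α * (α * (½ * (x + 1ℚ))) - α * (α * (½ * (y + 1ℚ)))
two-step-gap g a α x y 0≤g 0≤a a≤α g≤x-y = subst (a * (a * (½ * g)) ≤ℚ_)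
  (solve 3 (λ α x y → α :* (α :* (con ½ :* (x :- y)))
    := α :* (α :* (con ½ :* (x :+ con 1ℚ))) :- α :* (α :* (con ½ :* (y :+ con 1ℚ)))) refl α x y)
  (*-mono 0≤α (0≤* 0≤a 0≤½g) a≤α (*-mono 0≤α 0≤½g a≤α (*-monoˡ {c = ½} (ℚ.nonNegative⁻¹ ½) g≤x-y)))
  where
  0≤α : 0ℚ ≤ℚ α
  0≤α = ℚ.≤-trans 0≤a a≤α
  0≤½g : 0ℚ ≤ℚ ½ * g
  0≤½g = 0≤* (ℚ.nonNegative⁻¹ ½) 0≤g

-- Constants from `ε` and the case distinction by parity.

module Main (ε : ℝ) (0<ε : 0ᵣ <ᵣ ε) (ε<1 : ε <ᵣ 1ᵣ) where

  -- The gaps witnessing `ε < 1` and `0 < ε` confine `1 - ε` to the interval from `a` to `b` at all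
  -- `k ≥ N`; `C` is `1 / δ`.
  a δ b C : ℚ
  a = proj₁ ε<1
  δ = proj₁ 0<ε
  b = 1ℚ - δ

  0<a : 0ℚ <ℚ a
  0<a = proj₁ (proj₂ ε<1)

  0<δ : 0ℚ <ℚ δ
  0<δ = proj₁ (proj₂ 0<ε)

  N : ℕ
  N = proj₁ (proj₂ (proj₂ 0<ε)) ⊔ proj₁ (proj₂ (proj₂ ε<1))

  δ<ε : ∀ k → N ≤ k → δ <ℚ seq ε k
  δ<ε k N≤k = subst (_<ℚ seq ε k) (ℚ.+-identityˡ δ)
    (proj₂ (proj₂ (proj₂ 0<ε)) k (≤-⊔ˡ N≤k))

  ε+a<1 : ∀ k → N ≤ k → seq ε k + a <ℚ 1ℚ
  ε+a<1 k N≤k = proj₂ (proj₂ (proj₂ ε<1)) k (≤-⊔ʳ {proj₁ (proj₂ (proj₂ 0<ε))} N≤k)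

  ε<1ₖ : ∀ k → N ≤ k → seq ε k <ℚ 1ℚ
  ε<1ₖ k N≤k = ℚ.<-trans (<-by a 0<a refl) (ε+a<1 k N≤k)

  0≤ε : ∀ k → N ≤ k → 0ℚ ≤ℚ seq ε k
  0≤ε k N≤k = ℚ.<⇒≤ (ℚ.<-trans 0<δ (δ<ε k N≤k))

  ε≤1 : ∀ k → N ≤ k → seq ε k ≤ℚ 1ℚ
  ε≤1 k N≤k = ℚ.<⇒≤ (ε<1ₖ k N≤k)

  α : ℕ → ℚ
  α k = 1ℚ - seq ε k

  0≤α : ∀ k → N ≤ k → 0ℚ ≤ℚ α k
  0≤α k N≤k = ≤⇒0≤- (ε≤1 k N≤k)

  a≤α : ∀ k → N ≤ k → a ≤ℚ α k
  a≤α k N≤k = ≤-by (1ℚ - (seq ε k + a)) (≤⇒0≤- (ℚ.<⇒≤ (ε+a<1 k N≤k)))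
    (solve 2 (λ e a → con 1ℚ :- e := a :+ (con 1ℚ :- (e :+ a))) refl (seq ε k) a)

  α≤b : ∀ k → N ≤ k → α k ≤ℚ b
  α≤b k N≤k = ℚ.+-monoʳ-≤ 1ℚ (ℚ.neg-antimono-≤ (ℚ.<⇒≤ (δ<ε k N≤k)))

  0≤b : 0ℚ ≤ℚ b
  0≤b = ℚ.≤-trans (0≤α N ℕ.≤-refl) (α≤b N ℕ.≤-refl)

  b≤1 : b ≤ℚ 1ℚ
  b≤1 = ≤-by δ (ℚ.<⇒≤ 0<δ) (solve 1 (λ d → con 1ℚ := con 1ℚ :- d :+ d) refl δ)

  inverse : ∃[ γ ] (0ℚ <ℚ γ × δ * γ ≡ 1ℚ)
  inverse = shrink δ 1ℚ 0<δ (ℚ.positive⁻¹ 1ℚ)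

  C = proj₁ inverse

  0≤C : 0ℚ ≤ℚ C
  0≤C = ℚ.<⇒≤ (proj₁ (proj₂ inverse))

  1+bC≡C : 1ℚ + b * C ≡ C
  1+bC≡C = trans (solve 2 (λ d c → con 1ℚ :+ (con 1ℚ :- d) :* c := (con 1ℚ :- d :* c) :+ c) refl δ C)
    (trans (cong (λ z → (1ℚ - z) + C) (proj₂ (proj₂ inverse))) (ℚ.+-identityˡ C))

  cauchy-α : Cauchy α
  cauchy-α = +-cauchy (λ _ → 1ℚ) (λ k → - seq ε k) (const-cauchy 1ℚ) (neg-cauchy (seq ε) (cauchy ε))

  centre-cauchy : ∀ n 3≤n d u T → Cauchy (λ k → centre ε n 3≤n d u k T)
  centre-cauchy n 3≤n d u T = cauchy-M n 3≤n α cauchy-α d (λ k → Averaging.meet n 3≤n (α k) T u)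
    (cauchy-meet n 3≤n α cauchy-α T u) u

  centre-close : ∀ n 3≤n d u k s T → N ≤ k → s ≤ T →
    ∣ centre ε n 3≤n d u k s - centre ε n 3≤n d u k T ∣ ≤ℚ b ^ s * 2ℚ
  centre-close n 3≤n d u k s T N≤k s≤T = A.M-meet-close (0≤α k N≤k) (α≤b k N≤k) b≤1 d s T s≤T A.diagonal
    (A.∣meet∣≤1 (0≤α k N≤k) (α≤b k N≤k) b≤1 0) u
    where module A = Averaging n 3≤n (α k)

  module _ (n₁ n₂ : ℕ) (h₁ : 3 ≤ n₁) (h₂ : 3 ≤ n₂) (u₁ : Fin n₁) (u₂ : Fin n₂) (d′ : ℕ)
    (g : ℚ) (0<g : 0ℚ <ℚ g) (s₁ : ℕ)
    (gap : ∀ k T → N ≤ k → s₁ ≤ T → g ≤ℚ centre ε n₁ h₁ (suc d′) u₁ k T - centre ε n₂ h₂ (suc d′) u₂ k T) where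

    private
      module Th = Threshold δ 0<δ 0≤b N (centre ε n₁ h₁ (suc d′) u₁) (centre ε n₂ h₂ (suc d′) u₂)
        (centre-close n₁ h₁ (suc d′) u₁) (centre-close n₂ h₂ (suc d′) u₂)
        (centre-cauchy n₁ h₁ (suc d′) u₁) (centre-cauchy n₂ h₂ (suc d′) u₂) g 0<g s₁ gap

      module Sep = Separation ε b C b≤1 0≤C 1+bC≡C N 0≤ε ε≤1 α≤b d′ Th.margin Th.0<margin Th.k₀ Th.s (Th.N≤ ℕ.≤-refl)

      p : ℚ
      p = ½ * (1ℚ + Th.q)

      high : Sep.Concentrates n₁ h₁ u₁ (λ y → ratℝ p <ᵣ ratℝ y)
      high k T k₀≤k s≤T y near = rat-<ᵣ {p} {y}
        (above-threshold y Th.q Th.margin (centre ε n₁ h₁ (suc d′) u₁ k T) (proj₁ (Th.threshold k T k₀≤k s≤T)) near)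

      low : Sep.Concentrates n₂ h₂ u₂ (λ y → ratℝ y <ᵣ ratℝ p)
      low k T k₀≤k s≤T y near = rat-<ᵣ {y} {p}
        (below-threshold y Th.q Th.margin (centre ε n₂ h₂ (suc d′) u₂ k T) (proj₂ (Th.threshold k T k₀≤k s≤T)) near)

    -- Both orders are delivered because the cycle with the larger correlation need not be the one
    -- named first.
    gap⇒distinguishable :
      Distinguishable ε (cycle n₁ h₁) u₁ (cycle n₂ h₂) u₂ (repetition (suc d′)) ×
      Distinguishable ε (cycle n₂ h₂) u₂ (cycle n₁ h₁) u₁ (repetition (suc d′))
    gap⇒distinguishable =
        Sep.TwoCycles.distinguishable n₁ n₂ h₁ h₂ u₁ u₂ (above p) (below p) (above-below-disjoint p)
          (λ y → p <ᵣ? y) (λ y → y <ᵣ? p) high low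
      , Sep.TwoCycles.distinguishable n₂ n₁ h₂ h₁ u₂ u₁ (below p) (above p)
          (λ x x<p p<x → above-below-disjoint p x p<x x<p)
          (λ y → y <ᵣ? p) (λ y → p <ᵣ? y) low high

  private
    c₀ : ℚ
    c₀ = a * (a * (½ * ½))

    0<½ : 0ℚ <ℚ ½
    0<½ = ℚ.positive⁻¹ ½

    0<c₀ : 0ℚ <ℚ c₀
    0<c₀ = 0<* 0<a (0<* 0<a (0<* 0<½ 0<½))

    0≤a : 0ℚ ≤ℚ a
    0≤a = ℚ.<⇒≤ 0<a

  -- The even cycle has centre 0. On the odd one neighbours are at half-distance `suc j₁`, and a
  -- straight approach bounds the centre from below; the extra factor `a` is the survival of the
  -- lagged step.
  odd-even : ∀ n₁ n₂ (h₁ : 3 ≤ n₁) (h₂ : 3 ≤ n₂) u₁ u₂ j₁ j₂ → n₁ ≡ suc (j₁ ℕ.+ j₁) → n₂ ≡ j₂ ℕ.+ j₂ →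
    Distinguishable ε (cycle n₁ h₁) u₁ (cycle n₂ h₂) u₂ (repetition 1) ×
    Distinguishable ε (cycle n₂ h₂) u₂ (cycle n₁ h₁) u₁ (repetition 1)
  odd-even n₁ n₂ h₁ h₂ u₁ u₂ j₁ j₂ odd even =
    gap⇒distinguishable n₁ n₂ h₁ h₂ u₁ u₂ 0 (a * c₀ ^ suc j₁) (0<* 0<a (0<^ 0<c₀ (suc j₁))) (suc j₁)
      (λ k T N≤k j₁<T → subst (a * c₀ ^ suc j₁ ≤ℚ_) (sym (centres k T))
        (*-mono (0≤α k N≤k) (ℚ.<⇒≤ (0<^ 0<c₀ (suc j₁))) (a≤α k N≤k)
          (r-lower (0≤α k N≤k) (α≤b k N≤k) b≤1 0≤a (a≤α k N≤k) (Meeting.hit n₁ h₁ (α k)) (Meeting.hit0 n₁ h₁ (α k)) T (suc j₁) j₁<T)))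
    where
    centres : ∀ k T → centre ε n₁ h₁ 1 u₁ k T - centre ε n₂ h₂ 1 u₂ k T ≡ α k * r (α k) (Meeting.hit n₁ h₁ (α k)) T (suc j₁)
    centres k T = trans
      (cong₂ _-_ (Meeting.M₁-meet-odd n₁ h₁ (α k) j₁ odd T u₁) (Meeting.M₁-meet-even n₂ h₂ (α k) j₂ even T u₂))
      (ℚ.+-identityʳ (α k * r (α k) (Meeting.hit n₁ h₁ (α k)) T (suc j₁)))

  -- In half-distances the first cycle absorbs at `suc e` and the second nowhere from 1 to `suc e`.
  -- The walk starts at 1 and needs `e` moves to reach the difference.
  nested : ∀ n₁ n₂ (h₁ : 3 ≤ n₁) (h₂ : 3 ≤ n₂) u₁ u₂ e → n₁ ∣ suc e ℕ.+ suc e →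
    (∀ j → suc j ≤ suc e → ¬ (n₂ ∣ suc j ℕ.+ suc j)) →
    Distinguishable ε (cycle n₁ h₁) u₁ (cycle n₂ h₂) u₂ (repetition 2) ×
    Distinguishable ε (cycle n₂ h₂) u₂ (cycle n₁ h₁) u₁ (repetition 2)
  nested n₁ n₂ h₁ h₂ u₁ u₂ e n₁∣ n₂∤ =
    gap⇒distinguishable n₁ n₂ h₁ h₂ u₁ u₂ 1 (a * (a * (½ * (c₀ ^ e * (1ℚ - b)))))
      (0<* 0<a (0<* 0<a (0<* 0<½ (0<* (0<^ 0<c₀ e) 0<1-b)))) e
      (λ k T N≤k e≤T → subst₂ (λ x y → a * (a * (½ * (c₀ ^ e * (1ℚ - b)))) ≤ℚ x - y)
        (sym (Meeting.M₂-meet n₁ h₁ (α k) T u₁)) (sym (Meeting.M₂-meet n₂ h₂ (α k) T u₂))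
        (two-step-gap (c₀ ^ e * (1ℚ - b)) a (α k) (r (α k) hit₁ T 1) (r (α k) hit₂ T 1)
          (ℚ.<⇒≤ (0<* (0<^ 0<c₀ e) 0<1-b)) 0≤a (a≤α k N≤k) (gap k T N≤k e≤T)))
    where
    hit₁ hit₂ : ℕ → Bool
    hit₁ j = does (n₁ ∣? j ℕ.+ j)
    hit₂ j = does (n₂ ∣? j ℕ.+ j)
    0<1-b : 0ℚ <ℚ 1ℚ - b
    0<1-b = subst (0ℚ <ℚ_) (solve 1 (λ d → d := con 1ℚ :- (con 1ℚ :- d)) refl δ) 0<δ
    gap : ∀ k T → N ≤ k → e ≤ T → c₀ ^ e * (1ℚ - b) ≤ℚ r (α k) hit₁ T 1 - r (α k) hit₂ T 1
    gap k T N≤k e≤T = r-gap (0≤α k N≤k) (α≤b k N≤k) b≤1 0≤a (a≤α k N≤k) hit₁ hit₂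
      (dec-true (n₁ ∣? 0) (n₁ ℕ.∣0)) (suc e) (dec-true (n₁ ∣? suc e ℕ.+ suc e) n₁∣)
      (λ j j≤e → dec-false (n₂ ∣? suc j ℕ.+ suc j) (n₂∤ j j≤e)) e T 0 e≤T (ℕ.+-comm e 1)

  -- Here `suc e` is half of `n₁`, and the even distances up to `n₁` are too small to be multiples
  -- of `n₂`.
  even-even : ∀ n₁ n₂ (h₁ : 3 ≤ n₁) (h₂ : 3 ≤ n₂) u₁ u₂ j₁ → n₁ ≡ j₁ ℕ.+ j₁ → n₁ ℕ.< n₂ →
    Distinguishable ε (cycle n₁ h₁) u₁ (cycle n₂ h₂) u₂ (repetition 2) ×
    Distinguishable ε (cycle n₂ h₂) u₂ (cycle n₁ h₁) u₁ (repetition 2)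
  even-even n₁ n₂ () h₂ u₁ u₂ zero refl n₁<n₂
  even-even n₁ n₂ h₁ h₂ u₁ u₂ (suc e) n₁≡ n₁<n₂ = nested n₁ n₂ h₁ h₂ u₁ u₂ e
    (subst (n₁ ∣_) n₁≡ ℕ.∣-refl)
    (λ j j≤e n₂∣ → ℕ.<⇒≱ n₁<n₂ (ℕ.≤-trans (ℕ.∣⇒≤ n₂∣) (ℕ.≤-trans (ℕ.+-mono-≤ j≤e j≤e) (ℕ.≤-reflexive (sym n₁≡)))))

  -- An even distance on an odd cycle vanishes first after two turns, at half-distance `n₁`.
  -- Distances up to `2 n₁` may exceed `n₂`, so `odd∤double` excludes its multiples by parity as
  -- well as size.
  odd-odd : ∀ n₁ n₂ (h₁ : 3 ≤ n₁) (h₂ : 3 ≤ n₂) u₁ u₂ j₁ j₂ → n₁ ≡ suc (j₁ ℕ.+ j₁) → n₂ ≡ suc (j₂ ℕ.+ j₂) → n₁ ℕ.< n₂ →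
    Distinguishable ε (cycle n₁ h₁) u₁ (cycle n₂ h₂) u₂ (repetition 2) ×
    Distinguishable ε (cycle n₂ h₂) u₂ (cycle n₁ h₁) u₁ (repetition 2)
  odd-odd n₁ n₂ h₁ h₂ u₁ u₂ j₁ j₂ refl refl n₁<n₂ = nested n₁ n₂ h₁ h₂ u₁ u₂ (j₁ ℕ.+ j₁)
    (ℕ.∣m∣n⇒∣m+n ℕ.∣-refl ℕ.∣-refl)
    (λ j j<n₁ → odd∤double j₂ j (ℕ.<⇒≤ (ℕ.≤-<-trans j<n₁ n₁<n₂)) (ℕ.<⇒≢ (ℕ.≤-<-trans j<n₁ n₁<n₂)))

  by-parity : ∀ n₁ n₂ (h₁ : 3 ≤ n₁) (h₂ : 3 ≤ n₂) (u₁ : Fin n₁) (u₂ : Fin n₂) →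
    (∃[ h ] n₁ ≡ h ℕ.+ h) ⊎ (∃[ h ] n₁ ≡ suc (h ℕ.+ h)) →
    (∃[ h ] n₂ ≡ h ℕ.+ h) ⊎ (∃[ h ] n₂ ≡ suc (h ℕ.+ h)) →
    n₁ ℕ.< n₂ ⊎ n₂ ℕ.< n₁ →
    Distinguishable ε (cycle n₁ h₁) u₁ (cycle n₂ h₂) u₂ (repetition 1) ⊎
    Distinguishable ε (cycle n₁ h₁) u₁ (cycle n₂ h₂) u₂ (repetition 2)
  by-parity n₁ n₂ h₁ h₂ u₁ u₂ (inj₂ (j₁ , odd₁))  (inj₁ (j₂ , even₂)) _ =
    inj₁ (proj₁ (odd-even n₁ n₂ h₁ h₂ u₁ u₂ j₁ j₂ odd₁ even₂))
  by-parity n₁ n₂ h₁ h₂ u₁ u₂ (inj₁ (j₁ , even₁)) (inj₂ (j₂ , odd₂))  _ =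
    inj₁ (proj₂ (odd-even n₂ n₁ h₂ h₁ u₂ u₁ j₂ j₁ odd₂ even₁))
  by-parity n₁ n₂ h₁ h₂ u₁ u₂ (inj₁ (j₁ , even₁)) (inj₁ (j₂ , even₂)) (inj₁ n₁<n₂) =
    inj₂ (proj₁ (even-even n₁ n₂ h₁ h₂ u₁ u₂ j₁ even₁ n₁<n₂))
  by-parity n₁ n₂ h₁ h₂ u₁ u₂ (inj₁ (j₁ , even₁)) (inj₁ (j₂ , even₂)) (inj₂ n₂<n₁) =
    inj₂ (proj₂ (even-even n₂ n₁ h₂ h₁ u₂ u₁ j₂ even₂ n₂<n₁))
  by-parity n₁ n₂ h₁ h₂ u₁ u₂ (inj₂ (j₁ , odd₁))  (inj₂ (j₂ , odd₂))  (inj₁ n₁<n₂) =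
    inj₂ (proj₁ (odd-odd n₁ n₂ h₁ h₂ u₁ u₂ j₁ j₂ odd₁ odd₂ n₁<n₂))
  by-parity n₁ n₂ h₁ h₂ u₁ u₂ (inj₂ (j₁ , odd₁))  (inj₂ (j₂ , odd₂))  (inj₂ n₂<n₁) =
    inj₂ (proj₂ (odd-odd n₂ n₁ h₂ h₁ u₂ u₁ j₂ j₁ odd₂ odd₁ n₂<n₁))

theorem1p2 : (ε : ℝ) → 0ᵣ <ᵣ ε → ε <ᵣ 1ᵣ →
    (n₁ n₂ : ℕ) (h₁ : 3 ≤ n₁) (h₂ : 3 ≤ n₂) → n₁ ≢ n₂ →
    (u₁ : Fin n₁) (u₂ : Fin n₂) →
    Distinguishable ε (cycle n₁ h₁) u₁ (cycle n₂ h₂) u₂ (repetition 1) ⊎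
    Distinguishable ε (cycle n₁ h₁) u₁ (cycle n₂ h₂) u₂ (repetition 2)
theorem1p2 ε 0<ε ε<1 n₁ n₂ h₁ h₂ n₁≢n₂ u₁ u₂ =
  Main.by-parity ε 0<ε ε<1 n₁ n₂ h₁ h₂ u₁ u₂ (even⊎odd n₁) (even⊎odd n₂) (≢⇒<⊎> n₁≢n₂)
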